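{- There exists a constant $C > 0$ such that for any graph $H$ and any $n\geq C|H|\log^4\chi(H)$ we have that $C_n$ is $H$-good, i.e.\ $R(C_n, H) = (\chi(H)-1)(n-1)+\sigma(H)$.
   Context: For graphs $F,H$, the Ramsey number $R(F,H)$ is the minimum $N$ such that every $N$-vertex graph $G$ either contains $F$ or its complement $\overline{G}$ contains $H$. $C_n$ denotes the cycle on $n$ vertices, $|H|$ the number of vertices of $H$, $\chi(H)$ the chromatic number of $H$, and $\sigma(H)$ the minimum possible size of a colour class in a proper $\chi(H)$-colouring of $H$. $F$ is called $H$-good if $R(F,H)=(\chi(H)-1)(|F|-1)+\sigma(H)$. Logarithms are natural. -}

module Defs where

open import Data.Nat using (ℕ; zero; suc; _+_; _*_; _∸_; _^_; _≤_; _<_; _≡ᵇ_; s≤s; z≤n)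
open import Data.Bool using (Bool; true; false; _∧_; _∨_; not; T)
open import Data.Bool.Properties using (∨-comm)
open import Data.Fin using (Fin; toℕ; _≟_)
open import Data.List using (List; length; filter; allFin)
open import Data.Product using (Σ; _×_; _,_)
open import Data.Sum using (_⊎_)
open import Function.Definitions using (Injective)
open import Relation.Nullary using (¬_; yes; no)
open import Relation.Binary.PropositionalEquality using (_≡_; _≢_; refl)

record Graph (k : ℕ) : Set where
  field
    adj    : Fin k → Fin k → Bool
    sym    : ∀ i j → adj i j ≡ adj j i
    irrefl : ∀ i → adj i i ≡ false
open Graph public

compl : ∀ {k} → Graph k → Graph k
compl {k} G = record { adj = a ; sym = s ; irrefl = r }
  where
  a : Fin k → Fin k → Bool
  a i j with i ≟ j
  ... | yes _ = false
  ... | no  _ = not (adj G i j)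
  s : ∀ i j → a i j ≡ a j i
  s i j with i ≟ j | j ≟ i
  ... | yes _ | yes _ = refl
  ... | yes refl | no q = Data.Empty.⊥-elim (q refl) where import Data.Empty
  ... | no q | yes refl = Data.Empty.⊥-elim (q refl) where import Data.Empty
  ... | no _ | no _ rewrite Graph.sym G i j = refl
  r : ∀ i → a i i ≡ false
  r i with i ≟ i
  ... | yes _ = refl
  ... | no q = Data.Empty.⊥-elim (q refl) where import Data.Empty

_⊆G_ : ∀ {a b} → Graph a → Graph b → Set
_⊆G_ {a} {b} F G =
  Σ (Fin a → Fin b) λ f → Injective _≡_ _≡_ f ×
    (∀ i j → T (adj F i j) → T (adj G (f i) (f j)))

RamseyProperty : ∀ {a b} → Graph a → Graph b → ℕ → Set
RamseyProperty F H N = (G : Graph N) → (F ⊆G G) ⊎ (H ⊆G compl G)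

RamseyNumberIs : ∀ {a b} → Graph a → Graph b → ℕ → Set
RamseyNumberIs F H m = RamseyProperty F H m × (∀ N → N < m → ¬ RamseyProperty F H N)

private
  step : ℕ → ℕ → ℕ → Bool
  step n a b = (suc a ≡ᵇ b) ∨ ((b ≡ᵇ 0) ∧ (suc a ≡ᵇ n))

  suc≢ : ∀ a → (suc a ≡ᵇ a) ≡ false
  suc≢ zero = refl
  suc≢ (suc a) = suc≢ a

  step-irr : ∀ m a → step (3 + m) a a ≡ false
  step-irr m zero = refl
  step-irr m (suc a) rewrite suc≢ (suc a) = refl

Cycle : (n : ℕ) → 3 ≤ n → Graph n
Cycle n p = record
  { adj = λ i j → step n (toℕ i) (toℕ j) ∨ step n (toℕ j) (toℕ i)
  ; sym = λ i j → ∨-comm (step n (toℕ i) (toℕ j)) (step n (toℕ j) (toℕ i))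
  ; irrefl = λ i → irr p (toℕ i) }
  where
  irr : ∀ {n} → 3 ≤ n → ∀ a → (step n a a ∨ step n a a) ≡ false
  irr (s≤s (s≤s (s≤s {n = m} _))) a rewrite step-irr m a = refl

ProperColouring : ∀ {k} → Graph k → ℕ → Set
ProperColouring {k} H q =
  Σ (Fin k → Fin q) λ c → ∀ i j → T (adj H i j) → c i ≢ c j

ChromaticNumberIs : ∀ {k} → Graph k → ℕ → Set
ChromaticNumberIs H q = ProperColouring H q × (∀ r → r < q → ¬ ProperColouring H r)

classSize : ∀ {k q} → (Fin k → Fin q) → Fin q → ℕ
classSize {k} c x = length (filter (λ v → c v ≟ x) (allFin k))

-- σ(H) = s (given χ(H) = q): some proper q-colouring has a colour class of size s,
-- and every colour class of every proper q-colouring has size ≥ s.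
SigmaIs : ∀ {k} → Graph k → ℕ → ℕ → Set
SigmaIs H q s =
  Σ (ProperColouring H q) (λ { (c , _) → Σ (Fin q) λ x → classSize c x ≡ s })
  × (∀ (pc : ProperColouring H q) → ∀ x → s ≤ classSize (Data.Product.proj₁ pc) x)
  where import Data.Product

{-# OPTIONS --safe #-}
-- Lower bound: disjoint cliques on n − 1 vertices together with one clique on fewer than σ(H) vertices.
--
-- Upper bound: H is contained in the complete multipartite graph on its colour classes, so it suffices to find, in a
-- graph without C_n, pairwise non-adjacent sets of the sizes of the classes (a "hole"). Induct on the number of classes.
-- Let K = |H| and let X be the vertex set. A set of at least K vertices with fewer than n vertices in its closed
-- neighbourhood can serve as a class, and induction applies to the rest; the same holds for two non-adjacent such sets
-- whose closed neighbourhoods cover at most 2(n − 1) vertices. So assume that neither occurs. Passing repeatedly to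
-- sets with small boundary gives a region W with small boundary in X in which every set of between K and |W|/2
-- vertices has a large boundary; at most log χ(H) steps are possible, because the size is halved each time.
--
-- If W is not much larger than n, any two disjoint sets of K vertices of W are adjacent. After removing a small
-- non-expanding set, Pósa rotations yield a cycle on at least n vertices; cutting out a suitable segment and rotating
-- both ends of the remaining path inside two disjoint halves closes a cycle of length exactly n.
--
-- If W is larger, trees embedded by the Friedman–Pippenger method either produce a hole or two adjacent tips at equal
-- depth, that is, an odd cycle. A chain of such cycles is a path whose length can be varied within a window of 2K.
-- Its ends are joined outside the chain by a longest path, which has at least n vertices by the argument of Chvátal
-- and Erdős. As there is no independent set of K vertices, chords shorten it in steps of at most 2K, until the chain
-- can make up for the difference to n.
module Submission where

open import Defs hiding (sym)
open import Data.Bool using (Bool; true; false; T; _∧_; _∨_; not; if_then_else_)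
open import Data.Bool.Properties using (T?; T-∧; T-∨)
open import Data.Empty using (⊥; ⊥-elim)
open import Data.Fin using (Fin; zero; suc; toℕ; fromℕ; fromℕ<; _≟_; punchOut; cast)
open import Data.Fin.Properties using (any?; all?; toℕ-injective; toℕ<n; toℕ-fromℕ<; toℕ-fromℕ; pigeonhole; punchOut-injective; toℕ-cast)
open import Data.List using (List; []; _∷_; [_]; _++_; length; reverse; map; filter; allFin; take; drop)
open import Data.List.Properties using (length-++; length-reverse; ++-assoc; ++-identityʳ; reverse-++; unfold-reverse; reverse-involutive; length-map; length-take; length-drop; take++drop≡id; drop-all; map-++)
open import Data.List.Membership.Propositional using () renaming (_∈_ to _∈ˡ_; _∉_ to _∉ˡ_)
open import Data.List.Membership.Propositional.Properties using (∈-++⁺ˡ; ∈-++⁺ʳ; ∈-++⁻; ∈-∃++; ∈-filter⁺; ∈-filter⁻; ∈-allFin)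
open import Data.List.Relation.Unary.All using (All; []; _∷_)
import Data.List.Relation.Unary.All as All
import Data.List.Relation.Unary.All.Properties as All
open import Data.List.Relation.Unary.Any using (here; there)
open import Data.List.Relation.Unary.AllPairs using ([]; _∷_)
open import Data.List.Relation.Unary.Unique.Propositional using (Unique)
import Data.List.Relation.Unary.Unique.Propositional.Properties as Unique
open import Data.List.Relation.Binary.Permutation.Propositional using (_↭_; ↭-refl; ↭-sym; ↭-trans; prep; swap; ↭-reflexive)
open import Data.List.Relation.Binary.Permutation.Propositional.Properties using (↭-length; ∈-resp-↭; All-resp-↭; ↭-reverse; shift; ++⁺ˡ; ++⁺ʳ; ++⁺; ++-comm)
open import Data.Nat using (ℕ; zero; suc; _+_; _*_; _∸_; _^_; _≤_; _<_; _≤ᵇ_; _≡ᵇ_; z≤n; s≤s; s≤s⁻¹; _≤?_; _<?_; NonZero; ⌈_/2⌉; ⌊_/2⌋)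
open import Data.Nat.Logarithm using (⌈log₂_⌉; ⌈log₂⌉-mono-≤; ⌈log₂⌈n/2⌉⌉≡⌈log₂n⌉∸1; ⌈log₂2^n⌉≡n)
open import Data.Nat.Properties hiding (_≟_; _≤?_; _<?_; ≤-step)
open import Data.Nat.Properties using (_≤?_)
open import Data.Product using (Σ; ∃; _×_; _,_; proj₁; proj₂; Σ-syntax; ∃-syntax)
open import Data.Sum using (_⊎_; inj₁; inj₂)
open import Data.Unit using (⊤; tt)
open import Function using (_∘_; id; case_of_; Equivalence; mk⇔)
open import Relation.Nullary using (¬_; Dec; yes; no; does)
open import Relation.Nullary.Decidable using (_×-dec_; _⊎-dec_; _→-dec_; ¬?; map′; does-⇔; dec-false)
open import Relation.Binary.PropositionalEquality using (_≡_; _≢_; refl; sym; trans; cong; cong₂; subst)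
open import Data.List.Membership.DecPropositional using () renaming (_∈?_ to ∈-list?)
open import Data.Nat.ListAction using (sum)
open import Data.Nat.DivMod using (_/_; _%_; m≡m%n+[m/n]*n; m%n<n; m/n*n≤m; m/n≤m; m<n*o⇒m/o<n)
open import Data.Nat.Solver using (module +-*-Solver)

-- Linear arithmetic by Farkas certificates

-- Existence is proved under a double negation, `(X → ⊥) → ⊥`: largest sets, longest paths and
-- components then come from a bounded measure without any search. Only at the end does the
-- decidability of subgraph containment turn the contradiction into an embedding. The quantitative
-- obstacle is that no logarithm of |H| may enter. Let L = ⌈log₂ χ⌉ and h = ⌈log₂ |H|⌉. One odd
-- cycle of the chain uses O(h + L) vertices but widens the window by 2h + 1, so a window of 2|H|
-- costs O(|H| L). The trees have at most 2^L groups of tips at depth h below their branching part,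
-- and 2^L h is O(|H| L) as well, although h alone is unrelated to L. This fixes the boundary τ =
-- O(|H| L) that a region must have in order to host the construction. Each passage to a subset with
-- small boundary adds τ to the boundary in X, so L passages lose φ = L τ = O(|H| L²), and n has to
-- exceed a large multiple of this.

infixl 7 _⊕_
infixl 8 _⊛_

data Linear : Set where
  var lit : ℕ → Linear
  _⊕_ : Linear → Linear → Linear
  _⊛_ : ℕ → Linear → Linear

nth : List ℕ → ℕ → ℕ
nth [] _ = 0
nth (x ∷ _) zero = x
nth (_ ∷ xs) (suc i) = nth xs i

eval : List ℕ → Linear → ℕ
eval ρ (var i) = nth ρ i
eval ρ (lit c) = c
eval ρ (a ⊕ b) = eval ρ a + eval ρ b
eval ρ (c ⊛ a) = c * eval ρ a

dot : List ℕ → List ℕ → ℕ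
dot [] _ = 0
dot (_ ∷ _) [] = 0
dot (c ∷ cs) (x ∷ xs) = c * x + dot cs xs

unit : ℕ → List ℕ
unit zero = 1 ∷ []
unit (suc i) = 0 ∷ unit i

infixl 6 _⊞_
_⊞_ : List ℕ → List ℕ → List ℕ
[] ⊞ bs = bs
(a ∷ as) ⊞ [] = a ∷ as
(a ∷ as) ⊞ (b ∷ bs) = a + b ∷ as ⊞ bs

scale : ℕ → List ℕ → List ℕ
scale c = map (c *_)

-- The head of a coefficient list is the constant term.
coefficients : Linear → List ℕ
coefficients (var i) = 0 ∷ unit i
coefficients (lit c) = c ∷ []
coefficients (a ⊕ b) = coefficients a ⊞ coefficients b
coefficients (c ⊛ a) = scale c (coefficients a)

dot-unit : ∀ i xs → dot (unit i) xs ≡ nth xs i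
dot-unit zero [] = refl
dot-unit (suc i) [] = refl
dot-unit zero (x ∷ xs) = trans (+-identityʳ (x + 0)) (+-identityʳ x)
dot-unit (suc i) (x ∷ xs) = dot-unit i xs

dot-⊞ : ∀ as bs xs → dot (as ⊞ bs) xs ≡ dot as xs + dot bs xs
dot-⊞ [] bs xs = refl
dot-⊞ (a ∷ as) [] xs = sym (+-identityʳ _)
dot-⊞ (a ∷ as) (b ∷ bs) [] = refl
dot-⊞ (a ∷ as) (b ∷ bs) (x ∷ xs) rewrite dot-⊞ as bs xs | *-distribʳ-+ x a b =
  trans (+-assoc (a * x) (b * x) _)
    (trans (cong (a * x +_) (trans (sym (+-assoc (b * x) _ _))
        (trans (cong (_+ dot bs xs) (+-comm (b * x) (dot as xs))) (+-assoc (dot as xs) _ _))))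
      (sym (+-assoc (a * x) _ _)))

dot-scale : ∀ c as xs → dot (scale c as) xs ≡ c * dot as xs
dot-scale c [] xs = sym (*-zeroʳ c)
dot-scale c (a ∷ as) [] = sym (*-zeroʳ c)
dot-scale c (a ∷ as) (x ∷ xs) rewrite dot-scale c as xs | *-distribˡ-+ c (a * x) (dot as xs) =
  cong (_+ c * dot as xs) (*-assoc c a x)

eval-coefficients : ∀ ρ e → dot (coefficients e) (1 ∷ ρ) ≡ eval ρ e
eval-coefficients ρ (var i) = dot-unit i ρ
eval-coefficients ρ (lit c) = trans (+-identityʳ (c * 1)) (*-identityʳ c)
eval-coefficients ρ (a ⊕ b) = trans (dot-⊞ (coefficients a) (coefficients b) (1 ∷ ρ))
  (cong₂ _+_ (eval-coefficients ρ a) (eval-coefficients ρ b))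
eval-coefficients ρ (c ⊛ a) = trans (dot-scale c (coefficients a) (1 ∷ ρ)) (cong (c *_) (eval-coefficients ρ a))

infix 4 _≤ᶜ_
_≤ᶜ_ : List ℕ → List ℕ → Bool
[] ≤ᶜ bs = true
(a ∷ as) ≤ᶜ [] = (a ≤ᵇ 0) ∧ (as ≤ᶜ [])
(a ∷ as) ≤ᶜ (b ∷ bs) = (a ≤ᵇ b) ∧ (as ≤ᶜ bs)

T-∧⁻ : ∀ {a b} → T (a ∧ b) → T a × T b
T-∧⁻ = Equivalence.to T-∧

dot-mono : ∀ as bs xs → T (as ≤ᶜ bs) → dot as xs ≤ dot bs xs
dot-mono [] bs xs p = z≤n
dot-mono (a ∷ as) [] [] p = z≤n
dot-mono (a ∷ as) [] (x ∷ xs) p with a≤0 , q ← T-∧⁻ {a ≤ᵇ 0} p =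
  +-mono-≤ (*-monoˡ-≤ x (≤ᵇ⇒≤ a 0 a≤0)) (dot-mono as [] xs q)
dot-mono (a ∷ as) (b ∷ bs) [] p = z≤n
dot-mono (a ∷ as) (b ∷ bs) (x ∷ xs) p with a≤b , q ← T-∧⁻ {a ≤ᵇ b} p =
  +-mono-≤ (*-monoˡ-≤ x (≤ᵇ⇒≤ a b a≤b)) (dot-mono as bs xs q)

infix 6 _≼_ _≐_ _≺_
infix 4 _⊢_

data Fact : Set where
  _≼_ _≐_ : Linear → Linear → Fact

_≺_ : Linear → Linear → Fact
a ≺ b = lit 1 ⊕ a ≼ b

⟦_⟧ : Fact → List ℕ → Set
⟦ a ≼ b ⟧ ρ = eval ρ a ≤ eval ρ b
⟦ a ≐ b ⟧ ρ = eval ρ a ≡ eval ρ b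

-- A certificate lists the multipliers of the hypotheses; an equation takes one multiplier for each direction.
combineˡ combineʳ : List Fact → List ℕ → List ℕ
combineˡ (a ≼ _ ∷ fs) (c ∷ cs) = scale c (coefficients a) ⊞ combineˡ fs cs
combineˡ (a ≐ b ∷ fs) (c ∷ c′ ∷ cs) = scale c (coefficients a) ⊞ (scale c′ (coefficients b) ⊞ combineˡ fs cs)
combineˡ _ _ = []
combineʳ (_ ≼ b ∷ fs) (c ∷ cs) = scale c (coefficients b) ⊞ combineʳ fs cs
combineʳ (a ≐ b ∷ fs) (c ∷ c′ ∷ cs) = scale c (coefficients b) ⊞ (scale c′ (coefficients a) ⊞ combineʳ fs cs)
combineʳ _ _ = []

Hold : List ℕ → List Fact → Set
Hold ρ [] = ⊤
Hold ρ (f ∷ fs) = ⟦ f ⟧ ρ × Hold ρ fs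

scale-≤ : ∀ ρ c a b {x y} → eval ρ a ≤ eval ρ b → dot x (1 ∷ ρ) ≤ dot y (1 ∷ ρ) →
  dot (scale c (coefficients a) ⊞ x) (1 ∷ ρ) ≤ dot (scale c (coefficients b) ⊞ y) (1 ∷ ρ)
scale-≤ ρ c a b {x} {y} a≤b x≤y
  rewrite dot-⊞ (scale c (coefficients a)) x (1 ∷ ρ) | dot-⊞ (scale c (coefficients b)) y (1 ∷ ρ)
        | eval-coefficients ρ (c ⊛ a) | eval-coefficients ρ (c ⊛ b)
  = +-mono-≤ (*-monoʳ-≤ c a≤b) x≤y

combine-≤ : ∀ ρ fs cs → Hold ρ fs → dot (combineˡ fs cs) (1 ∷ ρ) ≤ dot (combineʳ fs cs) (1 ∷ ρ)
combine-≤ ρ [] cs _ = z≤n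
combine-≤ ρ (a ≼ b ∷ fs) [] _ = z≤n
combine-≤ ρ (a ≼ b ∷ fs) (c ∷ cs) (h , hs) = scale-≤ ρ c a b h (combine-≤ ρ fs cs hs)
combine-≤ ρ (a ≐ b ∷ fs) [] _ = z≤n
combine-≤ ρ (a ≐ b ∷ fs) (_ ∷ []) _ = z≤n
combine-≤ ρ (a ≐ b ∷ fs) (c ∷ c′ ∷ cs) (h , hs) =
  scale-≤ ρ c a b (≤-reflexive h) (scale-≤ ρ c′ b a (≤-reflexive (sym h)) (combine-≤ ρ fs cs hs))

-- Comparing coefficients is sound because the variables are natural numbers; the extra 1 on the
-- larger side makes the combined inequality contradictory.
Refutes : List Fact → List ℕ → Bool
Refutes fs cs = (1 ∷ []) ⊞ combineʳ fs cs ≤ᶜ combineˡ fs cs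

refute : ∀ ρ fs cs → T (Refutes fs cs) → Hold ρ fs → ⊥
refute ρ fs cs ok hs = 1+n≰n (≤-trans
  (≤-reflexive (sym (dot-⊞ (1 ∷ []) (combineʳ fs cs) (1 ∷ ρ))))
  (≤-trans (dot-mono ((1 ∷ []) ⊞ combineʳ fs cs) (combineˡ fs cs) (1 ∷ ρ) ok) (combine-≤ ρ fs cs hs)))

data Sequent : Set where
  _⊢_ : List Fact → Fact → Sequent
  _⊢⊥ : List Fact → Sequent

-- The second certificate is only used for the reverse inequality of an equation.
Certified : Sequent → List ℕ → List ℕ → Bool
Certified (fs ⊢ a ≼ b) cs _ = Refutes (b ≺ a ∷ fs) cs
Certified (fs ⊢ a ≐ b) cs ds = Refutes (b ≺ a ∷ fs) cs ∧ Refutes (a ≺ b ∷ fs) ds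
Certified (fs ⊢⊥) cs _ = Refutes fs cs

Curried : List ℕ → List Fact → Set → Set
Curried ρ [] A = A
Curried ρ (f ∷ fs) A = ⟦ f ⟧ ρ → Curried ρ fs A

curried : ∀ {ρ} fs {A} → (Hold ρ fs → A) → Curried ρ fs A
curried [] k = k tt
curried (f ∷ fs) k h = curried fs (λ hs → k (h , hs))

Valid : Sequent → List ℕ → Set
Valid (fs ⊢ f) ρ = Curried ρ fs (⟦ f ⟧ ρ)
Valid (fs ⊢⊥) ρ = Curried ρ fs ⊥

valid-≤ : ∀ ρ a b fs cs → T (Refutes (b ≺ a ∷ fs) cs) → Hold ρ fs → eval ρ a ≤ eval ρ b
valid-≤ ρ a b fs cs ok hs with eval ρ a ≤? eval ρ b
... | yes p = p
... | no ¬p = ⊥-elim (refute ρ (b ≺ a ∷ fs) cs ok (≰⇒> ¬p , hs))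

valid : ∀ S cs ds → T (Certified S cs ds) → ∀ ρ → Valid S ρ
valid (fs ⊢ a ≼ b) cs _ ok ρ = curried fs (valid-≤ ρ a b fs cs ok)
valid (fs ⊢ a ≐ b) cs ds ok ρ with p , q ← T-∧⁻ ok = curried fs λ hs →
  ≤-antisym (valid-≤ ρ a b fs cs p hs) (valid-≤ ρ b a fs ds q hs)
valid (fs ⊢⊥) cs _ ok ρ = curried fs (refute ρ fs cs ok)

Open : ℕ → Set
Open zero = Sequent
Open (suc n) = Linear → Open n

-- The variable bound first has the largest index.
instantiate : ∀ n → Open n → Sequent
instantiate zero S = S
instantiate (suc n) F = instantiate n (F (var n))

Generalise : ℕ → (List ℕ → Set) → List ℕ → Set
Generalise zero P ρ = P ρ
Generalise (suc n) P ρ = ∀ {x} → Generalise n P (x ∷ ρ)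

generalise : ∀ n {P} → (∀ ρ → P ρ) → ∀ ρ → Generalise n P ρ
generalise zero p ρ = p ρ
generalise (suc n) p ρ {x} = generalise n p (x ∷ ρ)

linear : ∀ n (F : Open n) cs ds → T (Certified (instantiate n F) cs ds) → Generalise n (Valid (instantiate n F)) []
linear n F cs ds ok = generalise n (valid (instantiate n F) cs ds ok) []

-- The linear inequalities of the proof, with their certificates.

lin1 = linear 8 (λ a b c d e f g i → a ⊕ b ≐ c ⊕ d ∷ e ⊕ f ≐ g ⊕ i ∷ [] ⊢ a ⊕ e ⊕ (b ⊕ f) ≐ c ⊕ g ⊕ (d ⊕ i))
    (1 ∷ 1 ∷ 0 ∷ 1 ∷ 0 ∷ []) (1 ∷ 0 ∷ 1 ∷ 0 ∷ 1 ∷ []) tt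

lin2 = linear 6 (λ a b c d e f → a ≐ b ⊕ c ∷ d ≐ e ⊕ f ∷ [] ⊢ a ⊕ d ≐ b ⊕ e ⊕ (c ⊕ f)) (1 ∷ 1 ∷ 0 ∷ 1 ∷ 0 ∷ [])
    (1 ∷ 0 ∷ 1 ∷ 0 ∷ 1 ∷ []) tt

lin3 = linear 4 (λ a b c d → a ⊕ b ≐ c ⊕ d ∷ [] ⊢ a ≼ c ⊕ d) (1 ∷ 1 ∷ 0 ∷ []) [] tt

lin4 = linear 4 (λ a b c d → a ⊕ b ≐ c ⊕ d ∷ b ≐ lit 0 ∷ [] ⊢ a ≐ c ⊕ d) (1 ∷ 1 ∷ 0 ∷ 0 ∷ 0 ∷ [])
    (1 ∷ 0 ∷ 1 ∷ 1 ∷ 0 ∷ []) tt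

lin5 = linear 4 (λ a b c d → a ≐ b ⊕ c ∷ b ≼ d ∷ [] ⊢ a ≼ d ⊕ c) (1 ∷ 1 ∷ 0 ∷ 1 ∷ []) [] tt

lin6 = linear 4 (λ a b c d → a ≐ b ⊕ c ∷ a ≼ d ⊕ c ∷ d ≼ b ∷ [] ⊢ a ≐ d ⊕ c) (1 ∷ 0 ∷ 0 ∷ 1 ∷ 0 ∷ [])
    (1 ∷ 0 ∷ 1 ∷ 0 ∷ 1 ∷ []) tt

lin7 = linear 4 (λ a b c d → lit 1 ⊕ a ≼ b ∷ c ≐ a ∷ b ≼ c ⊕ d ∷ [] ⊢ lit 1 ≼ d) (1 ∷ 1 ∷ 1 ∷ 0 ∷ 1 ∷ []) [] tt

lin8 = linear 3 (λ a b c → a ≐ b ∷ c ≐ lit 1 ∷ [] ⊢ a ⊕ c ≐ lit 1 ⊕ b) (1 ∷ 1 ∷ 0 ∷ 1 ∷ 0 ∷ [])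
    (1 ∷ 0 ∷ 1 ∷ 0 ∷ 1 ∷ []) tt

lin9 = linear 3 (λ a b c → a ≼ b ∷ b ≼ c ⊕ lit 0 ∷ [] ⊢ a ≼ c) (1 ∷ 1 ∷ 1 ∷ []) [] tt

lin10 = linear 4 (λ a b c d → a ≼ b ⊕ (lit 1 ⊕ c) ∷ b ≺ d ∷ [] ⊢ a ≼ d ⊕ c) (1 ∷ 1 ∷ 1 ∷ []) [] tt

lin11 = linear 3 (λ a b c → a ≼ lit 1 ⊕ b ∷ c ≺ a ∷ [] ⊢ c ≼ b) (1 ∷ 1 ∷ 1 ∷ []) [] tt

lin12 = linear 6 (λ a b c d e f → a ⊕ b ≼ c ∷ d ≐ a ∷ e ≼ d ∷ c ≼ e ⊕ f ∷ [] ⊢ b ≼ f) (1 ∷ 1 ∷ 1 ∷ 0 ∷ 1 ∷ 1 ∷ []) []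
    tt

lin13 = linear 7 (λ a b c d e f g → a ≼ b ∷ b ≼ c ⊕ d ∷ c ≼ 4 ⊛ e ∷ d ≼ 4 ⊛ f ∷ g ≐ e ⊕ f ∷ [] ⊢ a ≼ 4 ⊛ g)
    (1 ∷ 1 ∷ 1 ∷ 1 ∷ 1 ∷ 0 ∷ 4 ∷ []) [] tt

lin14 = linear 3 (λ a b c → (a ≼ b ∷ a ≐ b ⊕ c ∷ lit 1 ≼ c ∷ []) ⊢⊥) (1 ∷ 0 ∷ 1 ∷ 1 ∷ []) [] tt

lin15 = linear 4 (λ a b c d → a ≐ b ⊕ c ∷ b ≺ d ∷ c ≼ d ∷ [] ⊢ a ≺ d ⊕ d) (1 ∷ 1 ∷ 0 ∷ 1 ∷ 1 ∷ []) [] tt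

lin16 = linear 6 (λ a b c d e f → a ≼ b ∷ c ≼ d ∷ b ⊕ d ≐ e ⊕ f ∷ [] ⊢ a ⊕ c ≼ e ⊕ f) (1 ∷ 1 ∷ 1 ∷ 1 ∷ 0 ∷ []) [] tt

lin17 = linear 4 (λ a b c d → a ≼ b ∷ b ≼ c ⊕ d ∷ d ≐ lit 1 ∷ [] ⊢ a ≼ lit 1 ⊕ c) (1 ∷ 1 ∷ 1 ∷ 1 ∷ 0 ∷ []) [] tt

lin18 = linear 8 (λ a b c d e f g i → a ≼ b ⊕ b ∷ a ⊕ (4 ⊛ b ⊕ c) ≺ d ∷ d ≼ e ⊕ f ∷ e ≼ a ⊕ g ∷ f ≼ i ∷ g ≼ c ∷ [] ⊢ a
    ⊕ a ≺ i) (1 ∷ 2 ∷ 1 ∷ 1 ∷ 1 ∷ 1 ∷ 1 ∷ []) [] tt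

lin19 = linear 5 (λ a b c d e → a ⊕ a ≺ b ∷ b ≼ c ⊕ d ∷ c ≐ lit 1 ∷ d ≼ e ∷ [] ⊢ a ⊕ a ≼ e)
    (1 ∷ 1 ∷ 1 ∷ 1 ∷ 0 ∷ 1 ∷ []) [] tt

lin20 = linear 7 (λ a b c d e f g → (a ⊕ a ≼ b ∷ a ≐ c ⊕ d ∷ d ≐ lit 1 ∷ b ≼ e ∷ e ≼ f ⊕ g ∷ f ≼ c ⊕ c ∷ g ≼ lit 1 ∷
    []) ⊢⊥) (1 ∷ 0 ∷ 2 ∷ 0 ∷ 2 ∷ 1 ∷ 1 ∷ 1 ∷ 1 ∷ []) [] tt

lin21 = linear 4 (λ a b c d → a ≐ b ⊕ c ∷ c ≐ lit 1 ∷ b ≺ d ∷ [] ⊢ a ≼ d ⊕ d) (1 ∷ 1 ∷ 0 ∷ 1 ∷ 0 ∷ 1 ∷ []) [] tt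

lin22 = linear 3 (λ a b c → (a ≼ b ∷ lit 1 ≼ c ∷ a ≐ b ⊕ c ∷ []) ⊢⊥) (1 ∷ 1 ∷ 0 ∷ 1 ∷ []) [] tt

lin23 = linear 4 (λ a b c d → a ≼ b ⊕ c ∷ b ≺ d ∷ c ≺ d ∷ [] ⊢ a ≼ d ⊕ d) (1 ∷ 1 ∷ 1 ∷ 1 ∷ []) [] tt

lin24 = linear 8 (λ a b c d e f g i → a ⊕ b ≼ c ⊕ d ∷ c ≼ e ⊕ e ∷ d ≼ f ⊕ f ∷ g ⊕ i ≐ e ⊕ f ∷ i ⊕ i ≼ b ∷ [] ⊢ a ≼ g ⊕
    g) (1 ∷ 1 ∷ 1 ∷ 1 ∷ 0 ∷ 2 ∷ 1 ∷ []) [] tt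

lin25 = linear 4 (λ a b c d → a ≼ b ⊕ c ∷ b ≼ lit 1 ⊕ d ∷ [] ⊢ a ≼ d ⊕ (lit 1 ⊕ c)) (1 ∷ 1 ∷ 1 ∷ []) [] tt

lin26 = linear 5 (λ a b c d e → a ≼ lit 1 ⊕ b ∷ b ⊕ (lit 1 ⊕ (c ⊕ d)) ≼ e ∷ [] ⊢ a ⊕ (c ⊕ d) ≼ e) (1 ∷ 1 ∷ 1 ∷ []) []
    tt

lin27 = linear 5 (λ a b c d e → a ≼ lit 1 ⊕ b ∷ b ⊕ (lit 1 ⊕ (lit 1 ⊕ (c ⊕ d))) ≼ e ∷ [] ⊢ a ⊕ c ≼ e) (1 ∷ 1 ∷ 1 ∷ [])
    [] tt

lin28 = linear 5 (λ a b c d e → a ≼ b ⊕ (lit 1 ⊕ c) ∷ b ⊕ (lit 1 ⊕ (lit 1 ⊕ (c ⊕ d))) ≼ e ∷ [] ⊢ a ≼ e)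
    (1 ∷ 1 ∷ 1 ∷ []) [] tt

lin29 = linear 6 (λ a b c d e f → a ≼ b ⊕ (lit 1 ⊕ c) ∷ b ⊕ (lit 1 ⊕ (lit 1 ⊕ (c ⊕ d))) ≼ e ∷ f ≼ lit 1 ⊕ a ∷ [] ⊢ f ⊕
    d ≼ e) (1 ∷ 1 ∷ 1 ∷ 1 ∷ []) [] tt

lin30 = linear 5 (λ a b c d e → a ≼ b ⊕ (lit 1 ⊕ c) ∷ d ≼ a ⊕ (lit 1 ⊕ e) ∷ [] ⊢ d ≼ b ⊕ (lit 1 ⊕ (lit 1 ⊕ (c ⊕ e))))
    (1 ∷ 1 ∷ 1 ∷ []) [] tt

lin31 = linear 4 (λ a b c d → a ≼ b ∷ a ≼ c ∷ d ≐ b ⊕ c ∷ [] ⊢ 2 ⊛ a ≼ d) (1 ∷ 1 ∷ 1 ∷ 0 ∷ 1 ∷ []) [] tt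

lin32 = linear 5 (λ a b c d e → a ≼ b ∷ lit 1 ⊕ c ⊕ b ≺ d ∷ [] ⊢ lit 1 ⊕ (c ⊕ e) ⊕ a ≼ e ⊕ d) (1 ∷ 1 ∷ 1 ∷ []) [] tt

lin33 = linear 12 (λ a b c d e f g i j k l m → a ≐ b ∷ b ≼ c ⊕ d ∷ d ≼ e ∷ e ≐ f ⊕ g ∷ g ≐ i ⊕ (lit 1 ⊕ j) ∷ f ≐ k ∷ i
    ≐ k ∷ k ⊕ j ≼ l ⊕ m ∷ [] ⊢ a ≼ c ⊕ (lit 1 ⊕ (l ⊕ m ⊕ (l ⊕ m))))
    (1 ∷ 1 ∷ 0 ∷ 1 ∷ 1 ∷ 1 ∷ 0 ∷ 1 ∷ 0 ∷ 1 ∷ 0 ∷ 1 ∷ 0 ∷ 2 ∷ []) [] tt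

lin34 = linear 11 (λ a b c d e f g i j k l → a ≐ b ⊕ c ∷ b ≐ d ∷ d ≐ e ∷ c ≐ f ⊕ g ∷ f ≐ i ∷ j ≐ i ∷ j ≐ d ⊕
    (lit 1 ⊕ k) ∷ l ≐ k ⊕ g ∷ [] ⊢ a ≐ l ⊕ (lit 1 ⊕ (e ⊕ e)))
    (1 ∷ 1 ∷ 0 ∷ 1 ∷ 0 ∷ 2 ∷ 0 ∷ 1 ∷ 0 ∷ 1 ∷ 0 ∷ 0 ∷ 1 ∷ 1 ∷ 0 ∷ 0 ∷ 1 ∷ [])
    (1 ∷ 0 ∷ 1 ∷ 0 ∷ 1 ∷ 0 ∷ 2 ∷ 0 ∷ 1 ∷ 0 ∷ 1 ∷ 1 ∷ 0 ∷ 0 ∷ 1 ∷ 1 ∷ 0 ∷ []) tt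

lin35 = linear 2 (λ a b → a ≺ lit 1 ∷ [] ⊢ a ⊕ a ≼ b) (1 ∷ 2 ∷ []) [] tt

lin36 = linear 6 (λ a b c d e f → 4 ⊛ a ≺ b ∷ b ≼ c ∷ c ≼ d ⊕ e ∷ d ≼ a ⊕ f ∷ f ≐ lit 1 ∷ [] ⊢ a ⊕ a ≼ e)
    (3 ∷ 2 ∷ 2 ∷ 2 ∷ 2 ∷ 2 ∷ 0 ∷ []) [] tt

lin37 = linear 8 (λ a b c d e f g i → a ⊕ (4 ⊛ b ⊕ c) ≺ d ∷ d ≼ e ∷ e ≼ f ⊕ g ∷ f ≼ a ⊕ i ∷ i ≐ lit 1 ∷ a ≼ b ⊕ b ∷ []
    ⊢ a ⊕ a ≼ g) (1 ∷ 1 ∷ 1 ∷ 1 ∷ 1 ∷ 1 ∷ 0 ∷ 2 ∷ []) [] tt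

lin38 = linear 2 (λ a b → a ≐ lit 1 ∷ lit 2 ≼ b ∷ [] ⊢ a ≼ b) (1 ∷ 1 ∷ 0 ∷ 1 ∷ []) [] tt

lin39 = linear 2 (λ a b → a ≼ lit 1 ⊕ b ∷ b ≐ lit 1 ∷ [] ⊢ a ≼ lit 2) (1 ∷ 1 ∷ 1 ∷ 0 ∷ []) [] tt

lin40 = linear 4 (λ a b c d → a ≼ b ⊕ c ∷ b ≼ d ∷ [] ⊢ a ≼ d ⊕ c) (1 ∷ 1 ∷ 1 ∷ []) [] tt

lin41 = linear 5 (λ a b c d e → a ≐ b ⊕ (lit 1 ⊕ c) ∷ c ≐ d ⊕ e ∷ [] ⊢ a ≐ lit 1 ⊕ (b ⊕ d) ⊕ e)
    (1 ∷ 1 ∷ 0 ∷ 1 ∷ 0 ∷ []) (1 ∷ 0 ∷ 1 ∷ 0 ∷ 1 ∷ []) tt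

lin42 = linear 7 (λ a b c d e f g → a ≐ lit 1 ⊕ (b ⊕ c) ⊕ d ∷ b ≐ e ⊕ (lit 1 ⊕ (f ⊕ f)) ∷ lit 1 ⊕ (f ⊕ f) ⊕ d ≐ g ∷ []
    ⊢ a ≐ lit 1 ⊕ (e ⊕ c) ⊕ g) (1 ∷ 1 ∷ 0 ∷ 1 ∷ 0 ∷ 1 ∷ 0 ∷ []) (1 ∷ 0 ∷ 1 ∷ 0 ∷ 1 ∷ 0 ∷ 1 ∷ []) tt

lin43 = linear 3 (λ a b c → a ⊕ a ≼ b ∷ b ≺ c ∷ [] ⊢ lit 1 ⊕ (a ⊕ a) ≼ c) (1 ∷ 1 ∷ 1 ∷ []) [] tt

lin44 = linear 10 (λ a b c d e f g i j k → a ≐ b ⊕ (lit 1 ⊕ (c ⊕ c)) ∷ lit 1 ⊕ a ≼ d ∷ e ≼ f ⊕ g ∷ e ≐ f ⊕ d ∷ i ⊕ j ⊕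
    lit 2 ≼ k ∷ [] ⊢ lit 1 ⊕ (b ⊕ i) ⊕ (j ⊕ (lit 1 ⊕ (c ⊕ c))) ⊕ lit 2 ≼ k ⊕ g) (1 ∷ 0 ∷ 1 ∷ 1 ∷ 1 ∷ 0 ∷ 1 ∷ 1 ∷ [])
    [] tt

lin45 = linear 4 (λ a b c d → a ≼ b ∷ b ⊕ (lit 1 ⊕ c) ≼ d ∷ [] ⊢ a ≼ d) (1 ∷ 1 ∷ 1 ∷ []) [] tt

lin46 = linear 5 (λ a b c d e → a ≼ b ∷ b ⊕ (lit 1 ⊕ c) ≼ d ∷ e ≼ lit 1 ⊕ a ∷ [] ⊢ e ⊕ c ≼ d) (1 ∷ 1 ∷ 1 ∷ 1 ∷ []) []
    tt

lin47 = linear 1 (λ a → (lit 0 ≐ a ∷ lit 1 ≼ a ∷ []) ⊢⊥) (0 ∷ 1 ∷ 1 ∷ []) [] tt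

lin48 = linear 5 (λ a b c d e → a ⊕ (b ⊕ c) ⊕ (lit 1 ⊕ d) ≼ e ∷ [] ⊢ a ⊕ c ⊕ (lit 1 ⊕ d) ≼ e) (1 ∷ 1 ∷ []) [] tt

lin49 = linear 3 (λ a b c → [] ⊢ a ⊕ b ⊕ (lit 1 ⊕ c) ≐ a ⊕ (lit 1 ⊕ c ⊕ b)) (1 ∷ []) (1 ∷ []) tt

lin50 = linear 3 (λ a b c → [] ⊢ a ⊕ b ⊕ c ≐ a ⊕ (c ⊕ b)) (1 ∷ []) (1 ∷ []) tt

lin51 = linear 4 (λ a b c d → lit 2 ⊕ a ⊕ b ⊕ (lit 1 ⊕ c) ≼ d ∷ [] ⊢ lit 2 ≼ d) (1 ∷ 1 ∷ []) [] tt

lin52 = linear 4 (λ a b c d → lit 2 ⊕ a ⊕ b ⊕ (lit 1 ⊕ c) ≼ d ∷ [] ⊢ lit 2 ⊕ a ⊕ (lit 1 ⊕ c) ≼ d) (1 ∷ 1 ∷ []) [] tt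

lin53 = linear 5 (λ a b c d e → (a ≼ b ∷ c ≐ a ∷ c ≐ lit 1 ⊕ d ∷ d ≐ e ⊕ b ∷ []) ⊢⊥) (1 ∷ 1 ∷ 0 ∷ 0 ∷ 1 ∷ 0 ∷ 1 ∷ [])
    [] tt

lin54 = linear 4 (λ a b c d → a ≼ lit 1 ⊕ b ∷ c ≐ b ∷ c ≺ d ∷ [] ⊢ a ≼ d) (1 ∷ 1 ∷ 0 ∷ 1 ∷ 1 ∷ []) [] tt

lin55 = linear 9 (λ a b c d e f g i j → a ≼ b ∷ b ≼ c ⊕ d ∷ c ≼ e ⊕ f ∷ f ≼ g ∷ d ≼ i ∷ i ≼ j ∷ [] ⊢ a ≼ e ⊕ (j ⊕ g))
    (1 ∷ 1 ∷ 1 ∷ 1 ∷ 1 ∷ 1 ∷ 1 ∷ []) [] tt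

lin56 = linear 7 (λ a b c d e f g → a ≼ b ⊕ c ∷ c ≼ d ∷ b ≼ e ∷ e ≼ f ∷ a ≐ g ∷ f ⊕ f ≼ g ∷ [] ⊢ f ≼ d)
    (1 ∷ 1 ∷ 1 ∷ 1 ∷ 1 ∷ 0 ∷ 1 ∷ 1 ∷ []) [] tt

lin57 = linear 5 (λ a b c d e → (a ⊕ b ≼ c ∷ c ≼ a ⊕ (d ⊕ e) ∷ d ⊕ e ≺ b ∷ []) ⊢⊥) (1 ∷ 1 ∷ 1 ∷ []) [] tt

lin58 = linear 9 (λ a b c d e f g i j → (a ⊕ b ≼ c ∷ c ≼ d ∷ e ≐ f ⊕ d ∷ e ≐ g ⊕ a ∷ g ≼ f ⊕ (i ⊕ j) ∷ i ⊕ j ≺ b ∷ [])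
    ⊢⊥) (1 ∷ 1 ∷ 0 ∷ 1 ∷ 1 ∷ 0 ∷ 1 ∷ 1 ∷ []) [] tt

lin59 = linear 4 (λ a b c d → a ≺ b ⊕ b ∷ b ≼ c ∷ a ≐ c ⊕ d ∷ [] ⊢ d ⊕ d ≼ a) (1 ∷ 1 ∷ 2 ∷ 0 ∷ 2 ∷ []) [] tt

lin60 = linear 3 (λ a b c → (a ≼ b ∷ a ≐ c ⊕ b ∷ lit 1 ≼ c ∷ []) ⊢⊥) (1 ∷ 0 ∷ 1 ∷ 1 ∷ []) [] tt

lin61 = linear 4 (λ a b c d → a ⊕ a ≺ b ∷ b ≼ c ⊕ d ∷ c ≺ a ∷ [] ⊢ a ≼ d) (1 ∷ 1 ∷ 1 ∷ 1 ∷ []) [] tt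

lin62 = linear 6 (λ a b c d e f → a ≼ b ⊕ c ∷ b ≼ d ⊕ e ∷ e ≼ f ∷ [] ⊢ a ≼ d ⊕ f ⊕ c) (1 ∷ 1 ∷ 1 ∷ 1 ∷ []) [] tt

lin63 = linear 7 (λ a b c d e f g → a ≼ b ⊕ c ⊕ d ∷ b ≼ e ∷ c ≼ f ∷ f ⊕ e ⊕ 3 ⊛ g ≼ a ∷ [] ⊢ g ≼ d)
    (3 ∷ 1 ∷ 1 ∷ 1 ∷ 1 ∷ []) [] tt

lin64 = linear 9 (λ a b c d e f g i j → a ≼ b ⊕ c ⊕ d ∷ b ≼ e ∷ c ≼ f ∷ f ⊕ e ⊕ 3 ⊛ g ≼ a ∷ d ≼ i ⊕ j ∷ i ≼ g ⊕ g ∷ []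
    ⊢ g ≼ j) (1 ∷ 1 ∷ 1 ∷ 1 ∷ 1 ∷ 1 ∷ 1 ∷ []) [] tt

lin65 = linear 13 (λ a b c d e f g i j k l m n →
    (a ⊕ b ≼ c ∷ c ≼ d ∷ d ≼ e ⊕ f ∷ e ≼ g ⊕ i ∷ f ≼ j ⊕ k ∷ k ≐ l ∷ l ≼ a ∷ j ≼ m ∷ g ≼ n ⊕ n ∷ i ≼ n ⊕ n ∷ m ⊕ 4 ⊛ n
    ≺ b ∷ []) ⊢⊥) (1 ∷ 1 ∷ 1 ∷ 1 ∷ 1 ∷ 1 ∷ 0 ∷ 1 ∷ 1 ∷ 1 ∷ 1 ∷ 1 ∷ []) [] tt

lin66 = linear 2 (λ a b → a ≼ b ⊕ b ∷ [] ⊢ lit 1 ⊕ (lit 1 ⊕ a) ≼ lit 1 ⊕ b ⊕ (lit 1 ⊕ b)) (1 ∷ 1 ∷ []) [] tt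

lin67 = linear 4 (λ a b c d → a ≐ b ∷ b ≐ lit 1 ⊕ c ⊕ d ∷ [] ⊢ d ≺ a) (1 ∷ 0 ∷ 1 ∷ 0 ∷ 1 ∷ []) [] tt

lin68 = linear 9 (λ a b c d e f g i j → a ≐ b ∷ b ≐ lit 1 ⊕ c ⊕ d ∷ e ≐ f ∷ f ≐ g ⊕ (lit 1 ⊕ i) ∷ i ≐ lit 1 ⊕ c ⊕ j ∷
    [] ⊢ a ≼ d ⊕ e) (1 ∷ 1 ∷ 0 ∷ 1 ∷ 0 ∷ 0 ∷ 1 ∷ 0 ∷ 1 ∷ 0 ∷ 1 ∷ []) [] tt

lin69 = linear 4 (λ a b c d → (a ≺ b ∷ a ≐ c ∷ d ≼ c ⊕ c ∷ d ≐ b ⊕ b ∷ []) ⊢⊥) (2 ∷ 0 ∷ 2 ∷ 1 ∷ 0 ∷ 1 ∷ []) [] tt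

lin70 = linear 8 (λ a b c d e f g i → a ≐ b ⊕ (lit 1 ⊕ c) ∷ c ≐ d ∷ b ≐ e ⊕ f ∷ g ≐ d ⊕ lit 1 ∷ lit 1 ⊕ g ⊕ e ⊕ f ≐ i
    ∷ [] ⊢ lit 1 ⊕ a ≐ i) (1 ∷ 1 ∷ 0 ∷ 1 ∷ 0 ∷ 1 ∷ 0 ∷ 0 ∷ 1 ∷ 1 ∷ 0 ∷ [])
    (1 ∷ 0 ∷ 1 ∷ 0 ∷ 1 ∷ 0 ∷ 1 ∷ 1 ∷ 0 ∷ 0 ∷ 1 ∷ []) tt

lin71 = linear 4 (λ a b c d → a ≼ b ∷ [] ⊢ a ≼ b ⊕ c ⊕ d) (1 ∷ 1 ∷ []) [] tt

lin72 = linear 4 (λ a b c d → a ≺ b ⊕ c ∷ c ⊕ (d ⊕ d) ≼ a ∷ [] ⊢ d ⊕ d ≼ b) (1 ∷ 1 ∷ 1 ∷ []) [] tt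

lin73 = linear 6 (λ a b c d e f → a ≺ b ⊕ c ∷ b ≼ d ⊕ (e ⊕ e) ∷ e ⊕ e ≼ f ∷ [] ⊢ a ≼ d ⊕ c ⊕ f) (1 ∷ 1 ∷ 1 ∷ 1 ∷ [])
    [] tt

lin74 = linear 2 (λ a b → a ≼ lit 1 ⊕ b ∷ [] ⊢ a ≼ b ⊕ lit 1) (1 ∷ 1 ∷ []) [] tt

lin75 = linear 3 (λ a b c → a ⊕ (lit 1 ⊕ b) ≼ c ∷ [] ⊢ a ⊕ b ≼ c) (1 ∷ 1 ∷ []) [] tt

lin76 = linear 4 (λ a b c d → a ⊕ (lit 1 ⊕ b) ≼ c ∷ d ≼ a ⊕ (lit 1 ⊕ b) ∷ [] ⊢ d ≼ c) (1 ∷ 1 ∷ 1 ∷ []) [] tt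

lin77 = linear 4 (λ a b c d → a ≼ lit 1 ⊕ b ∷ b ≼ c ⊕ (lit 1 ⊕ d) ∷ [] ⊢ a ≼ c ⊕ (lit 1 ⊕ (lit 1 ⊕ d)))
    (1 ∷ 1 ∷ 1 ∷ []) [] tt

lin78 = linear 6 (λ a b c d e f → (a ⊕ a ≼ b ∷ b ≼ c ∷ c ≼ d ⊕ e ∷ e ≼ lit 1 ∷ a ≐ f ⊕ d ∷ f ≐ lit 1 ∷ []) ⊢⊥)
    (1 ∷ 1 ∷ 1 ∷ 1 ∷ 0 ∷ 2 ∷ 0 ∷ 2 ∷ []) [] tt

lin79 = linear 4 (λ a b c d → a ≼ b ∷ b ⊕ 3 ⊛ c ≼ d ∷ [] ⊢ a ⊕ (c ⊕ c) ≼ d) (1 ∷ 1 ∷ 1 ∷ []) [] tt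

lin80 = linear 6 (λ a b c d e f → a ≐ b ⊕ b ∷ c ≐ a ∷ d ≐ c ⊕ (lit 1 ⊕ e) ∷ f ≐ d ⊕ lit 1 ∷ [] ⊢ b ⊕ b ≼ lit 1 ⊕ f)
    (1 ∷ 0 ∷ 1 ∷ 0 ∷ 1 ∷ 0 ∷ 1 ∷ 0 ∷ 1 ∷ []) [] tt

lin81 = linear 10 (λ a b c d e f g i j k →
    (a ⊕ b ≼ c ∷ c ≼ d ∷ d ≼ a ⊕ e ∷ e ≼ f ⊕ g ∷ g ≼ i ∷ f ≼ j ⊕ (lit 1 ⊕ (i ⊕ i)) ∷ j ≼ k ∷ k ⊕ 4 ⊛ i ≺ b ∷ lit 1 ≼ i
    ∷ []) ⊢⊥) (1 ∷ 1 ∷ 1 ∷ 1 ∷ 1 ∷ 1 ∷ 1 ∷ 1 ∷ 1 ∷ []) [] tt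

lin82 = linear 3 (λ a b c → a ⊕ b ≼ c ∷ b ≺ a ∷ [] ⊢ b ⊕ b ≼ c) (1 ∷ 1 ∷ 1 ∷ []) [] tt

lin83 = linear 3 (λ a b c → a ⊕ b ≼ c ∷ a ≼ b ∷ [] ⊢ a ⊕ a ≼ c) (1 ∷ 1 ∷ 1 ∷ []) [] tt

lin84 = linear 5 (λ a b c d e → a ⊕ b ⊕ lit 2 ≼ c ∷ c ⊕ (d ⊕ d) ≼ e ∷ [] ⊢ a ⊕ (d ⊕ d) ≼ e) (1 ∷ 1 ∷ 1 ∷ []) [] tt

lin85 = linear 3 (λ a b c → a ⊕ 4 ⊛ b ≺ c ∷ [] ⊢ b ⊕ a ≺ c) (1 ∷ 1 ∷ []) [] tt

lin86 = linear 5 (λ a b c d e → a ≼ b ⊕ b ∷ c ⊕ d ⊕ 3 ⊛ b ≼ e ∷ d ⊕ (b ⊕ b) ≼ c ∷ [] ⊢ a ⊕ a ≼ e) (2 ∷ 4 ∷ 2 ∷ 1 ∷ [])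
    [] tt

lin87 = linear 5 (λ a b c d e → a ⊕ b ≼ c ∷ a ≺ d ⊕ d ∷ e ⊕ 6 ⊛ d ≼ b ∷ [] ⊢ 4 ⊛ a ≺ c) (1 ∷ 1 ∷ 3 ∷ 1 ∷ []) [] tt

lin88 = linear 8 (λ a b c d e f g i → a ⊕ b ≼ c ∷ c ≼ d ⊕ e ∷ e ≼ f ∷ d ≺ g ∷ i ⊕ 6 ⊛ g ≼ b ∷ [] ⊢ a ⊕ (4 ⊛ g ⊕ i) ≺
    f) (1 ∷ 1 ∷ 1 ∷ 1 ∷ 2 ∷ 1 ∷ []) [] tt

lin89 = linear 4 (λ a b c d → a ⊕ 3 ⊛ b ≼ c ∷ c ⊕ 6 ⊛ b ≼ d ∷ lit 1 ≼ b ∷ [] ⊢ a ⊕ 4 ⊛ b ≺ d) (1 ∷ 1 ∷ 1 ∷ 5 ∷ []) []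
    tt

lin90 = linear 6 (λ a b c d e f → a ≼ b ⊕ c ∷ b ≺ d ∷ e ⊕ f ⊕ 3 ⊛ d ≼ a ∷ [] ⊢ lit 1 ≼ c) (1 ∷ 1 ∷ 3 ∷ 1 ∷ []) [] tt

lin91 = linear 2 (λ a b → a ≼ lit 1 ⊕ b ⊕ b ∷ [] ⊢ lit 1 ⊕ (lit 1 ⊕ a) ≼ lit 1 ⊕ (lit 1 ⊕ b) ⊕ (lit 1 ⊕ b))
    (1 ∷ 1 ∷ []) [] tt

lin92 = linear 2 (λ a b → a ≼ b ⊕ b ∷ [] ⊢ lit 1 ⊕ a ≼ lit 1 ⊕ b ⊕ b) (1 ∷ 1 ∷ []) [] tt

lin93 = linear 2 (λ a b → a ≼ lit 1 ⊕ b ⊕ b ∷ [] ⊢ lit 1 ⊕ a ≼ lit 1 ⊕ b ⊕ (lit 1 ⊕ b)) (1 ∷ 1 ∷ []) [] tt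

lin94 = linear 3 (λ a b c → (a ≼ b ∷ a ≐ b ⊕ c ∷ c ≐ lit 1 ∷ []) ⊢⊥) (1 ∷ 0 ∷ 1 ∷ 0 ∷ 1 ∷ []) [] tt

lin95 = linear 1 (λ a → (lit 1 ⊕ a ≼ a ∷ []) ⊢⊥) (1 ∷ []) [] tt

lin96 = linear 5 (λ a b c d e → a ≼ b ∷ b ≼ c ⊕ d ∷ d ≼ e ∷ e ≼ c ⊕ c ∷ [] ⊢ a ≼ 3 ⊛ c) (1 ∷ 1 ∷ 1 ∷ 1 ∷ 1 ∷ []) [] tt

lin97 = linear 2 (λ a b → (4 ⊛ a ≺ b ∷ b ≼ 3 ⊛ a ∷ []) ⊢⊥) (1 ∷ 1 ∷ []) [] tt

lin98 = linear 4 (λ a b c d → a ≼ b ∷ b ≐ c ∷ d ≺ a ∷ lit 1 ≼ d ∷ [] ⊢ lit 2 ≼ c) (1 ∷ 1 ∷ 1 ∷ 0 ∷ 1 ∷ 1 ∷ []) [] tt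

lin99 = linear 2 (λ a b → (a ≐ b ⊕ lit 1 ∷ lit 1 ⊕ a ≼ lit 1 ⊕ b ∷ []) ⊢⊥) (0 ∷ 1 ∷ 1 ∷ []) [] tt

lin100 = linear 5 (λ a b c d e → a ≼ b ⊕ c ∷ c ≐ lit 0 ∷ [] ⊢ lit 1 ⊕ a ≼ lit 1 ⊕ b ⊕ d ⊕ e) (1 ∷ 1 ∷ 1 ∷ 0 ∷ []) []
    tt

lin101 = linear 5 (λ a b c d e → a ≼ lit 1 ⊕ b ⊕ c ⊕ d ∷ d ≐ e ∷ [] ⊢ lit 1 ⊕ a ≼ lit 1 ⊕ b ⊕ (lit 1 ⊕ c) ⊕
    (lit 1 ⊕ e)) (1 ∷ 1 ∷ 1 ∷ 0 ∷ []) [] tt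

lin102 = linear 5 (λ a b c d e → a ≼ lit 1 ⊕ b ⊕ c ⊕ d ∷ d ≐ e ∷ [] ⊢ lit 1 ⊕ a ≼ lit 1 ⊕ b ⊕ (lit 1 ⊕ c) ⊕ e)
    (1 ∷ 1 ∷ 1 ∷ 0 ∷ []) [] tt

lin103 = linear 5 (λ a b c d e → a ≼ lit 1 ⊕ b ⊕ c ⊕ d ∷ d ≐ e ∷ [] ⊢ lit 1 ⊕ a ≼ lit 1 ⊕ b ⊕ c ⊕ (lit 1 ⊕ e))
    (1 ∷ 1 ∷ 1 ∷ 0 ∷ []) [] tt

lin104 = linear 8 (λ a b c d e f g i → a ≼ b ⊕ c ∷ b ≼ d ⊕ e ∷ e ≼ f ∷ f ≼ d ⊕ d ∷ d ≺ g ⊕ g ∷ a ≐ i ∷ 7 ⊛ g ≼ i ∷ []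
    ⊢ g ≼ c) (1 ∷ 1 ∷ 1 ∷ 1 ∷ 1 ∷ 3 ∷ 0 ∷ 1 ∷ 1 ∷ []) [] tt

lin105 = linear 4 (λ a b c d → a ≼ b ⊕ c ∷ b ≺ d ∷ c ≺ d ∷ [] ⊢ a ≺ d ⊕ d) (1 ∷ 1 ∷ 1 ∷ 1 ∷ []) [] tt

lin106 = linear 7 (λ a b c d e f g → (a ≼ lit 1 ⊕ b ⊕ c ⊕ d ∷ c ≼ e ∷ e ≺ f ∷ d ≼ g ∷ g ≺ f ∷ lit 1 ⊕ b ⊕ (f ⊕ f) ≺ a
    ∷ []) ⊢⊥) (1 ∷ 1 ∷ 1 ∷ 1 ∷ 1 ∷ 1 ∷ []) [] tt

lin107 = linear 6 (λ a b c d e f → a ≐ b ⊕ c ∷ a ≐ d ∷ d ≐ e ⊕ f ∷ e ≐ b ∷ [] ⊢ f ≐ c)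
    (1 ∷ 1 ∷ 0 ∷ 0 ∷ 1 ∷ 0 ∷ 1 ∷ 0 ∷ 1 ∷ []) (1 ∷ 0 ∷ 1 ∷ 1 ∷ 0 ∷ 1 ∷ 0 ∷ 1 ∷ 0 ∷ []) tt

lin108 = linear 2 (λ a b → (7 ⊛ a ≼ b ∷ lit 0 ≐ b ∷ lit 1 ≼ a ∷ []) ⊢⊥) (1 ∷ 0 ∷ 1 ∷ 7 ∷ []) [] tt

lin109 = linear 7 (λ a b c d e f g → a ≐ b ⊕ c ∷ c ≼ d ∷ e ≐ f ⊕ d ∷ e ≼ f ⊕ g ∷ [] ⊢ a ≼ b ⊕ g)
    (1 ∷ 1 ∷ 0 ∷ 1 ∷ 0 ∷ 1 ∷ 1 ∷ []) [] tt

lin110 = linear 4 (λ a b c d → a ≼ b ⊕ c ∷ d ⊕ c ≼ a ∷ [] ⊢ d ≼ b) (1 ∷ 1 ∷ 1 ∷ []) [] tt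

lin111 = linear 6 (λ a b c d e f → (a ⊕ a ≼ lit 1 ⊕ b ∷ b ≼ c ∷ c ≼ d ⊕ e ∷ d ≺ a ⊕ (f ⊕ e) ∷ 50 ⊛ (f ⊕ e) ≼ a ∷ [])
    ⊢⊥) (17 ∷ 17 ∷ 17 ∷ 33 ∷ 1 ∷ []) [] tt

lin112 = linear 5 (λ a b c d e → a ≼ b ∷ c ≺ 6 ⊛ (d ⊕ e) ⊕ 6 ⊛ (d ⊕ e) ∷ 50 ⊛ (d ⊕ e) ≼ a ∷ [] ⊢ 4 ⊛ c ≺ b)
    (6 ∷ 6 ∷ 25 ∷ 6 ∷ []) [] tt

lin113 = linear 5 (λ a b c d e → (a ≼ b ∷ b ≼ 4 ⊛ c ∷ c ≺ 6 ⊛ (d ⊕ e) ∷ 50 ⊛ (d ⊕ e) ≼ a ∷ []) ⊢⊥)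
    (3 ∷ 3 ∷ 25 ∷ 3 ∷ []) [] tt

lin114 = linear 7 (λ a b c d e f g → a ≼ b ⊕ c ∷ 6 ⊛ (d ⊕ c) ≺ a ∷ b ≼ e ⊕ f ∷ e ≼ 4 ⊛ g ∷ g ≺ d ⊕ c ∷ [] ⊢ d ≼ f)
    (2 ∷ 1 ∷ 1 ∷ 1 ∷ 1 ∷ 4 ∷ []) [] tt

lin115 = linear 6 (λ a b c d e f → a ≼ b ∷ b ≼ c ⊕ d ∷ c ≺ e ⊕ f ∷ 50 ⊛ (e ⊕ f) ≼ a ∷ [] ⊢ lit 1 ≼ d)
    (1 ∷ 1 ∷ 1 ∷ 50 ∷ 1 ∷ []) [] tt

lin116 = linear 5 (λ a b c d e → a ≐ b ⊕ c ∷ 50 ⊛ (d ⊕ e) ≼ b ∷ lit 1 ≼ d ∷ [] ⊢ lit 1 ⊕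
    (lit 1 ⊕ c ⊕ (d ⊕ e ⊕ (d ⊕ e))) ≼ a) (1 ∷ 0 ∷ 1 ∷ 1 ∷ 48 ∷ []) [] tt

lin117 = linear 7 (λ a b c d e f g → a ≐ b ⊕ c ∷ 50 ⊛ (d ⊕ e) ≼ b ∷ lit 1 ≼ d ∷ a ≼ f ⊕ g ∷ f ≐ lit 1 ⊕
    (lit 1 ⊕ c ⊕ (d ⊕ e ⊕ (d ⊕ e))) ∷ [] ⊢ 7 ⊛ (d ⊕ e) ⊕ 7 ⊛ (d ⊕ e) ≼ g) (1 ∷ 0 ∷ 1 ∷ 1 ∷ 34 ∷ 1 ∷ 1 ∷ 0 ∷ []) [] tt

lin118 = linear 9 (λ a b c d e f g i j → a ≼ b ∷ b ≼ c ⊕ d ∷ c ≺ e ⊕ f ∷ g ≐ i ⊕ d ∷ g ≼ i ⊕ j ∷ [] ⊢ a ≼ e ⊕ (j ⊕ f))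
    (1 ∷ 1 ∷ 1 ∷ 1 ∷ 0 ∷ 1 ∷ 1 ∷ []) [] tt

lin119 = linear 4 (λ a b c d → a ≼ b ⊕ c ∷ [] ⊢ a ≼ b ⊕ (c ⊕ d)) (1 ∷ 1 ∷ []) [] tt

lin120 = linear 6 (λ a b c d e f → (a ≼ b ∷ b ≼ c ⊕ (d ⊕ e) ∷ c ⊕ c ≼ f ∷ f ≼ a ⊕ lit 0 ∷ a ⊕ (d ⊕ e) ⊕ (d ⊕ e) ⊕ lit
    0 ≺ a ⊕ a ∷ []) ⊢⊥) (2 ∷ 2 ∷ 1 ∷ 1 ∷ 1 ∷ []) [] tt

lin121 = linear 4 (λ a b c d → a ⊕ a ≼ b ∷ b ≼ c ∷ c ≐ d ⊕ d ∷ [] ⊢ a ≼ d) (2 ∷ 1 ∷ 1 ∷ 1 ∷ 0 ∷ []) [] tt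

lin122 = linear 4 (λ a b c d → a ⊕ (b ⊕ c) ⊕ (b ⊕ c) ⊕ (c ⊕ c ⊕ d) ≺ a ⊕ a ∷ [] ⊢ a ⊕ (b ⊕ c ⊕ c) ⊕ (b ⊕ c ⊕ c) ⊕ d ≺
    a ⊕ a) (1 ∷ 1 ∷ []) [] tt

lin123 = linear 3 (λ a b c → [] ⊢ a ⊕ b ⊕ c ≐ a ⊕ (b ⊕ c)) (1 ∷ []) (1 ∷ []) tt

lin124 = linear 7 (λ a b c d e f g → a ⊕ (b ⊕ c) ≼ d ∷ e ⊕ 3 ⊛ b ≼ f ∷ f ⊕ 6 ⊛ b ≼ g ∷ g ≼ c ∷ [] ⊢ a ⊕ e ⊕ 3 ⊛ b ≼ d)
    (1 ∷ 1 ∷ 1 ∷ 1 ∷ 1 ∷ []) [] tt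

lin125 = linear 7 (λ a b c d e f g → lit 1 ⊕ a ⊕ b ≐ c ∷ d ⊕ 3 ⊛ e ≼ f ∷ f ⊕ 6 ⊛ e ≼ g ∷ g ≼ a ∷ 50 ⊛ (e ⊕ a) ≼ c ∷
    lit 1 ≼ e ∷ [] ⊢ d ⊕ 4 ⊛ e ≺ b) (1 ∷ 0 ∷ 1 ∷ 49 ∷ 49 ∷ 49 ∷ 1 ∷ 487 ∷ []) [] tt

lin126 = linear 6 (λ a b c d e f → a ⊕ 3 ⊛ b ≼ c ∷ c ⊕ 6 ⊛ b ≼ d ∷ d ≼ e ∷ 50 ⊛ (b ⊕ e) ≼ f ∷ [] ⊢ a ⊕ (b ⊕ b) ≼ f)
    (50 ∷ 50 ∷ 50 ∷ 50 ∷ 1 ∷ []) [] tt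

lin127 = linear 3 (λ a b c → 50 ⊛ (a ⊕ b) ≼ c ∷ lit 1 ≼ a ∷ [] ⊢ lit 1 ⊕ b ≼ c) (1 ∷ 1 ∷ 50 ∷ []) [] tt

lin128 = linear 9 (λ a b c d e f g i j → a ⊕ a ≼ lit 1 ⊕ b ∷ b ≼ c ∷ c ≼ d ⊕ e ∷ f ≐ g ⊕ e ∷ f ≼ g ⊕ i ∷ lit 1 ⊕ i ⊕ j
    ≐ a ∷ [] ⊢ a ⊕ j ≼ d) (1 ∷ 1 ∷ 1 ∷ 1 ∷ 0 ∷ 1 ∷ 1 ∷ 1 ∷ 0 ∷ []) [] tt

lin129 = linear 5 (λ a b c d e → 50 ⊛ (a ⊕ b) ≼ c ∷ d ≼ b ∷ lit 1 ≼ a ∷ e ≐ b ⊕ b ∷ [] ⊢ c ⊕ d ⊕ d ⊕ e ≺ c ⊕ c)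
    (1 ∷ 1 ∷ 2 ∷ 50 ∷ 1 ∷ 0 ∷ []) [] tt

lin130 = linear 2 (λ a b → a ⊕ a ≼ lit 1 ⊕ b ∷ [] ⊢ lit 1 ⊕ a ⊕ (lit 1 ⊕ a) ≼ lit 1 ⊕ (lit 1 ⊕ (lit 1 ⊕ b)))
    (1 ∷ 1 ∷ []) [] tt

lin131 = linear 5 (λ a b c d e → a ≼ b ∷ a ⊕ b ≐ c ∷ b ≼ d ∷ e ≐ d ⊕ d ∷ [] ⊢ c ≼ e) (1 ∷ 1 ∷ 0 ∷ 1 ∷ 2 ∷ 0 ∷ 1 ∷ [])
    [] tt

lin132 = linear 4 (λ a b c d → lit 2 ⊕ a ≼ b ⊕ b ∷ c ≐ a ⊕ a ∷ b ⊕ b ≼ lit 1 ⊕ d ∷ [] ⊢ lit 2 ⊕ c ≼ d ⊕ d)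
    (1 ∷ 2 ∷ 1 ∷ 0 ∷ 2 ∷ []) [] tt

lin133 = linear 2 (λ a b → lit 2 ⊕ a ≼ b ⊕ b ∷ [] ⊢ a ≼ lit 1 ⊕ (b ⊕ b)) (1 ∷ 1 ∷ []) [] tt

lin134 = linear 2 (λ a b → lit 2 ⊕ a ≼ b ⊕ b ∷ [] ⊢ a ≼ b ⊕ b) (1 ∷ 1 ∷ []) [] tt

lin135 = linear 2 (λ a b → a ≺ b ∷ [] ⊢ lit 1 ⊕ a ≺ 2 ⊛ b) (1 ∷ 2 ∷ []) [] tt

lin136 = linear 4 (λ a b c d → a ≼ 2 ⊛ b ∷ c ≺ b ∷ d ≐ c ⊕ a ∷ [] ⊢ lit 1 ⊕ (c ⊕ d) ≼ 2 ⊛ (2 ⊛ b))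
    (1 ∷ 1 ∷ 2 ∷ 1 ∷ 0 ∷ []) [] tt

lin137 = linear 2 (λ a b → lit 2 ⊕ a ≼ 2 ⊛ b ∷ [] ⊢ lit 2 ⊕ (lit 2 ⊕ (a ⊕ a)) ≼ 2 ⊛ (2 ⊛ b)) (1 ∷ 2 ∷ []) [] tt

lin138 = linear 5 (λ a b c d e → a ≼ b ∷ lit 2 ⊕ c ≼ 2 ⊛ d ∷ d ≼ lit 1 ⊕ (e ⊕ e) ∷ [] ⊢ a ⊕ c ≼ b ⊕ 4 ⊛ e)
    (1 ∷ 1 ∷ 1 ∷ 2 ∷ []) [] tt

lin139 = linear 6 (λ a b c d e f → a ≼ b ⊕ 4 ⊛ c ∷ d ≼ e ⊕ 4 ⊛ f ∷ [] ⊢ a ⊕ d ≼ b ⊕ e ⊕ 4 ⊛ (c ⊕ f)) (1 ∷ 1 ∷ 1 ∷ [])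
    [] tt

lin140 = linear 6 (λ a b c d e f → lit 2 ⊕ a ≼ 2 ⊛ b ⊕ c ∷ lit 2 ⊕ d ≼ 2 ⊛ b ⊕ e ∷ f ≐ c ⊕ e ∷ [] ⊢ lit 2 ⊕
    (lit 2 ⊕ (a ⊕ d)) ≼ 2 ⊛ (2 ⊛ b) ⊕ f) (1 ∷ 1 ∷ 1 ∷ 0 ∷ 1 ∷ []) [] tt

lin141 = linear 3 (λ a b c → a ≺ b ∷ b ≼ c ⊕ c ∷ [] ⊢ a ≼ 2 ⊛ c) (1 ∷ 1 ∷ 1 ∷ []) [] tt

lin142 = linear 4 (λ a b c d → a ≐ b ⊕ c ∷ b ≺ lit 1 ⊕ d ∷ [] ⊢ a ≼ d ⊕ (lit 1 ⊕ d ⊕ c)) (1 ∷ 1 ∷ 0 ∷ 1 ∷ []) [] tt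

lin143 = linear 12 (λ a b c d e f g i j k l m → a ≐ 4 ⊛ b ⊕ 4 ⊛ c ⊕ 6 ⊛ d ∷ e ≐ lit 1 ⊕ (d ⊕ d) ⊕ f ⊕ (g ⊕ g ⊕ lit 2)
    ⊕ i ∷ b ≼ 2 ⊛ j ∷ j ≼ k ⊕ k ∷ d ≼ 2 ⊛ k ∷ c ≼ 2 ⊛ l ∷ f ≼ k ⊕ k ∷ i ≼ m ∷ m ≐ 4 ⊛ l ⊕ 4 ⊛ k ∷ k ≼ l ∷ g ≼ l ∷ lit
    1 ≼ k ∷ [] ⊢ lit 2 ⊕ a ⊕ e ≼ 57 ⊛ l) (1 ∷ 1 ∷ 0 ∷ 1 ∷ 0 ∷ 4 ∷ 8 ∷ 8 ∷ 4 ∷ 1 ∷ 1 ∷ 1 ∷ 0 ∷ 43 ∷ 2 ∷ 5 ∷ []) [] tt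

lin144 = linear 8 (λ a b c d e f g i → a ≼ b ∷ b ≐ c ⊕ (d ⊕ e) ∷ c ≼ f ∷ f ≐ g ⊕ g ∷ e ≼ i ∷ d ≼ i ⊕ i ∷ [] ⊢ a ≼ 2 ⊛
    g ⊕ 3 ⊛ i) (1 ∷ 1 ∷ 1 ∷ 0 ∷ 1 ∷ 1 ∷ 0 ∷ 1 ∷ 1 ∷ []) [] tt

lin145 = linear 7 (λ a b c d e f g → a ≐ b ⊕ c ∷ b ≺ d ∷ e ≐ f ∷ g ≼ f ∷ g ≐ d ⊕ c ∷ [] ⊢ a ≼ e)
    (1 ∷ 1 ∷ 0 ∷ 1 ∷ 0 ∷ 1 ∷ 1 ∷ 0 ∷ 1 ∷ []) [] tt

lin146 = linear 8 (λ a b c d e f g i → lit 2 ⊕ a ≼ 2 ⊛ b ⊕ c ∷ c ≼ d ⊕ 4 ⊛ e ∷ d ≼ f ∷ e ≼ g ∷ f ≼ 2 ⊛ i ⊕ 3 ⊛ g ∷ b ≼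
    g ⊕ g ∷ g ≼ i ∷ [] ⊢ lit 1 ⊕ a ≼ 13 ⊛ i) (1 ∷ 1 ∷ 1 ∷ 1 ∷ 4 ∷ 1 ∷ 2 ∷ 11 ∷ []) [] tt

lin147 = linear 3 (λ a b c → a ≼ b ∷ c ≐ 86 ⊛ b ∷ [] ⊢ a ⊕ c ≼ 100 ⊛ b) (1 ∷ 1 ∷ 1 ∷ 0 ∷ []) [] tt

lin148 = linear 3 (λ a b c → 50 ⊛ (a ⊕ b) ≼ c ∷ lit 1 ≼ a ∷ [] ⊢ a ≺ c) (1 ∷ 1 ∷ 49 ∷ []) [] tt

lin149 = linear 3 (λ a b c → a ⊕ lit 0 ≼ b ∷ b ≺ c ∷ [] ⊢ a ≼ c ⊕ lit 0) (1 ∷ 1 ∷ 1 ∷ []) [] tt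

lin150 = linear 4 (λ a b c d → lit 1 ⊕ a ≐ b ∷ c ≼ d ∷ [] ⊢ a ⊕ c ≼ b ⊕ d) (1 ∷ 1 ∷ 0 ∷ 1 ∷ []) [] tt

lin151 = linear 3 (λ a b c → a ≼ 57 ⊛ b ∷ lit 1 ⊕ c ≼ 13 ⊛ b ∷ [] ⊢ a ⊕ (lit 1 ⊕ c) ≼ 80 ⊛ b) (13 ∷ 13 ∷ 23 ∷ []) []
    tt

lin152 = linear 3 (λ a b c → a ≼ 57 ⊛ b ∷ c ≼ b ∷ [] ⊢ a ⊕ 3 ⊛ c ≼ 80 ⊛ b) (1 ∷ 1 ∷ 3 ∷ []) [] tt

lin153 = linear 2 (λ a b → a ≼ b ∷ [] ⊢ 80 ⊛ b ⊕ 6 ⊛ a ≼ 86 ⊛ b) (1 ∷ 6 ∷ []) [] tt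

lin154 = linear 5 (λ a b c d e → a ≐ b ⊕ c ∷ lit 1 ⊕ b ≐ d ∷ e ≺ d ∷ [] ⊢ e ≼ a) (1 ∷ 0 ∷ 1 ∷ 0 ∷ 1 ∷ 1 ∷ []) [] tt

lin155 = linear 6 (λ a b c d e f → a ≐ b ⊕ c ∷ lit 1 ⊕ b ≐ d ∷ e ≺ d ∷ a ≼ e ⊕ f ∷ [] ⊢ c ≼ f)
    (1 ∷ 0 ∷ 1 ∷ 0 ∷ 1 ∷ 1 ∷ 1 ∷ []) [] tt

lin156 = linear 6 (λ a b c d e f → a ≐ b ⊕ (b ⊕ c) ∷ lit 1 ⊕ b ≐ d ∷ lit 1 ⊕ e ≺ d ⊕ d ∷ a ≼ e ⊕ f ∷ [] ⊢ c ≼ f)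
    (1 ∷ 0 ∷ 1 ∷ 0 ∷ 2 ∷ 1 ∷ 1 ∷ []) [] tt

lin157 = linear 4 (λ a b c d → a ≐ b ⊕ c ∷ b ≐ lit 1 ∷ a ≼ lit 1 ⊕ d ∷ [] ⊢ c ≼ d) (1 ∷ 0 ∷ 1 ∷ 0 ∷ 1 ∷ 1 ∷ []) [] tt

lin158 = linear 6 (λ a b c d e f → a ≐ b ⊕ c ∷ b ≐ lit 1 ∷ d ≐ e ⊕ f ∷ e ≐ lit 1 ∷ a ≼ d ∷ [] ⊢ c ≼ f)
    (1 ∷ 0 ∷ 1 ∷ 0 ∷ 1 ∷ 1 ∷ 0 ∷ 1 ∷ 0 ∷ 1 ∷ []) [] tt

lin159 = linear 6 (λ a b c d e f → a ≐ b ⊕ c ∷ b ≐ lit 1 ∷ d ≐ e ⊕ f ∷ e ≐ lit 1 ∷ c ≼ f ∷ [] ⊢ a ≼ d)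
    (1 ∷ 1 ∷ 0 ∷ 1 ∷ 0 ∷ 0 ∷ 1 ∷ 0 ∷ 1 ∷ 1 ∷ []) [] tt

lin160 = linear 6 (λ a b c d e f → a ≐ b ∷ c ≼ d ∷ e ≐ a ⊕ d ∷ e ≼ f ∷ [] ⊢ b ⊕ c ≼ f)
    (1 ∷ 0 ∷ 1 ∷ 1 ∷ 0 ∷ 1 ∷ 1 ∷ []) [] tt

lin161 = linear 3 (λ a b c → lit 1 ⊕ a ≐ lit 1 ⊕ (lit 1 ⊕ b) ∷ a ≐ c ⊕ lit 1 ∷ [] ⊢ c ≐ b) (1 ∷ 1 ∷ 0 ∷ 0 ∷ 1 ∷ [])
    (1 ∷ 0 ∷ 1 ∷ 1 ∷ 0 ∷ []) tt

lin162 = linear 5 (λ a b c d e → (a ≼ b ∷ b ≼ c ∷ d ⊕ c ≐ e ∷ e ≺ d ⊕ a ∷ []) ⊢⊥) (1 ∷ 1 ∷ 1 ∷ 0 ∷ 1 ∷ []) [] tt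

lin163 = linear 4 (λ a b c d → lit 1 ≼ a ∷ a ≼ b ∷ 50 ⊛ c ≼ d ∷ b ≼ c ∷ [] ⊢ a ≺ d) (1 ∷ 49 ∷ 50 ∷ 1 ∷ 50 ∷ []) [] tt

-- Finite sets

Sub : ℕ → Set
Sub n = Fin n → Bool

private variable
  n : ℕ

indicator : Bool → ℕ
indicator true = 1
indicator false = 0

infix 4 _∈_ _∉_ _∈?_ _⊆_

abstract
  _∈_ : Fin n → Sub n → Set
  x ∈ A = T (A x)

  _∈?_ : ∀ (x : Fin n) A → Dec (x ∈ A)
  x ∈? A = T? (A x)

  sep : {P : Fin n → Set} → (∀ x → Dec (P x)) → Sub n
  sep P? x = does (P? x)

  sep⁺ : {P : Fin n → Set} (P? : ∀ x → Dec (P x)) {x : Fin n} → P x → x ∈ sep P?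
  sep⁺ P? {x} p with P? x
  ... | yes _ = tt
  ... | no ¬p = ¬p p

  sep⁻ : {P : Fin n → Set} (P? : ∀ x → Dec (P x)) {x : Fin n} → x ∈ sep P? → P x
  sep⁻ P? {x} p with P? x
  ... | yes q = q

  # : Sub n → ℕ
  # {zero} A = 0
  # {suc n} A = indicator (A zero) + # (A ∘ suc)

_∉_ : Fin n → Sub n → Set
x ∉ A = ¬ (x ∈ A)

_⊆_ : Sub n → Sub n → Set
A ⊆ B = ∀ {x} → x ∈ A → x ∈ B

infixl 6 _∪_ _∖_
infixl 7 _∩_

abstract
  ∅ full : Sub n
  ∅ _ = false
  full _ = true

  _∪_ _∩_ _∖_ : Sub n → Sub n → Sub n
  (A ∪ B) x = A x ∨ B x
  (A ∩ B) x = A x ∧ B x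
  (A ∖ B) x = A x ∧ not (B x)

  ⁅_⁆ : Fin n → Sub n
  ⁅ x ⁆ = sep (λ y → y ≟ x)

  ∅⁻ : {x : Fin n} → x ∈ ∅ → ⊥
  ∅⁻ ()

  full⁺ : {x : Fin n} → x ∈ full
  full⁺ = tt

  ∪ˡ : ∀ {A B : Sub n} → A ⊆ A ∪ B
  ∪ˡ {A = A} {B} {x} p with A x
  ... | true = tt

  ∪ʳ : ∀ {A B : Sub n} → B ⊆ A ∪ B
  ∪ʳ {A = A} {B} {x} p with A x
  ... | true = tt
  ... | false = p

  ∪⁻ : ∀ {A B : Sub n} {x} → x ∈ A ∪ B → x ∈ A ⊎ x ∈ B
  ∪⁻ {A = A} {B} {x} p with A x
  ... | true = inj₁ tt
  ... | false = inj₂ p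

  ∩⁺ : ∀ {A B : Sub n} {x} → x ∈ A → x ∈ B → x ∈ A ∩ B
  ∩⁺ {A = A} {B} {x} p q with A x
  ... | true = q

  ∩⁻ : ∀ {A B : Sub n} {x} → x ∈ A ∩ B → x ∈ A × x ∈ B
  ∩⁻ {A = A} {B} {x} p with A x
  ... | true = tt , p

  ∖⁺ : ∀ {A B : Sub n} {x} → x ∈ A → x ∉ B → x ∈ A ∖ B
  ∖⁺ {A = A} {B} {x} p q with A x | B x
  ... | true | true = q tt
  ... | true | false = tt

  ∖⁻ : ∀ {A B : Sub n} {x} → x ∈ A ∖ B → x ∈ A × x ∉ B
  ∖⁻ {A = A} {B} {x} p with A x | B x
  ... | true | false = tt , λ ()

  ⁅⁆⁺ : {x : Fin n} → x ∈ ⁅ x ⁆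
  ⁅⁆⁺ {x = x} = sep⁺ (λ y → y ≟ x) refl

  ⁅⁆⁻ : {x y : Fin n} → y ∈ ⁅ x ⁆ → y ≡ x
  ⁅⁆⁻ {x = x} = sep⁻ (λ y → y ≟ x)

  #-mono : ∀ {A B : Sub n} → A ⊆ B → # A ≤ # B
  #-mono {zero} p = z≤n
  #-mono {suc n} {A} {B} p = +-mono-≤ (head (A zero) (B zero) (p {zero}))
      (#-mono {A = A ∘ suc} {B ∘ suc} (λ {x} → p {suc x}))
    where
    head : ∀ a b → (T a → T b) → indicator a ≤ indicator b
    head false b q = z≤n
    head true true q = ≤-refl
    head true false q = ⊥-elim (q tt)

  #-∪∩ : ∀ (A B : Sub n) → # (A ∪ B) + # (A ∩ B) ≡ # A + # B
  #-∪∩ {zero} A B = refl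
  #-∪∩ {suc n} A B = (lin1 {indicator (A zero ∨ B zero)} {indicator (A zero ∧ B zero)} {indicator (A zero)}
      {indicator (B zero)} {# (λ x → A (suc x) ∨ B (suc x))} {# (λ x → A (suc x) ∧ B (suc x))} {# (A ∘ suc)}
      {# (B ∘ suc)})
    (head (A zero) (B zero)) (#-∪∩ (A ∘ suc) (B ∘ suc))
    where
    head : ∀ a b → indicator (a ∨ b) + indicator (a ∧ b) ≡ indicator a + indicator b
    head true true = refl
    head true false = refl
    head false true = refl
    head false false = refl

  #-split : ∀ (A B : Sub n) → # A ≡ # (A ∩ B) + # (A ∖ B)
  #-split {zero} A B = refl
  #-split {suc n} A B = (lin2 {_} {indicator (A zero ∧ B zero)} {indicator (A zero ∧ not (B zero))} {_}
      {# (λ x → A (suc x) ∧ B (suc x))} {# (λ x → A (suc x) ∧ not (B (suc x)))})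
    (head (A zero) (B zero)) (#-split (A ∘ suc) (B ∘ suc))
    where
    head : ∀ a b → indicator a ≡ indicator (a ∧ b) + indicator (a ∧ not b)
    head true true = refl
    head true false = refl
    head false b = refl

  #-∅ : # {n} ∅ ≡ 0
  #-∅ {zero} = refl
  #-∅ {suc n} = #-∅ {n}

  #-full : # {n} full ≡ n
  #-full {zero} = refl
  #-full {suc n} = cong suc (#-full {n})

  #-⁅⁆ : (x : Fin n) → # ⁅ x ⁆ ≡ 1
  #-⁅⁆ {suc n} zero = cong suc (#-∅ {n})
  #-⁅⁆ {suc n} (suc x) = trans (≤-antisym (#-mono {A = ⁅ suc x ⁆ ∘ suc} {⁅ x ⁆} (λ {y} → p y))
      (#-mono {A = ⁅ x ⁆} {⁅ suc x ⁆ ∘ suc} (λ {y} → q y))) (#-⁅⁆ x)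
    where
    p : ∀ y → T (⁅ suc x ⁆ (suc y)) → T (⁅ x ⁆ y)
    p y e with sep⁻ (λ z → z ≟ suc x) {suc y} e
    ... | refl = ⁅⁆⁺ {x = x}
    q : ∀ y → T (⁅ x ⁆ y) → T (⁅ suc x ⁆ (suc y))
    q y e with sep⁻ (λ z → z ≟ x) {y} e
    ... | refl = ⁅⁆⁺ {x = suc x}

  pick : ∀ {A : Sub n} → 1 ≤ # A → ∃[ x ] x ∈ A
  pick {suc n} {A} p with A zero in eq
  ... | true = zero , subst T (sym eq) tt
  ... | false with x , q ← pick {n} {A ∘ suc} p = suc x , q

#-∪ : ∀ (A B : Sub n) → # (A ∪ B) ≤ # A + # B
#-∪ A B = (lin3 {_} {# (A ∩ B)} {# A} {# B}) (#-∪∩ A B)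

empty⇒#≡0 : ∀ {A : Sub n} → (∀ {x} → x ∉ A) → # A ≡ 0
empty⇒#≡0 {A = A} e = n≤0⇒n≡0 (≤-trans (#-mono {B = ∅} (λ p → ⊥-elim (e p))) (≤-reflexive #-∅))

#-⊎ : ∀ {A B : Sub n} → (∀ {x} → x ∈ A → x ∉ B) → # (A ∪ B) ≡ # A + # B
#-⊎ {A = A} {B} d = (lin4 {_} {_} {# A} {# B}) (#-∪∩ A B) (empty⇒#≡0 (λ p → let a , b = ∩⁻ p in d a b))

∩⊆ˡ : ∀ {A B : Sub n} → A ∩ B ⊆ A
∩⊆ˡ p = proj₁ (∩⁻ p)

∩⊆ʳ : ∀ {A B : Sub n} → A ∩ B ⊆ B
∩⊆ʳ p = proj₂ (∩⁻ p)

∖⊆ : ∀ {A B : Sub n} → A ∖ B ⊆ A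
∖⊆ p = proj₁ (∖⁻ p)

∪-⊆ : ∀ {A B C : Sub n} → A ⊆ C → B ⊆ C → A ∪ B ⊆ C
∪-⊆ f g p with ∪⁻ p
... | inj₁ a = f a
... | inj₂ b = g b

#-∖ : ∀ (A B : Sub n) → # A ≤ # B + # (A ∖ B)
#-∖ A B = (lin5 {_} {_} {# (A ∖ B)}) (#-split A B) (#-mono ∩⊆ʳ)

#-∖⊆ : ∀ {A B : Sub n} → B ⊆ A → # A ≡ # B + # (A ∖ B)
#-∖⊆ {A = A} {B} s = (lin6 {_} {_} {# (A ∖ B)}) (#-split A B) (#-∖ A B) (#-mono (λ b → ∩⁺ (s b) b))

∈⇒1≤# : ∀ {A : Sub n} {x} → x ∈ A → 1 ≤ # A
∈⇒1≤# {x = x} p = ≤-trans (≤-reflexive (sym (#-⁅⁆ x))) (#-mono (λ q → subst (_∈ _) (sym (⁅⁆⁻ q)) p))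

subset-of-size : ∀ {A : Sub n} k → k ≤ # A → Σ[ B ∈ Sub n ] B ⊆ A × # B ≡ k
subset-of-size zero _ = ∅ , (λ p → ⊥-elim (∅⁻ p)) , #-∅
subset-of-size {A = A} (suc k) le with B , s , e ← subset-of-size {A = A} k (≤-trans (n≤1+n k) le)
  with x , p ← pick {A = A ∖ B} (lin7 le e (#-∖ A B)) =
  B ∪ ⁅ x ⁆ , ∪-⊆ s (λ q → subst (_∈ A) (sym (⁅⁆⁻ q)) (∖⊆ p)) ,
  trans (#-⊎ (λ b q → proj₂ (∖⁻ p) (subst (_∈ B) (⁅⁆⁻ q) b))) (lin8 e (#-⁅⁆ x))

-- Double-negation reasoning

infixl 1 _>>=_
_>>=_ : {A : Set} → ((A → ⊥) → ⊥) → (A → ⊥) → ⊥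
m >>= k = m k

lem : (P : Set) → (P ⊎ ¬ P → ⊥) → ⊥
lem P k = k (inj₂ (λ p → k (inj₁ p)))

-- A non-maximal element yields one of larger measure, and `fuel` bounds the remaining climb. `P` is
-- never decided; the double negation makes up for it.
maximum : {X : Set} (P : X → Set) (μ : X → ℕ) (b : ℕ) → (∀ x → P x → μ x ≤ b) → ∀ x → P x →
  (Σ[ x ∈ X ] (P x × (∀ y → P y → μ y ≤ μ x)) → ⊥) → ⊥
maximum {X} P μ b bound x₀ p₀ k = go b x₀ p₀ (m≤n+m b (μ x₀))
  where
  go : ∀ fuel x → P x → b ≤ μ x + fuel → ⊥
  go zero x p le = k (x , p , λ y q → lin9 (bound y q) le)
  go (suc fuel) x p le = k (x , p , λ y q → ≮⇒≥ (λ lt → go fuel y q ((lin10 {_} {μ x} {fuel}) le lt)))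

minimum : {X : Set} (P : X → Set) (μ : X → ℕ) → ∀ x → P x →
  (Σ[ x ∈ X ] (P x × (∀ y → P y → μ x ≤ μ y)) → ⊥) → ⊥
minimum P μ x₀ p₀ k = go (μ x₀) x₀ p₀ ≤-refl
  where
  go : ∀ fuel x → P x → μ x ≤ fuel → ⊥
  go zero x p le = k (x , p , λ y q → ≤-trans le z≤n)
  go (suc fuel) x p le = k (x , p , λ y q → ≮⇒≥ (λ lt → go fuel y q (lin11 le lt)))

#≤n : ∀ (A : Sub n) → # A ≤ n
#≤n A = ≤-trans (#-mono {B = full} (λ _ → full⁺)) (≤-reflexive #-full)

-- Sets of list elements

abstract
  set : List (Fin n) → Sub n
  set l = sep (λ x → ∈-list? _≟_ x l)

  set⁺ : ∀ {l : List (Fin n)} {x} → x ∈ˡ l → x ∈ set l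
  set⁺ {l = l} = sep⁺ (λ x → ∈-list? _≟_ x l)

  set⁻ : ∀ {l : List (Fin n)} {x} → x ∈ set l → x ∈ˡ l
  set⁻ {l = l} = sep⁻ (λ x → ∈-list? _≟_ x l)

#-set : ∀ {l : List (Fin n)} → Unique l → # (set l) ≡ length l
#-set {l = []} _ = empty⇒#≡0 (λ p → case set⁻ p of λ ())
#-set {l = x ∷ l} (h ∷ u) = trans (≤-antisym (#-mono f) (#-mono g))
  (trans (#-⊎ {A = ⁅ x ⁆} {set l} (λ p q → All.lookup h (set⁻ q) (sym (⁅⁆⁻ p)))) (cong₂ _+_ (#-⁅⁆ x) (#-set u)))
  where
  f : set (x ∷ l) ⊆ ⁅ x ⁆ ∪ set l
  f p with set⁻ p
  ... | here refl = ∪ˡ ⁅⁆⁺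
  ... | there q = ∪ʳ (set⁺ q)
  g : ⁅ x ⁆ ∪ set l ⊆ set (x ∷ l)
  g = ∪-⊆ (λ p → set⁺ (here (⁅⁆⁻ p))) (λ p → set⁺ (there (set⁻ p)))

#-set≤ : ∀ (l : List (Fin n)) → # (set l) ≤ length l
#-set≤ [] = ≤-reflexive (empty⇒#≡0 (λ p → case set⁻ p of λ ()))
#-set≤ (x ∷ l) = ≤-trans (#-mono f) (≤-trans (#-∪ ⁅ x ⁆ (set l)) (+-mono-≤ (≤-reflexive (#-⁅⁆ x)) (#-set≤ l)))
  where
  f : set (x ∷ l) ⊆ ⁅ x ⁆ ∪ set l
  f p with set⁻ p
  ... | here refl = ∪ˡ ⁅⁆⁺
  ... | there q = ∪ʳ (set⁺ q)

length≤# : ∀ {l : List (Fin n)} {A} → Unique l → All (_∈ A) l → length l ≤ # A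
length≤# u a = ≤-trans (≤-reflexive (sym (#-set u))) (#-mono (λ p → All.lookup a (set⁻ p)))

-- Lists without repetition

Unique-resp-↭ : {A : Set} {l r : List A} → l ↭ r → Unique l → Unique r
Unique-resp-↭ _↭_.refl u = u
Unique-resp-↭ (prep x p) (h ∷ u) = All-resp-↭ p h ∷ Unique-resp-↭ p u
Unique-resp-↭ (swap x y p) ((x≢y ∷ h) ∷ h′ ∷ u) =
  ((λ e → x≢y (sym e)) ∷ All-resp-↭ p h′) ∷ All-resp-↭ p h ∷ Unique-resp-↭ p u
Unique-resp-↭ (_↭_.trans p q) u = Unique-resp-↭ q (Unique-resp-↭ p u)

Unique-++⁻ : {A : Set} (l : List A) {r : List A} → Unique (l ++ r) → Unique l × Unique r ×
    (∀ {x} → x ∈ˡ l → x ∈ˡ r → ⊥)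
Unique-++⁻ [] u = [] , u , λ ()
Unique-++⁻ (x ∷ l) (h ∷ u) with a , b , c ← Unique-++⁻ l u =
  All.++⁻ˡ l h ∷ a , b , λ { (here refl) q → All.lookup (All.++⁻ʳ l h) q refl ; (there p) q → c p q }

Unique-++⁺ : {A : Set} {l r : List A} → Unique l → Unique r → (∀ {x} → x ∈ˡ l → x ∈ˡ r → ⊥) → Unique (l ++ r)
Unique-++⁺ u v d = Unique.++⁺ u v (λ (p , q) → d p q)

-- Neighbourhoods, paths as lists, components and holes.

module Basics {N : ℕ} (G : Graph N) where

  V : Set
  V = Fin N

  infix 4 _~_ _~?_

  _~_ : V → V → Set
  x ~ y = T (adj G x y)

  ~-sym : ∀ {x y} → x ~ y → y ~ x
  ~-sym {x} {y} = subst T (Graph.sym G x y)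

  ~-irrefl : ∀ {x} → ¬ (x ~ x)
  ~-irrefl {x} = subst T (irrefl G x)

  _~?_ : ∀ x y → Dec (x ~ y)
  x ~? y = T? (adj G x y)

  Apart : Sub N → Sub N → Set
  Apart A B = ∀ {a b} → a ∈ A → b ∈ B → ¬ (a ~ b)

  abstract
    N[_]_ : Sub N → Sub N → Sub N
    N[ S ] A = sep (λ x → (x ∈? S) ×-dec ((x ∈? A) ⊎-dec any? (λ a → (a ∈? A) ×-dec (a ~? x))))

    N⁻ : ∀ {S A x} → x ∈ N[ S ] A → x ∈ S × (x ∈ A ⊎ ∃[ a ] (a ∈ A × a ~ x))
    N⁻ {S} {A} = sep⁻ (λ x → (x ∈? S) ×-dec ((x ∈? A) ⊎-dec any? (λ a → (a ∈? A) ×-dec (a ~? x))))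

    N⁺ : ∀ {S A x} → x ∈ S → x ∈ A ⊎ ∃[ a ] (a ∈ A × a ~ x) → x ∈ N[ S ] A
    N⁺ {S} {A} p q = sep⁺ (λ x → (x ∈? S) ×-dec ((x ∈? A) ⊎-dec any? (λ a → (a ∈? A) ×-dec (a ~? x)))) (p , q)

  N-self : ∀ {S A x} → x ∈ S → x ∈ A → x ∈ N[ S ] A
  N-self p q = N⁺ p (inj₁ q)

  N-adj : ∀ {S A x a} → x ∈ S → a ∈ A → a ~ x → x ∈ N[ S ] A
  N-adj p q e = N⁺ p (inj₂ (_ , q , e))

  N⊆ : ∀ {S A} → N[ S ] A ⊆ S
  N⊆ p = proj₁ (N⁻ p)

  N-mono : ∀ {S S′ A A′} → S ⊆ S′ → A ⊆ A′ → N[ S ] A ⊆ N[ S′ ] A′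
  N-mono s a p with N⁻ p
  ... | q , inj₁ r = N-self (s q) (a r)
  ... | q , inj₂ (_ , r , e) = N-adj (s q) (a r) e

  N-∪ : ∀ {S A B} → N[ S ] (A ∪ B) ⊆ N[ S ] A ∪ N[ S ] B
  N-∪ p with N⁻ p
  N-∪ p | q , inj₁ r with ∪⁻ r
  ... | inj₁ a = ∪ˡ (N-self q a)
  ... | inj₂ b = ∪ʳ (N-self q b)
  N-∪ p | q , inj₂ (_ , r , e) with ∪⁻ r
  ... | inj₁ a = ∪ˡ (N-adj q a e)
  ... | inj₂ b = ∪ʳ (N-adj q b e)

  -- Chains, paths and cycles as lists of vertices

  Ch : List V → Set
  Ch [] = ⊤
  Ch (x ∷ []) = ⊤
  Ch (x ∷ y ∷ l) = x ~ y × Ch (y ∷ l)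

  Ch-tail : ∀ x l → Ch (x ∷ l) → Ch l
  Ch-tail x [] _ = tt
  Ch-tail x (y ∷ l) (_ , c) = c

  Ch-++ʳ : ∀ l {r} → Ch (l ++ r) → Ch r
  Ch-++ʳ [] c = c
  Ch-++ʳ (x ∷ l) c = Ch-++ʳ l (Ch-tail x _ c)

  Ch-++ˡ : ∀ l {r} → Ch (l ++ r) → Ch l
  Ch-++ˡ [] c = tt
  Ch-++ˡ (x ∷ []) c = tt
  Ch-++ˡ (x ∷ y ∷ l) (e , c) = e , Ch-++ˡ (y ∷ l) c

  Ch-++ : ∀ l x {r} → Ch (l ++ [ x ]) → Ch (x ∷ r) → Ch (l ++ x ∷ r)
  Ch-++ [] x _ d = d
  Ch-++ (y ∷ []) x (e , _) d = e , d
  Ch-++ (y ∷ z ∷ l) x (e , c) d = e , Ch-++ (z ∷ l) x c d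

  Ch-init : ∀ l x {r} → Ch (l ++ x ∷ r) → Ch (l ++ [ x ])
  Ch-init l x {r} c = Ch-++ˡ (l ++ [ x ]) (subst Ch (sym (++-assoc l [ x ] r)) c)

  Ch-snoc : ∀ l x y → Ch (l ++ [ x ]) → x ~ y → Ch ((l ++ [ x ]) ++ [ y ])
  Ch-snoc l x y c e = subst Ch (sym (++-assoc l [ x ] [ y ])) (Ch-++ l x c (e , tt))

  Ch-reverse : ∀ l → Ch l → Ch (reverse l)
  Ch-reverse [] c = tt
  Ch-reverse (x ∷ []) c = tt
  Ch-reverse (x ∷ y ∷ l) (e , c) = subst Ch eq
      (Ch-snoc (reverse l) y x (subst Ch (unfold-reverse y l) (Ch-reverse (y ∷ l) c)) (~-sym e))
    where
    eq : (reverse l ++ [ y ]) ++ [ x ] ≡ reverse (x ∷ y ∷ l)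
    eq = sym (trans (unfold-reverse x (y ∷ l)) (cong (_++ [ x ]) (unfold-reverse y l)))

  NoCycle : ℕ → Set
  NoCycle n = ∀ x r → Unique (x ∷ r) → Ch (x ∷ r ++ [ x ]) → length (x ∷ r) ≡ n → ⊥

  -- The target `p` is not listed and may lie outside `Q`, so the same notion describes paths inside
  -- a component and paths that leave it.
  Link : Sub N → V → V → Set
  Link Q e p = Σ[ ds ∈ List V ] Unique (e ∷ ds) × All (_∈ Q) (e ∷ ds) × Ch (e ∷ ds ++ [ p ])

  link-cons : ∀ {Q e d p} → e ∈ Q → e ~ d → Link Q d p → Link Q e p
  link-cons {Q} {e} {d} {p} eQ ed (ds , u , a , c) with ∈-list? _≟_ e (d ∷ ds)
  ... | no ∉ = d ∷ ds , All.tabulate (λ x∈ eq → ∉ (subst (_∈ˡ d ∷ ds) (sym eq) x∈)) ∷ u , eQ ∷ a , ed , c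
  ... | yes i with l₁ , l₂ , eq ← ∈-∃++ i =
    l₂ , proj₁ (proj₂ (Unique-++⁻ l₁ (subst Unique eq u))) , All.++⁻ʳ l₁ (subst (All (_∈ Q)) eq a) ,
      Ch-++ʳ l₁ (subst Ch (trans (cong (_++ [ p ]) eq) (++-assoc l₁ (e ∷ l₂) [ p ])) c)

  link-start : ∀ {Q e p} → e ∈ Q → e ~ p → Link Q e p
  link-start q e = [] , [] ∷ [] , q ∷ [] , e , tt

  -- Connectedness is encoded by `linked`: what can be reached from one vertex of `D` can be reached
  -- from every other. This is the form in which rerouting arguments use it.
  record Component (Q : Sub N) (a : V) : Set where
    field
      D : Sub N
      origin : a ∈ D
      D⊆Q : D ⊆ Q
      closed : ∀ {d e} → d ∈ D → e ∈ Q → d ~ e → e ∈ D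
      linked : ∀ {d e p} → d ∈ D → e ∈ D → Link Q d p → Link Q e p

  -- Take a largest set whose vertices reach the same targets as `a`. It is closed, because a
  -- neighbour in `Q` reaches the same targets and could be added.
  component : ∀ {Q a} → a ∈ Q → (Component Q a → ⊥) → ⊥
  component {Q} {a} aQ k = do
    D , (aD , D⊆Q , lk) , max ← maximum P # N (λ A _ → #≤n A) ⁅ a ⁆ P₀
    k record { D = D ; origin = aD ; D⊆Q = D⊆Q ; closed = closed D aD D⊆Q lk max
      ; linked = λ d e l → proj₂ (lk e) (proj₁ (lk d) l) }
    where
    P : Sub N → Set
    P D = a ∈ D × D ⊆ Q × (∀ {d} → d ∈ D → ∀ {p} → (Link Q d p → Link Q a p) × (Link Q a p → Link Q d p))
    P₀ : P ⁅ a ⁆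
    P₀ = ⁅⁆⁺ , (λ p → subst (_∈ Q) (sym (⁅⁆⁻ p)) aQ) , λ p {q} → subst (λ x → Link Q x q) (⁅⁆⁻ p) , subst
        (λ x → Link Q x q) (sym (⁅⁆⁻ p))
    closed : ∀ D → a ∈ D → D ⊆ Q → (∀ {d} → d ∈ D → ∀ {p} → (Link Q d p → Link Q a p) × (Link Q a p → Link Q d p)) →
      (∀ A → P A → # A ≤ # D) → ∀ {d e} → d ∈ D → e ∈ Q → d ~ e → e ∈ D
    closed D aD D⊆Q lk max {d} {e} dD eQ de with e ∈? D
    ... | yes p = p
    ... | no ∉ = ⊥-elim (1+n≰n (≤-trans (≤-reflexive
        (trans (+-comm 1 (# D)) (trans (cong (# D +_) (sym (#-⁅⁆ e)))
        (sym (#-⊎ {A = D} {⁅ e ⁆} (λ x y → ∉ (subst (_∈ D) (⁅⁆⁻ y) x)))))))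
        (max (D ∪ ⁅ e ⁆) (∪ˡ aD , ∪-⊆ D⊆Q (λ p → subst (_∈ Q) (sym (⁅⁆⁻ p)) eQ) , new))))
      where
      new : ∀ {x} → x ∈ D ∪ ⁅ e ⁆ → ∀ {p} → (Link Q x p → Link Q a p) × (Link Q a p → Link Q x p)
      new x∈ with ∪⁻ x∈
      ... | inj₁ q = lk q
      ... | inj₂ q with refl ← ⁅⁆⁻ q =
        (λ l → proj₁ (lk dD) (link-cons (D⊆Q dD) de l)) , (λ l → link-cons eQ (~-sym de) (proj₂ (lk dD) l))

  -- Holes: families of pairwise non-adjacent sets of prescribed sizes

  Hole : List ℕ → Sub N → Set
  Hole [] X = ⊤
  Hole (m ∷ ms) X = Σ[ A ∈ Sub N ] A ⊆ X × m ≤ # A × Hole ms (X ∖ N[ X ] A)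

  Hole-mono : ∀ ms {X Y} → X ⊆ Y → Hole ms X → Hole ms Y
  Hole-mono [] s _ = tt
  Hole-mono (m ∷ ms) {X} {Y} s (A , A⊆X , le , h) = A , (λ p → s (A⊆X p)) , le ,
    Hole-mono ms (λ p → let q , r = ∖⁻ p in ∖⁺ (s q) (λ t → r (N⁺ q (proj₂ (N⁻ t))))) h

  Hole-++ : ∀ ms₁ {ms₂ T₁ T₂} → Hole ms₁ T₁ → Hole ms₂ T₂ → (∀ {x} → x ∈ T₁ → x ∉ T₂) → Apart T₁ T₂ → Hole
      (ms₁ ++ ms₂) (T₁ ∪ T₂)
  Hole-++ [] {ms₂} _ h₂ _ _ = Hole-mono ms₂ ∪ʳ h₂
  Hole-++ (m ∷ ms₁) {ms₂} {T₁} {T₂} (A , A⊆ , le , h₁) h₂ disj apart = A , (λ p → ∪ˡ (A⊆ p)) , le ,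
    Hole-mono (ms₁ ++ ms₂) (∪-⊆ left right)
      (Hole-++ ms₁ h₁ h₂ (λ p → disj (∖⊆ p)) (λ p → apart (∖⊆ p)))
    where
    left : T₁ ∖ N[ T₁ ] A ⊆ (T₁ ∪ T₂) ∖ N[ T₁ ∪ T₂ ] A
    left p with q , r ← ∖⁻ p = ∖⁺ (∪ˡ q) (λ t → r (N⁺ q (proj₂ (N⁻ t))))
    right : T₂ ⊆ (T₁ ∪ T₂) ∖ N[ T₁ ∪ T₂ ] A
    right p = ∖⁺ (∪ʳ p) (λ t → case proj₂ (N⁻ t) of λ
      { (inj₁ q) → disj (A⊆ q) p ; (inj₂ (_ , q , e)) → apart (A⊆ q) p e })

  independent-hole : ∀ ms {S} → Apart S S → sum ms ≤ # S → Hole ms S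
  independent-hole [] _ _ = tt
  independent-hole (m ∷ ms) {S} ind le with A , A⊆S , eq ← subset-of-size {A = S} m (≤-trans (m≤m+n m (sum ms)) le) =
    A , A⊆S , ≤-reflexive (sym eq) , independent-hole ms (λ p q → ind (∖⊆ p) (∖⊆ q))
      ((lin12 {m} {sum ms} {_} {# A} {# (N[ S ] A)} {# (S ∖ N[ S ] A)}) le eq (#-mono N⊆A) (#-∖ S (N[ S ] A)))
    where
    N⊆A : N[ S ] A ⊆ A
    N⊆A p with N⁻ p
    ... | q , inj₁ r = r
    ... | q , inj₂ (_ , r , e) = ⊥-elim (ind (A⊆S r) q e)

module Cleaning {N : ℕ} (G : Graph N) where
  open Basics G

  -- Removing a largest small set B that fails to expand leaves a graph in which no small set fails,
  -- because failing sets are closed under unions.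
  clean : ∀ {S} s → 1 ≤ s →
    (∀ U → U ⊆ S → s ≤ # U → # U < s + s → 4 * # U < # (N[ S ] U)) →
    (Σ[ B ∈ Sub N ] (B ⊆ S × # B < s × # (N[ S ] B) ≤ 4 * # B ×
      (∀ U → U ⊆ S ∖ B → 1 ≤ # U → # U ≤ s → 4 * # U < # (N[ S ∖ B ] U))) → ⊥) → ⊥
  clean {S} s 1≤s mid k = do
    B , (B⊆S , B<s , NB) , max ← maximum P # N (λ A _ → #≤n A) ∅ P∅
    k (B , B⊆S , B<s , NB , λ U U⊆ 1≤U U≤s → ≰⇒> (λ NU → step B B⊆S B<s NB max U U⊆ 1≤U U≤s NU))
    where
    P : Sub N → Set
    P B = B ⊆ S × # B < s × # (N[ S ] B) ≤ 4 * # B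
    P∅ : P ∅
    P∅ = (λ p → ⊥-elim (∅⁻ p)) , ≤-trans (s≤s (≤-reflexive #-∅)) 1≤s ,
      ≤-trans (≤-reflexive (empty⇒#≡0 (λ p → case proj₂ (N⁻ p) of λ { (inj₁ q) → ∅⁻ q ; (inj₂ (_ , q , _)) → ∅⁻ q })))
          z≤n
    step : ∀ B → B ⊆ S → # B < s → # (N[ S ] B) ≤ 4 * # B → (∀ A → P A → # A ≤ # B) →
      ∀ U → U ⊆ S ∖ B → 1 ≤ # U → # U ≤ s → # (N[ S ∖ B ] U) ≤ 4 * # U → ⊥
    step B B⊆S B<s NB max U U⊆ 1≤U U≤s NU = conclude (<-≤-connex (# C) s)
      where
      C : Sub N
      C = B ∪ U
      C⊆S : C ⊆ S
      C⊆S = ∪-⊆ B⊆S (λ p → ∖⊆ (U⊆ p))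
      #C : # C ≡ # B + # U
      #C = #-⊎ (λ p q → proj₂ (∖⁻ (U⊆ q)) p)
      -- A neighbour of `U` inside `B` is already counted in the neighbourhood of `B`.
      cover : N[ S ] C ⊆ N[ S ] B ∪ N[ S ∖ B ] U
      cover {x} p with ∪⁻ (N-∪ p)
      ... | inj₁ q = ∪ˡ q
      ... | inj₂ q with x ∈? B
      ...   | yes b = ∪ˡ (N-self (N⊆ q) b)
      ...   | no ∉ = ∪ʳ (N⁺ (∖⁺ (N⊆ q) ∉) (proj₂ (N⁻ q)))
      NC : # (N[ S ] C) ≤ 4 * # C
      NC = (lin13 {_} {_} {# (N[ S ] B)} {# (N[ S ∖ B ] U)} {# B} {# U} {# C})
        (#-mono cover) (#-∪ _ _) NB NU #C
      conclude : # C < s ⊎ s ≤ # C → ⊥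
      conclude (inj₁ lt) = (lin14 {_} {# B} {# U}) (max C (C⊆S , lt , NC)) #C 1≤U
      conclude (inj₂ ge) = <⇒≱ (mid C C⊆S ge ((lin15 {_} {# B} {# U}) #C B<s U≤s)) NC

-- Tree embedding in expanders after Friedman and Pippenger

does⁺ : {P : Set} (d : Dec P) → P → T (does d)
does⁺ (yes _) _ = tt
does⁺ (no n) p = n p

does⁻ : {P : Set} (d : Dec P) → T (does d) → P
does⁻ (yes p) _ = p

module Image {N : ℕ} where

  abstract
    img : (Fin N → Fin N → Bool) → Sub N → Sub N
    img r U = sep (λ y → any? (λ u → (u ∈? U) ×-dec T? (r u y)))

    img⁺ : ∀ {r U u y} → u ∈ U → T (r u y) → y ∈ img r U
    img⁺ {r} {U} p q = sep⁺ (λ y → any? (λ u → (u ∈? U) ×-dec T? (r u y))) (_ , p , q)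

    img⁻ : ∀ {r U y} → y ∈ img r U → ∃[ u ] (u ∈ U × T (r u y))
    img⁻ {r} {U} = sep⁻ (λ y → any? (λ u → (u ∈? U) ×-dec T? (r u y)))

  img-mono : ∀ {r U U′} → U ⊆ U′ → img r U ⊆ img r U′
  img-mono s p = let u , q , e = img⁻ p in img⁺ (s q) e

  img-submodular : ∀ r A B → # (img r (A ∪ B)) + # (img r (A ∩ B)) ≤ # (img r A) + # (img r B)
  img-submodular r A B = (lin16 {# (img r (A ∪ B))} {# (img r A ∪ img r B)} {# (img r (A ∩ B))}
      {# (img r A ∩ img r B)} {# (img r A)} {# (img r B)})
    (#-mono f) (#-mono (λ p → ∩⁺ (img-mono ∩⊆ˡ p) (img-mono ∩⊆ʳ p))) (#-∪∩ (img r A) (img r B))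
    where
    f : img r (A ∪ B) ⊆ img r A ∪ img r B
    f p with u , q , e ← img⁻ p with ∪⁻ q
    ... | inj₁ a = ∪ˡ (img⁺ a e)
    ... | inj₂ b = ∪ʳ (img⁺ b e)

module Embedding {N : ℕ} (G : Graph N) (W : Sub N) (K β : ℕ) (1≤K : 1 ≤ K)
  (thick : ∀ U → U ⊆ W → K ≤ # U → # U ≤ K + K → # U + (4 * K + β) < # (Basics.N[_]_ G W U)) where
  open Basics G
  open Image {N}

  -- ρ u y means that y is reserved for u or still free; an embedded vertex y ∈ Z is reserved for its parent.
  record State : Set where
    field
      Z : Sub N
      ρ : V → V → Bool
      Z⊆W : Z ⊆ W
      ρ⇒~ : ∀ {u y} → T (ρ u y) → y ∈ W × u ~ y
      ρ-free : ∀ {u y} → y ∈ W → y ∉ Z → u ~ y → T (ρ u y)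
      parent∈Z : ∀ {u y} → y ∈ Z → T (ρ u y) → u ∈ Z
      -- Hall's condition for giving two children to every vertex of `U`. The range up to 2K
      -- contains the union of any two sets of fewer than K vertices, so that tight sets can be
      -- united.
      good : ∀ U → U ⊆ W → # U ≤ K + K → # U + # U ≤ # (img ρ U)

    children : V → Sub N
    children p = sep (λ y → (y ∈? Z) ×-dec T? (ρ p y))

    children⁻ : ∀ {p y} → y ∈ children p → y ∈ Z × T (ρ p y)
    children⁻ {p} = sep⁻ (λ y → (y ∈? Z) ×-dec T? (ρ p y))

    children⁺ : ∀ {p y} → y ∈ Z → T (ρ p y) → y ∈ children p
    children⁺ {p} q e = sep⁺ (λ y → (y ∈? Z) ×-dec T? (ρ p y)) (q , e)

  open State

  #Z : State → ℕ
  #Z st = # (Z st)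

  -- Growth happens only below `r`: a new vertex hangs from `r` or from another new vertex. All
  -- other old vertices therefore gain no children, and their free slots survive.
  record Ext (st : State) (r : V) (st′ : State) : Set where
    field
      grow : Z st ⊆ Z st′
      old : ∀ {u y} → y ∈ Z st → T (ρ st′ u y) → T (ρ st u y)
      new : ∀ {u y} → y ∈ Z st′ → y ∉ Z st → T (ρ st′ u y) → u ≡ r ⊎ u ∉ Z st

  open Ext

  Ext-refl : ∀ {st r} → Ext st r st
  Ext-refl = record { grow = id ; old = λ _ q → q ; new = λ p x∉ _ → ⊥-elim (x∉ p) }

  Ext-trans : ∀ {st st′ st″ r r′} → r′ ≡ r ⊎ r′ ∉ Z st → Ext st r st′ → Ext st′ r′ st″ → Ext st r st″
  Ext-trans {st} {st′} {st″} {r} {r′} rr e e′ = record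
    { grow = grow e′ ∘ grow e
    ; old = λ p q → old e p (old e′ (grow e p) q)
    ; new = λ {u} {y} p x∉ q → case y ∈? Z st′ of λ
        { (yes i) → new e i x∉ (old e′ i q)
        ; (no ¬i) → case new e′ p ¬i q of λ
            { (inj₁ refl) → rr
            ; (inj₂ j) → inj₂ (j ∘ grow e) } } }

  children-Ext : ∀ {st r st′} → Ext st r st′ → ∀ {q} → q ∈ Z st → q ≢ r → children st′ q ⊆ children st q
  children-Ext {st} {r} {st′} e q∈ q≢ {y} c with p , t ← children⁻ st′ c with y ∈? Z st
  ... | yes i = children⁺ st i (old e i t)
  ... | no x∉ = ⊥-elim (case new e p x∉ t of λ { (inj₁ eq) → q≢ eq ; (inj₂ j) → j q∈ })

  record Leaf (st : State) (p : V) : Set where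
    field
      y : V
      y∉Z : y ∉ Z st
      p~y : p ~ y
      st′ : State
      ext : Ext st p st′
      y∈Z′ : y ∈ Z st′
      Z′⊆ : Z st′ ⊆ Z st ∪ ⁅ y ⁆
      parent : ∀ {u} → T (ρ st′ u y) → u ≡ p
      childless : ∀ {z} → z ∉ children st′ y

  #Z-Leaf : ∀ {st p} (l : Leaf st p) → #Z (Leaf.st′ l) ≤ suc (#Z st)
  #Z-Leaf {st} l = (lin17 {_} {_} {#Z st} {# (⁅ Leaf.y l ⁆)}) (#-mono (Leaf.Z′⊆ l)) (#-∪ _ _) (#-⁅⁆ _)

  module _ (st : State) (#Z≤β : #Z st ≤ β) where

    -- Reservations withhold from `U` only embedded vertices, of which there are at most `β`.
    -- Consequently a tight set has fewer than K vertices.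
    thick-ρ : ∀ U → U ⊆ W → K ≤ # U → # U ≤ K + K → # U + # U < # (img (ρ st) U)
    thick-ρ U U⊆W K≤U U≤2K = (lin18 {# U} {K} {β} {_} {# (U ∪ Z st)} {# (N[ W ] U ∖ (U ∪ Z st))} {#Z st}
        {# (img (ρ st) U)})
      U≤2K (thick U U⊆W K≤U U≤2K) (#-∖ (N[ W ] U) (U ∪ Z st)) (#-∪ U (Z st)) (#-mono f) #Z≤β
      where
      f : N[ W ] U ∖ (U ∪ Z st) ⊆ img (ρ st) U
      f p with q , x∉ ← ∖⁻ p with N⁻ q
      ... | w , inj₁ u = ⊥-elim (x∉ (∪ˡ u))
      ... | w , inj₂ (a , a∈ , e) = img⁺ a∈ (ρ-free st w (λ z → x∉ (∪ʳ z)) e)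

    module _ (p : V) (p∈Z : p ∈ Z st) (y : V) (y∈W : y ∈ W) (y∉Z : y ∉ Z st) (p~y : p ~ y) where

      ρ′ : V → V → Bool
      ρ′ u z = if does (z ≟ y) then does (u ≟ p) else ρ st u z

      ρ′-y : ∀ {u} → T (ρ′ u y) → u ≡ p
      ρ′-y {u} t with y ≟ y | u ≟ p
      ... | yes _ | yes e = e
      ... | no n | _ = ⊥-elim (n refl)

      ρ′-py : T (ρ′ p y)
      ρ′-py with y ≟ y | p ≟ p
      ... | yes _ | yes _ = tt
      ... | yes _ | no n = n refl
      ... | no n | _ = ⊥-elim (n refl)

      ρ′-other : ∀ {u z} → z ≢ y → ρ′ u z ≡ ρ st u z
      ρ′-other {u} {z} n with z ≟ y
      ... | yes e = ⊥-elim (n e)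
      ... | no _ = refl

      leaf : (∀ U → U ⊆ W → # U ≤ K + K → # U + # U ≤ # (img ρ′ U)) → Leaf st p
      leaf good′ = record
        { y = y ; y∉Z = y∉Z ; p~y = p~y
        ; st′ = st′
        ; ext = record { grow = ∪ˡ ; old = λ {u} i t → subst T (ρ′-other (λ { refl → y∉Z i })) t
            ; new = λ i x∉ t → case ∪⁻ i of λ { (inj₁ j) → ⊥-elim (x∉ j) ; (inj₂ j) → inj₁
                (ρ′-y (subst (λ z → T (ρ′ _ z)) (⁅⁆⁻ j) t)) } }
        ; y∈Z′ = ∪ʳ ⁅⁆⁺ ; Z′⊆ = id ; parent = ρ′-y
        ; childless = λ {z} c → let i , t = children⁻ st′ c in y∉Z (par i t) }
        where
        par : ∀ {u z} → z ∈ Z st ∪ ⁅ y ⁆ → T (ρ′ u z) → u ∈ Z st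
        par {u} {z} i t with z ≟ y
        ... | yes refl = subst (_∈ Z st) (sym (ρ′-y ρ″)) p∈Z
          where
          ρ″ : T (ρ′ u y)
          ρ″ with y ≟ y
          ... | yes _ = t
          ... | no n = ⊥-elim (n refl)
        ... | no n with ∪⁻ i
        ...   | inj₁ j = parent∈Z st j t
        ...   | inj₂ j = ⊥-elim (n (⁅⁆⁻ j))
        edge : ∀ {u z} → T (ρ′ u z) → z ∈ W × u ~ z
        edge {u} {z} t = case z ≟ y of λ
          { (yes refl) → y∈W , subst (_~ y) (sym (ρ′-y t)) p~y
          ; (no n) → ρ⇒~ st (subst T (ρ′-other n) t) }
        st′ : State
        st′ = record
          { Z = Z st ∪ ⁅ y ⁆ ; ρ = ρ′
          ; Z⊆W = ∪-⊆ (Z⊆W st) (λ i → subst (_∈ W) (sym (⁅⁆⁻ i)) y∈W)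
          ; ρ⇒~ = edge
          ; ρ-free = λ {u} {z} w x∉ e → subst T (sym (ρ′-other (λ { refl → x∉ (∪ʳ ⁅⁆⁺) }))) (ρ-free st w (x∉ ∘ ∪ˡ) e)
          ; parent∈Z = λ i t → ∪ˡ (par i t)
          ; good = good′ }

      -- Reserving y for p can only hurt a tight set that avoids p and reaches y.
      good-after : ∀ T₀ → (∀ U → U ⊆ W → p ∉ U → # U ≤ K + K → # (img (ρ st) U) ≤ # U + # U → U ⊆ T₀) → y ∉ img (ρ st)
          T₀ →
        ∀ U → U ⊆ W → # U ≤ K + K → # U + # U ≤ # (img ρ′ U)
      good-after T₀ T₀-max y∉ U U⊆W U≤ with p ∈? U | y ∈? img (ρ st) U
      ... | yes p∈ | _ = ≤-trans (good st U U⊆W U≤) (#-mono f)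
        where
        f : img (ρ st) U ⊆ img ρ′ U
        f {z} i with u , u∈ , t ← img⁻ i with z ≟ y
        ... | yes refl = img⁺ p∈ ρ′-py
        ... | no n = img⁺ u∈ (subst T (sym (ρ′-other n)) t)
      ... | no _ | no x∉ = ≤-trans (good st U U⊆W U≤) (#-mono (λ {z} i → let u , u∈ , t = img⁻ i in
              img⁺ u∈ (subst T (sym (ρ′-other (λ { refl → x∉ i }))) t)))
      ... | no p∉ | yes y∈ = (lin19 {# U} {# (img (ρ st) U)} {# (⁅ y ⁆)} {# (img (ρ st) U ∖ ⁅ y ⁆)})
            (≰⇒> (λ le → y∉ (img-mono (T₀-max U U⊆W p∉ U≤ le) y∈))) (#-∖ (img (ρ st) U) ⁅ y ⁆) (#-⁅⁆ y) (#-mono f)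
        where
        f : img (ρ st) U ∖ ⁅ y ⁆ ⊆ img ρ′ U
        f {z} i with j , x∉ ← ∖⁻ i with u , u∈ , t ← img⁻ j = img⁺ u∈
            (subst T (sym (ρ′-other (λ { refl → x∉ ⁅⁆⁺ }))) t)

    -- If no free neighbour of `p` were suitable, each would be reached by a tight set avoiding `p`.
    -- By submodularity tight sets are closed under union, so the largest one, `T₀`, reaches them
    -- all. Then `T₀` with `p` added reaches at most 2|T₀| + 1 vertices, one too few for `good`.
    addLeaf : ∀ p → p ∈ Z st → # (children st p) ≤ 1 → (Leaf st p → ⊥) → ⊥
    addLeaf p p∈Z deg k = do
      T₀ , tight₀ , max ← maximum Tight # N (λ A _ → #≤n A) ∅ tight-∅
      finish T₀ tight₀ max
      where
      Tight : Sub N → Set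
      Tight U = U ⊆ W × p ∉ U × # U ≤ K + K × # (img (ρ st) U) ≤ # U + # U
      tight-∅ : Tight ∅
      tight-∅ = (λ i → ⊥-elim (∅⁻ i)) , ∅⁻ , ≤-trans (≤-reflexive #-∅) z≤n ,
        ≤-trans (≤-reflexive (empty⇒#≡0 (λ i → ∅⁻ (proj₁ (proj₂ (img⁻ i)))))) z≤n
      small : ∀ {U} → Tight U → # U < K
      small {U} (a , _ , b , c) = ≰⇒> (λ K≤ → <⇒≱ (thick-ρ U a K≤ b) c)
      finish : ∀ T₀ → Tight T₀ → (∀ A → Tight A → # A ≤ # T₀) → ⊥
      finish T₀ tight₀@(T₀⊆W , p∉T₀ , T₀≤ , img₀) max =
        (lin20 {# (T₀ ∪ ⁅ p ⁆)} {_} {# T₀} {# (⁅ p ⁆)} {_} {# (img (ρ st) T₀)} {# (children st p)})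
          (good st (T₀ ∪ ⁅ p ⁆) (∪-⊆ T₀⊆W (λ i → subst (_∈ W) (sym (⁅⁆⁻ i)) (Z⊆W st p∈Z)))
            ((lin21 {_} {# T₀} {# (⁅ p ⁆)} {K}) #T₁ (#-⁅⁆ p) (small tight₀)))
          #T₁ (#-⁅⁆ p) (#-mono cover) (#-∪ _ _) img₀ deg
        where
        #T₁ : # (T₀ ∪ ⁅ p ⁆) ≡ # T₀ + # ⁅ p ⁆
        #T₁ = #-⊎ (λ i j → p∉T₀ (subst (_∈ T₀) (⁅⁆⁻ j) i))
        absorb : ∀ U → U ⊆ W → p ∉ U → # U ≤ K + K → # (img (ρ st) U) ≤ # U + # U → U ⊆ T₀
        absorb U U⊆W p∉U U≤ tU {u} u∈ with u ∈? T₀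
        ... | yes i = i
        ... | no x∉ = ⊥-elim ((lin22 {# (T₀ ∪ U)} {_} {# ((T₀ ∪ U) ∖ T₀)}) (max (T₀ ∪ U) tightU)
            (∈⇒1≤# {A = (T₀ ∪ U) ∖ T₀} (∖⁺ (∪ʳ u∈) x∉)) (#-∖⊆ {A = T₀ ∪ U} ∪ˡ))
          where
          U<K : # U < K
          U<K = small (U⊆W , p∉U , U≤ , tU)
          tightU : Tight (T₀ ∪ U)
          tightU = ∪-⊆ T₀⊆W U⊆W , (λ i → case ∪⁻ i of λ { (inj₁ j) → p∉T₀ j ; (inj₂ j) → p∉U j }) ,
            (lin23 {_} {# T₀} {# U} {K}) (#-∪ T₀ U) (small tight₀) U<K ,
            (lin24 {# (img (ρ st) (T₀ ∪ U))} {# (img (ρ st) (T₀ ∩ U))} {# (img (ρ st) T₀)} {# (img (ρ st) U)} {# T₀}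
                {# U} {# (T₀ ∪ U)} {# (T₀ ∩ U)})
              (img-submodular (ρ st) T₀ U) img₀ tU (#-∪∩ T₀ U)
              (good st (T₀ ∩ U) (T₀⊆W ∘ ∩⊆ˡ) (≤-trans (#-mono ∩⊆ˡ) T₀≤))
        cover : img (ρ st) (T₀ ∪ ⁅ p ⁆) ⊆ img (ρ st) T₀ ∪ children st p
        cover {y} i with u , u∈ , t ← img⁻ i with ∪⁻ u∈
        ... | inj₁ j = ∪ˡ (img⁺ j t)
        ... | inj₂ j with refl ← ⁅⁆⁻ j with y ∈? Z st | y ∈? img (ρ st) T₀
        ...   | yes z | _ = ∪ʳ (children⁺ st z t)
        ...   | no _ | yes q = ∪ˡ q
        ...   | no x∉ | no q = ⊥-elim (k (leaf p p∈Z y (proj₁ (ρ⇒~ st t)) x∉ (proj₂ (ρ⇒~ st t))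
                    (good-after p p∈Z y (proj₁ (ρ⇒~ st t)) x∉ (proj₂ (ρ⇒~ st t)) T₀ absorb q)))

  -- Forgotten vertices become available to all their neighbours again, so the relation `ρ` only
  -- grows and `good` persists. This allows a search tree to be discarded except for the part that
  -- is wanted.
  restrict : ∀ {st₀ r st} → Ext st₀ r st → ∀ Z₁ → Z st₀ ⊆ Z₁ → Z₁ ⊆ Z st → (∀ {u y} → y ∈ Z₁ → T (ρ st u y) → u ∈ Z₁)
      →
    Σ[ st₁ ∈ State ] Z st₁ ≡ Z₁ × Ext st₀ r st₁ × (∀ {u y} → y ∈ Z₁ → T (ρ st₁ u y) → T (ρ st u y))
  restrict {st₀} {r} {st} e Z₁ Z₀⊆ ⊆Z par = st₁ , refl ,
      record { grow = Z₀⊆ ; old = λ i t → old e i (ρ₁-in (Z₀⊆ i) t) ; new = λ i x∉ t → new e (⊆Z i) x∉ (ρ₁-in i t) } ,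
          ρ₁-in
    where
    ρ₁ : V → V → Bool
    ρ₁ u y = if does (y ∈? Z₁) then ρ st u y else does ((y ∈? W) ×-dec (u ~? y))
    ρ₁-in : ∀ {u y} → y ∈ Z₁ → T (ρ₁ u y) → T (ρ st u y)
    ρ₁-in {u} {y} i t with y ∈? Z₁
    ... | yes _ = t
    ... | no x∉ = ⊥-elim (x∉ i)
    ρ₁-out : ∀ {u y} → y ∈ W → y ∉ Z₁ → u ~ y → T (ρ₁ u y)
    ρ₁-out {u} {y} w x∉ t with y ∈? Z₁
    ... | yes i = ⊥-elim (x∉ i)
    ... | no _ = does⁺ ((y ∈? W) ×-dec (u ~? y)) (w , t)
    ρ⊆ρ₁ : ∀ {u y} → T (ρ st u y) → T (ρ₁ u y)
    ρ⊆ρ₁ {u} {y} t with y ∈? Z₁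
    ... | yes _ = t
    ... | no _ = does⁺ ((y ∈? W) ×-dec (u ~? y)) (ρ⇒~ st t)
    edge : ∀ {u y} → T (ρ₁ u y) → y ∈ W × u ~ y
    edge {u} {y} t with y ∈? Z₁
    ... | yes _ = ρ⇒~ st t
    ... | no _ = does⁻ ((y ∈? W) ×-dec (u ~? y)) t
    st₁ : State
    st₁ = record { Z = Z₁ ; ρ = ρ₁ ; Z⊆W = Z⊆W st ∘ ⊆Z ; ρ⇒~ = edge ; ρ-free = ρ₁-out
      ; parent∈Z = λ i t → par i (ρ₁-in i t)
      ; good = λ U a b → ≤-trans (good st U a b) (#-mono (λ i → let u , u∈ , t = img⁻ i in img⁺ u∈ (ρ⊆ρ₁ t))) }

-- The numbers of vertices used by a binary tree of depth e, by a group of m tips at depth h, and by a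
-- binary tree of depth i with groups ms attached.
fullCost : ℕ → ℕ
fullCost zero = 0
fullCost (suc e) = 2 + (fullCost e + fullCost e)

groupCost : ℕ → ℕ → ℕ
groupCost h m = (h ∸ ⌈log₂ m ⌉) + fullCost ⌈log₂ m ⌉

cost : ℕ → ℕ → List ℕ → ℕ
cost h zero ms = sum (map (groupCost h) ms)
cost h (suc i) ms = 2 + (cost h i (take (2 ^ i) ms) + cost h i (drop (2 ^ i) ms))

Hd : {A : Set} → A → List A → Set
Hd t [] = ⊥
Hd t (x ∷ _) = t ≡ x

Hd-++ : {A : Set} {t : A} (l : List A) {r : List A} → Hd t l → Hd t (l ++ r)
Hd-++ (x ∷ l) p = p

∉⇒Unique-∷ʳ : {A : Set} {l : List A} {y : A} → Unique l → y ∉ˡ l → Unique (l ++ [ y ])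
∉⇒Unique-∷ʳ u n = Unique-++⁺ u ([] ∷ []) (λ { p (here refl) → n p })

-- Trees of prescribed shape and their paths up to the root.

module Trees {N : ℕ} (G : Graph N) (W : Sub N) (K β : ℕ) (1≤K : 1 ≤ K)
  (thick : ∀ U → U ⊆ W → K ≤ # U → # U ≤ K + K → # U + (4 * K + β) < # (Basics.N[_]_ G W U)) where
  open Basics G public
  open Embedding G W K β 1≤K thick public
  open State public
  open Ext public

  -- Paths that climb towards the root: an entry is reserved for no vertex but its successor. This
  -- uniqueness later limits the children of a vertex on such a path.
  UC : State → List V → Set
  UC st [] = ⊤
  UC st (y ∷ []) = ⊤
  UC st (y ∷ u ∷ l) = (y ~ u × (∀ {w} → T (ρ st w y) → w ≡ u)) × UC st (u ∷ l)

  UC⇒Ch : ∀ {st} l → UC st l → Ch l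
  UC⇒Ch [] _ = tt
  UC⇒Ch (x ∷ []) _ = tt
  UC⇒Ch (x ∷ y ∷ l) ((e , _) , c) = e , UC⇒Ch (y ∷ l) c

  UC-++ : ∀ {st} l x {r} → UC st (l ++ [ x ]) → UC st (x ∷ r) → UC st (l ++ x ∷ r)
  UC-++ [] x _ d = d
  UC-++ (y ∷ []) x (e , _) d = e , d
  UC-++ (y ∷ z ∷ l) x (e , c) d = e , UC-++ (z ∷ l) x c d

  UC-Ext : ∀ {st r st′} → Ext st r st′ → ∀ l {x} → All (_∈ Z st) l → UC st (l ++ [ x ]) → UC st′ (l ++ [ x ])
  UC-Ext e [] _ _ = tt
  UC-Ext e (y ∷ []) (i ∷ _) ((a , f) , _) = (a , λ t → f (old e i t)) , tt
  UC-Ext e (y ∷ z ∷ l) (i ∷ is) ((a , f) , c) = (a , λ t → f (old e i t)) , UC-Ext e (z ∷ l) is c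

  New : State → State → V → Set
  New st₀ st v = v ∈ Z st × v ∉ Z st₀

  -- The root is not listed; reading the tip from `l ++ [ r ]` also covers depth 0, where the tip is
  -- the root itself.
  Up : State → State → V → ℕ → V → Set
  Up st₀ st r d t = Σ[ l ∈ List V ] length l ≡ d × UC st (l ++ [ r ]) × All (New st₀ st) l × Unique l × Hd t
      (l ++ [ r ])

  Up-Ext : ∀ {st₀ st st′ r r′ d t} → Ext st r′ st′ → Up st₀ st r d t → Up st₀ st′ r d t
  Up-Ext e (l , len , c , a , u , hd) = l , len , UC-Ext e l (All.map proj₁ a) c , All.map (λ (p , q) → grow e p , q)
      a , u , hd

  Up-child : ∀ {st₀ r} (L : Leaf st₀ r) {st d t} → Ext (Leaf.st′ L) (Leaf.y L) st → Up (Leaf.st′ L) st (Leaf.y L) d t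
      → Up st₀ st r (suc d) t
  Up-child {st₀} {r} L {st} {d} {t} e (l , len , c , a , u , hd) =
    l ++ [ y ] , trans (length-++ l) (trans (+-comm (length l) 1) (cong suc len)) ,
    subst (UC st) (sym (++-assoc l [ y ] [ r ])) (UC-++ l y c ((~-sym p~y , λ q → parent (old e y∈Z′ q)) , tt)) ,
    All.++⁺ (All.map (λ (p , q) → p , λ z → q (grow ext z)) a) ((grow e y∈Z′ , y∉Z) ∷ []) ,
    ∉⇒Unique-∷ʳ u (λ i → proj₂ (All.lookup a i) y∈Z′) , Hd-++ (l ++ [ y ]) hd
    where open Leaf L

  record Grown (st₀ : State) (r : V) (d c : ℕ) (P : Sub N → Set) : Set where
    field
      st : State
      ext : Ext st₀ r st
      size : #Z st ≤ #Z st₀ + c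
      tips : Sub N
      up : ∀ {t} → t ∈ tips → Up st₀ st r d t
      property : P tips

  Fresh : State → V → Set
  Fresh st r = r ∈ Z st × (∀ {z} → z ∉ children st r)

  Fresh-deg : ∀ {st r} → Fresh st r → # (children st r) ≤ 1
  Fresh-deg (_ , f) = ≤-trans (≤-reflexive (empty⇒#≡0 f)) z≤n

  leaf-fresh : ∀ {st p} (L : Leaf st p) → Fresh (Leaf.st′ L) (Leaf.y L)
  leaf-fresh L = Leaf.y∈Z′ L , Leaf.childless L

  viaChild : ∀ {st r d c P} (L : Leaf st r) → Grown (Leaf.st′ L) (Leaf.y L) d c P → Grown st r (suc d) (suc c) P
  viaChild {st} {r} {d} {c} L g = record
    { st = G′.st ; ext = Ext-trans (inj₂ y∉Z) ext G′.ext
    ; size = (lin25 {_} {#Z st′} {c} {#Z st}) G′.size (#Z-Leaf L)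
    ; tips = G′.tips ; up = λ p → Up-child L G′.ext (G′.up p) ; property = G′.property }
    where
    open Leaf L
    module G′ = Grown g

  Grower : ℕ → ℕ → (Sub N → Set) → Set
  Grower d c P = ∀ st r → Fresh st r → #Z st + c ≤ β → (Grown st r d c P → ⊥) → ⊥

  line : ∀ j {d c P} → Grower d c P → Grower (j + d) (j + c) P
  line zero g = g
  line (suc j) {d} {c} g st r fr b k = do
    L ← addLeaf st (≤-trans (m≤m+n _ _) b) r (proj₁ fr) (Fresh-deg {st} {r} fr)
    g′ ← line j {d} {c} g (Leaf.st′ L) (Leaf.y L) (leaf-fresh L)
        ((lin26 {#Z (Leaf.st′ L)} {#Z st} {j} {c}) (#Z-Leaf L) b)
    k (viaChild L g′)

  record Fork (st : State) (r : V) (d c : ℕ) (P₁ P₂ : Sub N → Set) : Set where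
    field
      mid st′ : State
      ext₁ : Ext st r mid
      ext₂ : Ext mid r st′
      size : #Z st′ ≤ #Z st + c
      tips₁ tips₂ : Sub N
      up₁ : ∀ {t} → t ∈ tips₁ → Up st mid r (suc d) t
      up₂ : ∀ {t} → t ∈ tips₂ → Up mid st′ r (suc d) t
      property₁ : P₁ tips₁
      property₂ : P₂ tips₂

    tips-disjoint : ∀ {x} → x ∈ tips₁ → x ∉ tips₂
    tips-disjoint p q with up₁ p | up₂ q
    ... | (_ ∷ _) , _ , _ , (i , _) ∷ _ , _ , refl | (_ ∷ _) , _ , _ , (_ , n) ∷ _ , _ , refl = n i

  -- The second branch is begun when the first is complete. Everything added so far hangs below the
  -- first child, so `r` still has a single child and may receive another.
  fork : ∀ {d c₁ c₂ P₁ P₂} st r → Fresh st r → #Z st + (2 + (c₁ + c₂)) ≤ β →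
    (∀ (L : Leaf st r) → #Z (Leaf.st′ L) + c₁ ≤ β → (Grown (Leaf.st′ L) (Leaf.y L) d c₁ P₁ → ⊥) → ⊥) →
    (∀ mid → Ext st r mid → (L : Leaf mid r) → #Z (Leaf.st′ L) + c₂ ≤ β → (Grown (Leaf.st′ L) (Leaf.y L) d c₂ P₂ → ⊥)
        → ⊥) →
    (Fork st r d (2 + (c₁ + c₂)) P₁ P₂ → ⊥) → ⊥
  fork {d} {c₁} {c₂} {P₁} {P₂} st r fr b g₁ g₂ k = do
    L₁ ← addLeaf st (≤-trans (m≤m+n _ _) b) r (proj₁ fr) (Fresh-deg {st} {r} fr)
    G₁ ← g₁ L₁ ((lin27 {#Z (Leaf.st′ L₁)} {#Z st} {c₁} {c₂}) (#Z-Leaf L₁) b)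
    second L₁ G₁
    where
    module _ (L₁ : Leaf st r) (G₁ : Grown (Leaf.st′ L₁) (Leaf.y L₁) d c₁ P₁) where
      V₁ : Grown st r (suc d) (suc c₁) P₁
      V₁ = viaChild L₁ G₁
      module V₁ = Grown V₁
      r≢y : r ≢ Leaf.y L₁
      r≢y refl = Leaf.y∉Z L₁ (proj₁ fr)
      deg : # (children V₁.st r) ≤ 1
      deg = ≤-trans (#-mono child) (≤-reflexive (#-⁅⁆ (Leaf.y L₁)))
        where
        child : children V₁.st r ⊆ ⁅ Leaf.y L₁ ⁆
        child {z} c with zi , zt ← children⁻ (Leaf.st′ L₁)
            (children-Ext (Grown.ext G₁) (grow (Leaf.ext L₁) (proj₁ fr)) r≢y c)
          with ∪⁻ (Leaf.Z′⊆ L₁ zi)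
        ... | inj₂ q = q
        ... | inj₁ q = ⊥-elim (proj₂ fr (children⁺ st q (old (Leaf.ext L₁) q zt)))
      second : ⊥
      second = do
        L₂ ← addLeaf V₁.st ((lin28 {_} {#Z st} {c₁} {c₂}) V₁.size b) r (grow V₁.ext (proj₁ fr)) deg
        G₂ ← g₂ V₁.st V₁.ext L₂ ((lin29 {_} {#Z st} {c₁} {c₂} {_} {#Z (Leaf.st′ L₂)}) V₁.size b (#Z-Leaf L₂))
        final L₂ (viaChild L₂ G₂)
        where
        final : (L₂ : Leaf V₁.st r) → Grown V₁.st r (suc d) (suc c₂) P₂ → ⊥
        final L₂ V₂ = k record
          { mid = V₁.st ; st′ = V₂.st ; ext₁ = V₁.ext ; ext₂ = V₂.ext
          ; size = (lin30 {#Z V₁.st} {#Z st} {c₁} {_} {c₂}) V₁.size V₂.size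
          ; tips₁ = V₁.tips ; tips₂ = V₂.tips ; up₁ = V₁.up ; up₂ = V₂.up
          ; property₁ = V₁.property ; property₂ = V₂.property }
          where module V₂ = Grown V₂

  fromFork : ∀ {st r d c P₁ P₂ P} (F : Fork st r d c P₁ P₂) → P (Fork.tips₁ F ∪ Fork.tips₂ F) → Grown st r (suc d) c P
  fromFork {st} {r} {d} F p = record
    { st = st′ ; ext = Ext-trans (inj₁ refl) ext₁ ext₂ ; size = size ; tips = tips₁ ∪ tips₂ ; up = λ i → merge (∪⁻ i)
        ; property = p }
    where
    open Fork F
    merge : ∀ {t} → t ∈ tips₁ ⊎ t ∈ tips₂ → Up st st′ r (suc d) t
    merge (inj₁ i) = Up-Ext {st₀ = st} ext₂ (up₁ i)
    merge (inj₂ i) with l , len , c , a , u , hd ← up₂ i = l , len , c , All.map (λ (x , n) → x , n ∘ grow ext₁) a , u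
        , hd

  full-tree : ∀ e → Grower e (fullCost e) (λ T → 2 ^ e ≤ # T)
  full-tree zero st r fr b k = k record
    { st = st ; ext = Ext-refl ; size = m≤m+n _ _ ; tips = ⁅ r ⁆
    ; up = λ p → [] , refl , tt , [] , [] , ⁅⁆⁻ p ; property = ≤-reflexive (sym (#-⁅⁆ r)) }
  full-tree (suc e) st r fr b k = do
    F ← fork {e} {fullCost e} {fullCost e} st r fr b (λ L → full-tree e _ _ (leaf-fresh L))
        (λ _ _ L → full-tree e _ _ (leaf-fresh L))
    k (fromFork F ((lin31 {2 ^ e} {# (Fork.tips₁ F)} {# (Fork.tips₂ F)}) (Fork.property₁ F) (Fork.property₂ F)
        (#-⊎ (Fork.tips-disjoint F))))

  -- A lollipop consists of two chains of equal length d > h that leave a stem and whose tips are adjacent.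
  record Lollipop (st₀ : State) (s : V) (h b : ℕ) : Set where
    field
      st : State
      ext : Ext st₀ s st
      d : ℕ
      h<d : h < d
      x y a : V
      xs ys w : List V
      size : d + length w ≤ h + b
      length-xs : length (x ∷ xs) ≡ d
      length-ys : length (y ∷ ys) ≡ d
      UC-xs : UC st ((x ∷ xs) ++ [ a ])
      UC-ys : UC st ((y ∷ ys) ++ [ a ])
      UC-w : UC st ((a ∷ w) ++ [ s ])
      unique : Unique ((x ∷ xs) ++ (y ∷ ys) ++ (a ∷ w))
      all-new : All (New st₀ st) ((x ∷ xs) ++ (y ∷ ys) ++ (a ∷ w))
      x~y : x ~ y

  record Stem (st₀ : State) (s : V) (st : State) (r : V) (b : ℕ) : Set where
    field
      ext : Ext st₀ s st
      w : List V
      len : length w ≤ b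
      UC-w : UC st ((r ∷ w) ++ [ s ])
      all-new : All (New st₀ st) (r ∷ w)
      unique : Unique (r ∷ w)

  Stem-Ext : ∀ {st₀ s st r b st′ r′} → r′ ∉ Z st₀ → Ext st r′ st′ → Stem st₀ s st r b → Stem st₀ s st′ r b
  Stem-Ext {r = r} n e S = record
    { ext = Ext-trans (inj₂ n) (Stem.ext S) e ; w = Stem.w S ; len = Stem.len S
    ; UC-w = UC-Ext e (r ∷ Stem.w S) (All.map proj₁ (Stem.all-new S)) (Stem.UC-w S)
    ; all-new = All.map (λ (p , q) → grow e p , q) (Stem.all-new S) ; unique = Stem.unique S }

  Stem-Leaf : ∀ {st₀ s st r b} (L : Leaf st r) → Stem st₀ s st r b → Stem st₀ s (Leaf.st′ L) (Leaf.y L) (suc b)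
  Stem-Leaf {st₀} {s} {st} {r} L S = record
    { ext = E.ext ; w = r ∷ E.w ; len = s≤s E.len
    ; UC-w = (~-sym p~y , parent) , E.UC-w
    ; all-new = (y∈Z′ , λ z → y∉Z (grow (Stem.ext S) z)) ∷ E.all-new
    ; unique = All.tabulate (λ { i refl → y∉Z (proj₁ (All.lookup (Stem.all-new S) i)) }) ∷ Stem.unique S }
    where
    open Leaf L
    module E = Stem (Stem-Ext (proj₂ (All.head (Stem.all-new S))) ext S)

  module Search (st₀ : State) (s : V) (h b : ℕ) (none : Lollipop st₀ s h b → ⊥) where

    -- A bare line comes first and the binary tree at its end, so the tips lie at depth exactly `h`
    -- for every `m`: odd cycles require equal depths. Branching late keeps the cost at most h + 4m.
    group : ∀ m → ⌈log₂ m ⌉ ≤ h → m ≤ 2 ^ ⌈log₂ m ⌉ → Grower h (groupCost h m) (Hole (m ∷ []))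
    group m le pow st r fr bd k = do
      g ← line (h ∸ ⌈log₂ m ⌉) (full-tree ⌈log₂ m ⌉) st r fr bd
      k (convert g)
      where
      convert : Grown st r (h ∸ ⌈log₂ m ⌉ + ⌈log₂ m ⌉) (groupCost h m) (λ T → 2 ^ ⌈log₂ m ⌉ ≤ # T) → Grown st r h
          (groupCost h m) (Hole (m ∷ []))
      convert g = record { st = st′ ; ext = ext ; size = size ; tips = tips
        ; up = λ p → subst (λ d → Up st st′ r d _) (m∸n+n≡m le) (up p) ; property = tips , id , ≤-trans pow property ,
            tt }
        where open Grown g renaming (st to st′)

    nothing : ∀ {d c} st r → (Grown st r d c (Hole []) → ⊥) → ⊥
    nothing st r k = k record { st = st ; ext = Ext-refl ; size = m≤m+n _ _ ; tips = ∅ ; up = λ p → ⊥-elim (∅⁻ p) ;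
        property = tt }

    Small : ℕ → Set
    Small m = ⌈log₂ m ⌉ ≤ h × m ≤ 2 ^ ⌈log₂ m ⌉

    -- Two non-adjacent families of tips may be merged; adjacent tips close a lollipop.
    branches : ∀ i ms → length ms ≤ 2 ^ i → All Small ms → ∀ st r b′ → i + b′ < b → Fresh st r → Stem st₀ s st r b′ →
      #Z st + cost h i ms ≤ β → (Grown st r (i + h) (cost h i ms) (Hole ms) → ⊥) → ⊥
    branches zero [] _ _ st r b′ _ fr S bd k = nothing st r k
    branches zero (m ∷ []) _ ((le , pow) ∷ _) st r b′ _ fr S bd k =
      group m le pow st r fr (subst (λ c → #Z st + c ≤ β) (+-identityʳ (groupCost h m)) bd)
        (λ g → k (subst (λ c → Grown st r h c (Hole (m ∷ []))) (sym (+-identityʳ (groupCost h m))) g))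
    branches zero (m ∷ m′ ∷ ms) (s≤s ()) _ st r b′ _ fr S bd k
    branches (suc i) ms len small st r b′ i<b fr S bd k = do
      F ← fork {i + h} {cost h i ms₁} {cost h i ms₂} {Hole ms₁} {Hole ms₂} st r fr bd
            (λ L bd₁ → branches i ms₁ len₁ (All.take⁺ (2 ^ i) small) _ _ (suc b′) i<b′ (leaf-fresh L) (Stem-Leaf L S)
                bd₁)
            (λ mid e L bd₂ → branches i ms₂ len₂ (All.drop⁺ (2 ^ i) small) _ _ (suc b′) i<b′ (leaf-fresh L)
                (Stem-Leaf L (Stem-Ext r∉ e S)) bd₂)
      examine F (any? (λ x → (x ∈? Fork.tips₁ F) ×-dec any? (λ y → (y ∈? Fork.tips₂ F) ×-dec (x ~? y))))
      where
      ms₁ ms₂ : List ℕ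
      ms₁ = take (2 ^ i) ms
      ms₂ = drop (2 ^ i) ms
      r∉ : r ∉ Z st₀
      r∉ = proj₂ (All.head (Stem.all-new S))
      i<b′ : i + suc b′ < b
      i<b′ = subst (_< b) (sym (+-suc i b′)) i<b
      len₁ : length ms₁ ≤ 2 ^ i
      len₁ = ≤-trans (≤-reflexive (length-take (2 ^ i) ms)) (m⊓n≤m (2 ^ i) (length ms))
      len₂ : length ms₂ ≤ 2 ^ i
      len₂ = ≤-trans (≤-reflexive (length-drop (2 ^ i) ms)) (≤-trans (∸-monoˡ-≤ (2 ^ i) len)
               (≤-reflexive (trans (m+n∸m≡n (2 ^ i) _) (+-identityʳ (2 ^ i)))))
      examine : (F : Fork st r (i + h) (2 + (cost h i ms₁ + cost h i ms₂)) (Hole ms₁) (Hole ms₂)) →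
        Dec (∃[ x ] (x ∈ Fork.tips₁ F × ∃[ y ] (y ∈ Fork.tips₂ F × x ~ y))) → ⊥
      examine F (no n) = k (fromFork F (subst (λ l → Hole l (tips₁ ∪ tips₂)) (take++drop≡id (2 ^ i) ms)
          (Hole-++ ms₁ property₁ property₂ tips-disjoint (λ p q e → n (_ , p , _ , q , e)))))
        where open Fork F
      examine F (yes (x , p , y , q , e)) with Fork.up₁ F p | Fork.up₂ F q
      ... | (.x ∷ xs) , lx , cx , ax , ux , refl | (.y ∷ ys) , ly , cy , ay , uy , refl = none record
        { st = st′ ; ext = Stem.ext S′ ; d = suc (i + h) ; h<d = s≤s (m≤n+m h i) ; x = x ; y = y ; a = r ; xs = xs ;
            ys = ys ; w = Stem.w S′
        ; size = (lin32 {length (Stem.w S′)} {b′} {i} {_} {h}) (Stem.len S′) i<b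
        ; length-xs = lx ; length-ys = ly
        ; UC-xs = UC-Ext ext₂ (x ∷ xs) (All.map proj₁ ax) cx
        ; UC-ys = cy ; UC-w = Stem.UC-w S′
        ; unique = Unique-++⁺ ux (Unique-++⁺ uy (Stem.unique S′)
            (λ i₁ i₂ → proj₂ (All.lookup ay i₁) (grow ext₁ (proj₁ (All.lookup (Stem.all-new S) i₂)))))
            (λ i₁ i₂ → case ∈-++⁻ (y ∷ ys) i₂ of λ
              { (inj₁ j) → proj₂ (All.lookup ay j) (proj₁ (All.lookup ax i₁))
              ; (inj₂ j) → proj₂ (All.lookup ax i₁) (proj₁ (All.lookup (Stem.all-new S) j)) })
        ; all-new = All.++⁺ (All.map (λ (u , v) → grow ext₂ u , v ∘ grow (Stem.ext S)) ax)
            (All.++⁺ (All.map (λ (u , v) → u , v ∘ grow ext₁ ∘ grow (Stem.ext S)) ay) (Stem.all-new S′))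
        ; x~y = e }
        where
        open Fork F
        S′ : Stem st₀ s st′ r b′
        S′ = Stem-Ext r∉ (Ext-trans (inj₁ refl) ext₁ ext₂) S

split-at : {A : Set} (f : ℕ) (l : List A) → f < length l → Σ[ l₁ ∈ List A ] Σ[ v ∈ A ] Σ[ l₂ ∈ List A ] l ≡ l₁ ++ v ∷
    l₂ × length l₁ ≡ f
split-at zero (x ∷ l) _ = [] , x , l , refl , refl
split-at (suc f) (x ∷ l) (s≤s p) with l₁ , v , l₂ , refl , e ← split-at f l p = x ∷ l₁ , v , l₂ , refl , cong suc e

reverse-∷ʳ : {A : Set} (l : List A) (v : A) → reverse (l ++ [ v ]) ≡ v ∷ reverse l
reverse-∷ʳ l v = reverse-++ l [ v ]

unsnoc : {A : Set} (x : A) (l : List A) → Σ[ l′ ∈ List A ] Σ[ z ∈ A ] x ∷ l ≡ l′ ++ [ z ]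
unsnoc x [] = [] , x , refl
unsnoc x (y ∷ l) with l′ , z , e ← unsnoc y l = x ∷ l′ , z , cong (x ∷_) e

-- Odd cycles as two routes of different length.

module Adjusters {N : ℕ} (G : Graph N) (W : Sub N) (K β : ℕ) (1≤K : 1 ≤ K)
  (thick : ∀ U → U ⊆ W → K ≤ # U → # U ≤ K + K → # U + (4 * K + β) < # (Basics.N[_]_ G W U)) where
  open Trees G W K β 1≤K thick public

  record Adjuster (st₀ : State) (s : V) (f c : ℕ) : Set where
    field
      st : State
      ext : Ext st₀ s st
      size : #Z st ≤ #Z st₀ + c
      port : V
      port-deg : # (children st port) ≤ 1
      p q : List V
      Ch-p : Ch (port ∷ p ++ [ s ])
      Ch-q : Ch (port ∷ q ++ [ s ])
      unique-p : Unique (port ∷ p)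
      unique-q : Unique (port ∷ q)
      new-p : All (New st₀ st) (port ∷ p)
      new-q : All (New st₀ st) (port ∷ q)
      difference : length q ≡ length p + suc (f + f)

  UC-parent : ∀ {st} y₀ l {r} → UC st (y₀ ∷ l ++ [ r ]) → ∀ {y u} → y ∈ˡ y₀ ∷ l → T (ρ st u y) → u ∈ˡ l ++ [ r ]
  UC-parent y₀ [] ((_ , f) , _) (here refl) t = here (f t)
  UC-parent y₀ (z ∷ l) ((_ , f) , _) (here refl) t = here (f t)
  UC-parent y₀ (z ∷ l) (_ , c) (there i) t = there (UC-parent z l c i t)

  UC-init : ∀ {st} l x {r} → UC st (l ++ x ∷ r) → UC st (l ++ [ x ])
  UC-init [] x c = tt
  UC-init (y ∷ []) x (c , _) = c , tt
  UC-init (y ∷ z ∷ l) x (c , d) = c , UC-init (z ∷ l) x d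

  UC-++ʳ : ∀ {st} l {r} → UC st (l ++ r) → UC st r
  UC-++ʳ [] c = c
  UC-++ʳ (x ∷ []) {[]} c = tt
  UC-++ʳ (x ∷ []) {y ∷ r} (_ , c) = c
  UC-++ʳ (x ∷ y ∷ l) (_ , c) = UC-++ʳ (y ∷ l) c

  -- The port lies f steps above the tip x: the direct way to the stem and the way round through y differ by 2f + 1.
  adjuster : ∀ {st₀ s h b f} → s ∈ Z st₀ → f ≤ h → Lollipop st₀ s h b → Adjuster st₀ s f (suc ((h + b) + (h + b)))
  adjuster {st₀} {s} {h} {b} {f} s∈ f≤h Λ = build
      (split-at f (x ∷ xs) (≤-trans (s≤s f≤h) (≤-trans h<d (≤-reflexive (sym length-xs)))))
    where
    open Lollipop Λ
    aw : List V
    aw = a ∷ w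
    yw : List V
    yw = (y ∷ ys) ++ aw
    everything : List V
    everything = (x ∷ xs) ++ yw
    Z₁ : Sub N
    Z₁ = Z st₀ ∪ set everything
    Z₁⊆Z : Z₁ ⊆ Z st
    Z₁⊆Z = ∪-⊆ (grow ext) (λ i → proj₁ (All.lookup all-new (set⁻ i)))
    s∉ : s ∉ˡ everything
    s∉ i = proj₂ (All.lookup all-new i) s∈
    parent-closed : ∀ {u z} → z ∈ Z₁ → T (ρ st u z) → u ∈ Z₁
    parent-closed {u} {z} i t with ∪⁻ i
    ... | inj₁ j = ∪ˡ (parent∈Z st₀ j (old ext j t))
    ... | inj₂ j with ∈-++⁻ (x ∷ xs) (set⁻ j)
    ...   | inj₁ k with ∈-++⁻ xs (UC-parent x xs UC-xs k t)
    ...     | inj₁ m = ∪ʳ (set⁺ (there (∈-++⁺ˡ m)))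
    ...     | inj₂ (here refl) = ∪ʳ (set⁺ (∈-++⁺ʳ (x ∷ xs) (∈-++⁺ʳ (y ∷ ys) (here refl))))
    parent-closed {u} {z} i t | inj₂ j | inj₂ k with ∈-++⁻ (y ∷ ys) k
    ... | inj₁ m with ∈-++⁻ ys (UC-parent y ys UC-ys m t)
    ...   | inj₁ o = ∪ʳ (set⁺ (∈-++⁺ʳ (x ∷ xs) (there (∈-++⁺ˡ o))))
    ...   | inj₂ (here refl) = ∪ʳ (set⁺ (∈-++⁺ʳ (x ∷ xs) (∈-++⁺ʳ (y ∷ ys) (here refl))))
    parent-closed {u} {z} i t | inj₂ j | inj₂ k | inj₂ m with ∈-++⁻ w (UC-parent a w UC-w m t)
    ... | inj₁ o = ∪ʳ (set⁺ (∈-++⁺ʳ (x ∷ xs) (∈-++⁺ʳ (y ∷ ys) (there o))))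
    ... | inj₂ (here refl) = ∪ˡ s∈
    -- Only the lollipop is kept. The cost then does not depend on the size of the search tree, and
    -- the port loses any child off the cycle, which frees a slot for continuing there.
    R = restrict ext Z₁ ∪ˡ Z₁⊆Z parent-closed
    st₁ : State
    st₁ = proj₁ R
    Z₁≡ : Z st₁ ≡ Z₁
    Z₁≡ = proj₁ (proj₂ R)
    ρ₁⇒ρ : ∀ {u z} → z ∈ Z₁ → T (ρ st₁ u z) → T (ρ st u z)
    ρ₁⇒ρ = proj₂ (proj₂ (proj₂ R))
    new₁ : ∀ {v} → v ∈ˡ everything → New st₀ st₁ v
    new₁ {v} i = subst (v ∈_) (sym Z₁≡) (∪ʳ (set⁺ i)) , proj₂ (All.lookup all-new i)
    size₁ : #Z st₁ ≤ #Z st₀ + suc ((h + b) + (h + b))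
    size₁ = (lin33 {_} {_} {#Z st₀} {# (set everything)} {_} {length (x ∷ xs)} {length yw} {length (y ∷ ys)}
        {length w} {d} {h} {b})
      (cong # Z₁≡) (#-∪ _ _) (#-set≤ everything) (length-++ (x ∷ xs)) (length-++ (y ∷ ys)) length-xs length-ys size
    build : Σ[ l₁ ∈ List V ] Σ[ v ∈ V ] Σ[ l₂ ∈ List V ] x ∷ xs ≡ l₁ ++ v ∷ l₂ × length l₁ ≡ f → Adjuster st₀ s f
        (suc ((h + b) + (h + b)))
    build (l₁ , v , l₂ , eq , len) = record
      { st = st₁ ; ext = proj₁ (proj₂ (proj₂ R)) ; size = size₁ ; port = v ; port-deg = deg
      ; p = l₂ ++ aw ; q = reverse l₁ ++ yw
      ; Ch-p = subst Ch (sym (++-assoc (v ∷ l₂) aw [ s ])) (Ch-++ (v ∷ l₂) a (UC⇒Ch _ UC-v) (UC⇒Ch _ UC-w))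
      ; Ch-q = Ch-q′ ; unique-p = Unique-++⁺ (proj₁ (proj₂ U₁)) (proj₁ (proj₂ U₂))
          (λ i j → v-disj i (∈-++⁺ʳ (y ∷ ys) j))
      ; unique-q = Unique-++⁺ (Unique-resp-↭ (↭-trans (↭-sym (↭-reverse (l₁ ++ [ v ])))
          (↭-reflexive (reverse-∷ʳ l₁ v)))
                       (Unique-++⁺ (proj₁ U₁) ([] ∷ []) (λ { i (here refl) → proj₂ (proj₂ U₁) i (here refl) })))
                           (proj₁ (proj₂ U₀)) rev-disj
      ; new-p = All.tabulate (λ {z} i → new₁ (in-p z (∈-++⁻ (v ∷ l₂) i)))
      ; new-q = All.tabulate (λ {z} i → new₁ (in-q z (∈-++⁻ (v ∷ reverse l₁) i)))
      ; difference = (lin34 {_} {length (reverse l₁)} {length yw} {length l₁} {f} {length (y ∷ ys)} {length aw} {d}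
          {length (x ∷ xs)} {length l₂})
           (length-++ (reverse l₁)) (length-reverse l₁) len (length-++ (y ∷ ys)) length-ys length-xs
           (trans (cong length eq) (length-++ l₁)) (length-++ l₂) }
      where
      U₀ = Unique-++⁻ (x ∷ xs) {yw} unique
      U₁ : Unique l₁ × Unique (v ∷ l₂) × (∀ {z} → z ∈ˡ l₁ → z ∈ˡ v ∷ l₂ → ⊥)
      U₁ = Unique-++⁻ l₁ (subst Unique eq (proj₁ U₀))
      U₂ = Unique-++⁻ (y ∷ ys) {aw} (proj₁ (proj₂ U₀))
      v₂⊆ : ∀ {z} → z ∈ˡ v ∷ l₂ → z ∈ˡ x ∷ xs
      v₂⊆ i = subst (_ ∈ˡ_) (sym eq) (∈-++⁺ʳ l₁ i)
      l₁⊆ : ∀ {z} → z ∈ˡ l₁ → z ∈ˡ x ∷ xs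
      l₁⊆ i = subst (_ ∈ˡ_) (sym eq) (∈-++⁺ˡ i)
      v-disj : ∀ {z} → z ∈ˡ v ∷ l₂ → z ∈ˡ yw → ⊥
      v-disj i = proj₂ (proj₂ U₀) (v₂⊆ i)
      UC-all : UC st (l₁ ++ v ∷ l₂ ++ [ a ])
      UC-all = subst (UC st) (trans (cong (_++ [ a ]) eq) (++-assoc l₁ (v ∷ l₂) [ a ])) UC-xs
      UC-v : UC st (v ∷ l₂ ++ [ a ])
      UC-v = UC-++ʳ l₁ UC-all
      rev-in : ∀ {z} → z ∈ˡ v ∷ reverse l₁ → z ∈ˡ x ∷ xs
      rev-in (here refl) = v₂⊆ (here refl)
      rev-in (there i) = l₁⊆ (∈-resp-↭ (↭-reverse l₁) i)
      rev-disj : ∀ {z} → z ∈ˡ v ∷ reverse l₁ → z ∈ˡ yw → ⊥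
      rev-disj i = proj₂ (proj₂ U₀) (rev-in i)
      in-p : ∀ z → z ∈ˡ v ∷ l₂ ⊎ z ∈ˡ aw → z ∈ˡ everything
      in-p z (inj₁ i) = ∈-++⁺ˡ (v₂⊆ i)
      in-p z (inj₂ i) = ∈-++⁺ʳ (x ∷ xs) (∈-++⁺ʳ (y ∷ ys) i)
      in-q : ∀ z → z ∈ˡ v ∷ reverse l₁ ⊎ z ∈ˡ yw → z ∈ˡ everything
      in-q z (inj₁ i) = ∈-++⁺ˡ (rev-in i)
      in-q z (inj₂ i) = ∈-++⁺ʳ (x ∷ xs) i
      Ch-yw : Ch (yw ++ [ s ])
      Ch-yw = subst Ch (sym (++-assoc (y ∷ ys) aw [ s ])) (Ch-++ (y ∷ ys) a (UC⇒Ch _ UC-ys) (UC⇒Ch _ UC-w))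
      -- The list l₁ ++ [ v ] starts with x, so its reversal ends with x.
      down : ∀ l → l₁ ++ v ∷ l₂ ≡ x ∷ xs → l ≡ l₁ ++ [ v ] → Ch (l₁ ++ [ v ]) → Ch
          (reverse (l₁ ++ [ v ]) ++ y ∷ ys ++ aw ++ [ s ])
      down l e₁ refl c = glue (l₁ ++ [ v ]) (starts l₁ e₁) c
        where
        starts : ∀ l₁ → l₁ ++ v ∷ l₂ ≡ x ∷ xs → Hd x (l₁ ++ [ v ])
        starts [] refl = refl
        starts (_ ∷ _) refl = refl
        glue : ∀ l → Hd x l → Ch l → Ch (reverse l ++ y ∷ ys ++ aw ++ [ s ])
        glue (_ ∷ l) refl c rewrite unfold-reverse x l | ++-assoc (reverse l) [ x ] (y ∷ ys ++ aw ++ [ s ]) =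
          Ch-++ (reverse l) x (subst Ch (unfold-reverse x l) (Ch-reverse (x ∷ l) c))
              (x~y , subst Ch (++-assoc (y ∷ ys) aw [ s ]) Ch-yw)
      Ch-q′ : Ch (v ∷ (reverse l₁ ++ yw) ++ [ s ])
      Ch-q′ = subst Ch (trans (cong (_++ (y ∷ ys ++ aw ++ [ s ])) (reverse-∷ʳ l₁ v))
                (trans (cong (λ t → v ∷ reverse l₁ ++ t) (sym (++-assoc (y ∷ ys) aw [ s ])))
                    (sym (++-assoc (v ∷ reverse l₁) yw [ s ]))))
              (down _ (sym eq) refl (Ch-init l₁ v (UC⇒Ch _ UC-all)))
      v∈all : v ∈ˡ everything
      v∈all = ∈-++⁺ˡ (v₂⊆ (here refl))
      locate : ∀ {z} → z ∈ Z₁ → T (ρ st v z) → z ∈ˡ l₁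
      locate {z} i t with ∪⁻ i
      ... | inj₁ j = ⊥-elim (proj₂ (All.lookup all-new v∈all) (parent∈Z st₀ j (old ext j t)))
      ... | inj₂ j with ∈-++⁻ (x ∷ xs) (set⁻ j)
      ...   | inj₁ k with ∈-++⁻ l₁ (subst (z ∈ˡ_) eq k)
      ...     | inj₁ o = o
      ...     | inj₂ o with ∈-++⁻ l₂ (UC-parent v l₂ UC-v o t)
      ...       | inj₁ o′ with h∷ ∷ _ ← proj₁ (proj₂ U₁) = ⊥-elim (All.lookup h∷ o′ refl)
      ...       | inj₂ (here refl) = ⊥-elim (v-disj (here refl) (∈-++⁺ʳ (y ∷ ys) (here refl)))
      locate {z} i t | inj₂ j | inj₂ k with ∈-++⁻ (y ∷ ys) k
      ... | inj₁ m with ∈-++⁻ ys (UC-parent y ys UC-ys m t)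
      ...   | inj₁ o = ⊥-elim (v-disj (here refl) (there (∈-++⁺ˡ o)))
      ...   | inj₂ (here refl) = ⊥-elim (v-disj (here refl) (∈-++⁺ʳ (y ∷ ys) (here refl)))
      locate {z} i t | inj₂ j | inj₂ k | inj₂ m with ∈-++⁻ w (UC-parent a w UC-w m t)
      ... | inj₁ o = ⊥-elim (v-disj (here refl) (∈-++⁺ʳ (y ∷ ys) (there o)))
      ... | inj₂ (here refl) = ⊥-elim (s∉ v∈all)
      child-in-l₁ : ∀ {z} → z ∈ children st₁ v → z ∈ˡ l₁ × T (ρ st v z)
      child-in-l₁ {z} c with i , t ← children⁻ st₁ c = locate (subst (z ∈_) Z₁≡ i) (ρ₁⇒ρ (subst (z ∈_) Z₁≡ i) t) ,
          ρ₁⇒ρ (subst (z ∈_) Z₁≡ i) t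
      -- Every entry of `l` is reserved for its successor alone, so only the last entry can be a
      -- child of `v`.
      bound : ∀ l → (∀ {z} → z ∈ children st₁ v → z ∈ˡ l × T (ρ st v z)) → (∀ {z} → z ∈ˡ l → z ∈ˡ v ∷ l₂ → ⊥) → UC st
          (l ++ [ v ]) → Unique l → # (children st₁ v) ≤ 1
      bound [] ch _ _ _ = ≤-trans (≤-reflexive (empty⇒#≡0 (λ i → case proj₁ (ch i) of λ ()))) z≤n
      bound (z₀ ∷ l) ch dj uc uq with l′ , z , e ← unsnoc z₀ l = ≤-trans (#-mono f′) (≤-reflexive (#-⁅⁆ z))
        where
        f′ : children st₁ v ⊆ ⁅ z ⁆
        f′ {u} i with j , t ← ch i with ∈-++⁻ l′ (subst (u ∈ˡ_) e j)
        ... | inj₂ (here refl) = ⁅⁆⁺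
        ... | inj₁ k = ⊥-elim (go l′ k (UC-init l′ z
            (subst (UC st) (trans (cong (_++ [ v ]) e) (++-assoc l′ [ z ] [ v ])) uc))
            (λ i → dj (subst (_ ∈ˡ_) (sym e) i) (here refl)))
          where
          go : ∀ l″ → u ∈ˡ l″ → UC st (l″ ++ [ z ]) → (v ∈ˡ l″ ++ [ z ] → ⊥) → ⊥
          go (c₀ ∷ l″) k uc′ n = n (there (UC-parent c₀ l″ uc′ k t))
      deg : # (children st₁ v) ≤ 1
      deg = bound l₁ child-in-l₁ (proj₂ (proj₂ U₁)) (UC-init l₁ v UC-all) (proj₁ U₁)

-- Chains of odd cycles and paths of variable length.

module Chains {N : ℕ} (G : Graph N) (W : Sub N) (K β : ℕ) (1≤K : 1 ≤ K)
  (thick : ∀ U → U ⊆ W → K ≤ # U → # U ≤ K + K → # U + (4 * K + β) < # (Basics.N[_]_ G W U))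
  (small : ∀ U → U ⊆ W → 1 ≤ # U → # U ≤ K → 4 * # U < # (Basics.N[_]_ G W U)) where
  open Adjusters G W K β 1≤K thick public
  open Image {N}

  initial : ∀ r → r ∈ W → Σ[ st ∈ State ] Z st ≡ ⁅ r ⁆ × Fresh st r
  initial r r∈W = st , refl , ⁅⁆⁺ , λ c → let i , t = children⁻ st c in proj₂ (ρ₀⁻ t) (⁅⁆⁻ i)
    where
    P? : ∀ u y → Dec ((y ∈ W × u ~ y) × y ≢ r)
    P? u y = ((y ∈? W) ×-dec (u ~? y)) ×-dec ¬? (y ≟ r)
    ρ₀ : V → V → Bool
    ρ₀ u y = does (P? u y)
    ρ₀⁻ : ∀ {u y} → T (ρ₀ u y) → (y ∈ W × u ~ y) × y ≢ r
    ρ₀⁻ {u} {y} = does⁻ (P? u y)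
    ρ₀⁺ : ∀ {u y} → (y ∈ W × u ~ y) × y ≢ r → T (ρ₀ u y)
    ρ₀⁺ {u} {y} = does⁺ (P? u y)
    cover : ∀ U → N[ W ] U ⊆ (U ∪ ⁅ r ⁆) ∪ img ρ₀ U
    cover U {x} i with N⁻ i
    ... | w , inj₁ u = ∪ˡ (∪ˡ u)
    ... | w , inj₂ (a , a∈ , e) with x ≟ r
    ...   | yes refl = ∪ˡ (∪ʳ ⁅⁆⁺)
    ...   | no n = ∪ʳ (img⁺ a∈ (ρ₀⁺ ((w , e) , n)))
    good₀ : ∀ U → U ⊆ W → # U ≤ K + K → # U + # U ≤ # (img ρ₀ U)
    good₀ U U⊆W U≤ with 1 ≤? # U | # U ≤? K
    ... | no n | _ = (lin35 {# U}) (≰⇒> n)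
    -- Of more than 4|U| vertices only those of `U` and the root are lost, which leaves enough.
    ... | yes 1≤ | yes ≤K = (lin36 {# U} {_} {_} {# (U ∪ ⁅ r ⁆)} {# (img ρ₀ U)} {# (⁅ r ⁆)})
          (small U U⊆W 1≤ ≤K) (#-mono (cover U)) (#-∪ _ _) (#-∪ _ _) (#-⁅⁆ r)
    ... | yes _ | no n = (lin37 {# U} {K} {β} {_} {_} {# (U ∪ ⁅ r ⁆)} {# (img ρ₀ U)} {# (⁅ r ⁆)})
          (thick U U⊆W (<⇒≤ (≰⇒> n)) U≤) (#-mono (cover U)) (#-∪ _ _) (#-∪ _ _) (#-⁅⁆ r) U≤
    st : State
    st = record
      { Z = ⁅ r ⁆ ; ρ = ρ₀ ; Z⊆W = λ i → subst (_∈ W) (sym (⁅⁆⁻ i)) r∈W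
      ; ρ⇒~ = λ t → proj₁ (ρ₀⁻ t) ; ρ-free = λ {u} {y} w x∉ e → ρ₀⁺ ((w , e) , λ { refl → x∉ ⁅⁆⁺ })
      ; parent∈Z = λ i t → ⊥-elim (proj₂ (ρ₀⁻ t) (⁅⁆⁻ i)) ; good = good₀ }

  -- Both ends retain room for one more child: `port` in order to be continued, `r` so that its
  -- surroundings still expand when the two ends are joined.
  record Flex (r : V) (window z : ℕ) : Set where
    field
      st : State
      size : #Z st ≤ z
      port : V
      r≢port : r ≢ port
      port∈Z : port ∈ Z st
      port-deg : # (children st port) ≤ 1
      r∈Z : r ∈ Z st
      r-deg : # (children st r) ≤ 1
      base : ℕ
      base≤z : base + window + 2 ≤ z
      path : ∀ j → j ≤ window → Σ[ l ∈ List V ] Unique (port ∷ l ++ [ r ]) × Ch (port ∷ l ++ [ r ]) × All (_∈ Z st)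
          (port ∷ l ++ [ r ]) × length l ≡ base + j

  start : ∀ r → r ∈ W → 2 ≤ β → (Flex r 0 2 → ⊥) → ⊥
  start r r∈W 2≤β k with st , refl , fr ← initial r r∈W = do
    L ← addLeaf st (lin38 (#-⁅⁆ r) 2≤β) r (proj₁ fr) (Fresh-deg {st} {r} fr)
    k (make L)
    where
    make : Leaf st r → Flex r 0 2
    make L = record
      { st = st′ ; size = lin39 (#Z-Leaf L) (#-⁅⁆ r)
      ; port = y ; r≢port = λ { refl → y∉Z ⁅⁆⁺ } ; port∈Z = y∈Z′ ; port-deg = Fresh-deg {st′} (leaf-fresh L)
      ; r∈Z = grow ext ⁅⁆⁺ ; r-deg = ≤-trans (#-mono one) (≤-reflexive (#-⁅⁆ y))
      ; base = 0 ; base≤z = ≤-refl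
      ; path = λ { zero _ → [] , ((λ { refl → y∉Z ⁅⁆⁺ }) ∷ []) ∷ [] ∷ [] , (~-sym p~y , tt) , y∈Z′ ∷ grow ext ⁅⁆⁺ ∷ []
          , refl } }
      where
      open Leaf L
      one : children st′ r ⊆ ⁅ y ⁆
      one {z} c with i , t ← children⁻ st′ c with ∪⁻ (Z′⊆ i)
      ... | inj₂ j = j
      ... | inj₁ j with refl ← ⁅⁆⁻ j = ⊥-elim (proj₂ fr (children⁺ st ⁅⁆⁺ (old ext ⁅⁆⁺ t)))

  -- The short route realises the old lengths, the long one the same lengths shifted by 2f + 1. The
  -- two intervals leave no gap because 2f does not exceed the old window.
  attach : ∀ {r window z f c} → f + f ≤ window → (F : Flex r window z) → Adjuster (Flex.st F) (Flex.port F) f c →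
    Flex r (window + suc (f + f)) (z + c)
  attach {r} {window} {z} {f} {c} 2f≤ F A = record
    { st = A.st ; size = (lin40 {_} {#Z F.st} {c} {z}) A.size F.size
    ; port = A.port ; r≢port = λ { refl → proj₂ (All.head A.new-p) F.r∈Z }
    ; port∈Z = proj₁ (All.head A.new-p) ; port-deg = A.port-deg
    ; r∈Z = grow A.ext F.r∈Z
    ; r-deg = ≤-trans (#-mono (children-Ext A.ext F.r∈Z F.r≢port)) F.r-deg
    ; base = base′
    ; base≤z = bound
    ; path = path′ }
    where
    module F = Flex F
    module A = Adjuster A
    base′ : ℕ
    base′ = suc (length A.p + F.base)
    join : ∀ p → Ch (A.port ∷ p ++ [ F.port ]) → Unique (A.port ∷ p) → All (New F.st A.st) (A.port ∷ p) → ∀ j → j ≤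
        window →
      Σ[ l ∈ List V ] Unique (A.port ∷ l ++ [ r ]) × Ch (A.port ∷ l ++ [ r ]) × All (_∈ Z A.st) (A.port ∷ l ++ [ r ])
          × length l ≡ suc (length p + F.base) + j
    join p ch uq nw j j≤ with l , u , c′ , a , len ← F.path j j≤ = p ++ F.port ∷ l ,
      subst Unique eq (Unique-++⁺ uq u (λ i₁ i₂ → proj₂ (All.lookup nw i₁) (All.lookup a i₂))) ,
      subst Ch eq (Ch-++ (A.port ∷ p) F.port ch c′) ,
      subst (All (_∈ Z A.st)) eq (All.++⁺ (All.map proj₁ nw) (All.map (grow A.ext) a)) ,
      (lin41 {_} {length p} {length l} {F.base} {j}) (length-++ p) len
      where
      eq : (A.port ∷ p) ++ (F.port ∷ l ++ [ r ]) ≡ A.port ∷ (p ++ F.port ∷ l) ++ [ r ]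
      eq = cong (A.port ∷_) (sym (++-assoc p (F.port ∷ l) [ r ]))
    path′ : ∀ j → j ≤ window + suc (f + f) → Σ[ l ∈ List V ] Unique (A.port ∷ l ++ [ r ]) × Ch (A.port ∷ l ++ [ r ]) ×
        All (_∈ Z A.st) (A.port ∷ l ++ [ r ]) × length l ≡ base′ + j
    path′ j j≤ with j ≤? window
    ... | yes le = join A.p A.Ch-p A.unique-p A.new-p j le
    ... | no gt = let l , a , b , c , len = join A.q A.Ch-q A.unique-q A.new-q (j ∸ suc (f + f)) i≤ in
        l , a , b , c , (lin42 {_} {length A.q} {F.base} {j ∸ suc (f + f)} {length A.p} {f} {j}) len A.difference
            (m+[n∸m]≡n le)
      where
      le : suc (f + f) ≤ j
      le = (lin43 {f}) 2f≤ (≰⇒> gt)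
      i≤ : j ∸ suc (f + f) ≤ window
      i≤ = ≤-trans (∸-monoˡ-≤ (suc (f + f)) j≤) (≤-reflexive (m+n∸n≡m window (suc (f + f))))
    bound : base′ + (window + suc (f + f)) + 2 ≤ z + c
    bound = (lin44 {length A.q} {length A.p} {f} {# (Z A.st ∖ Z F.st)} {_} {#Z F.st} {c} {F.base} {window} {z})
      A.difference (length≤# A.unique-q (All.map (λ (i , n) → ∖⁺ i n) A.new-q)) A.size (#-∖⊆ (grow A.ext)) F.base≤z

  module Building (h L : ℕ) (ms : List ℕ) (ms≤ : length ms ≤ 2 ^ L)
    (Small : All (λ m → ⌈log₂ m ⌉ ≤ h × m ≤ 2 ^ ⌈log₂ m ⌉) ms)
    (noHole : ∀ S → S ⊆ W → Hole ms S → ⊥) where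

    unitCost : ℕ
    unitCost = suc ((h + suc L) + (h + suc L))

    enlarge : ∀ {r window z} f → f ≤ h → f + f ≤ window → 1 ≤ L + h → z + suc (cost h L ms) ≤ β → Flex r window z →
      (Flex r (window + suc (f + f)) (z + unitCost) → ⊥) → ⊥
    enlarge {r} {window} {z} f f≤h 2f≤ 1≤Lh bd F k = do
      L₁ ← addLeaf F.st ((lin45 {_} {z} {cost h L ms}) F.size bd) F.port F.port∈Z F.port-deg
      g ← Search.branches F.st F.port h (suc L) none L ms ms≤ Small (Leaf.st′ L₁) (Leaf.y L₁) 0
          (s≤s (≤-reflexive (+-identityʳ L))) (leaf-fresh L₁) (stem L₁)
            (budget L₁)
      noHole (Grown.tips g) (tips⊆W g) (Grown.property g)
      where
      module F = Flex F
      none : Lollipop F.st F.port h (suc L) → ⊥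
      none Λ = k (attach 2f≤ F (adjuster F.port∈Z f≤h Λ))
      budget : ∀ L₁ → #Z (Leaf.st′ {F.st} {F.port} L₁) + cost h L ms ≤ β
      budget L₁ = (lin46 {#Z F.st} {z} {cost h L ms} {_} {#Z (Leaf.st′ L₁)}) F.size bd (#Z-Leaf L₁)
      stem : ∀ L₁ → Stem F.st F.port (Leaf.st′ {F.st} {F.port} L₁) (Leaf.y L₁) 0
      stem L₁ = record { ext = ext ; w = [] ; len = z≤n ; UC-w = (~-sym p~y , parent) , tt ; all-new = (y∈Z′ , y∉Z) ∷
          [] ; unique = [] ∷ [] }
        where open Leaf L₁
      tips⊆W : ∀ {st r c P} (g : Grown st r (L + h) c P) → Grown.tips g ⊆ W
      tips⊆W g {t} i with Grown.up g i
      ... | [] , len , _ = ⊥-elim (lin47 len 1≤Lh)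
      ... | (_ ∷ _) , _ , _ , (j , _) ∷ _ , _ , refl = Z⊆W (Grown.st g) j

    enlarges : ∀ {r} f t {window z} → f ≤ h → f + f ≤ window → 1 ≤ L + h → z + t * unitCost + suc (cost h L ms) ≤ β →
        Flex r window z →
      (Flex r (window + t * suc (f + f)) (z + t * unitCost) → ⊥) → ⊥
    enlarges f zero {window} {z} _ _ _ _ F k = k (subst₂′ (sym (+-identityʳ window)) (sym (+-identityʳ z)) F)
      where
      subst₂′ : ∀ {r a b c d} → a ≡ b → c ≡ d → Flex r a c → Flex r b d
      subst₂′ refl refl F = F
    enlarges f (suc t) {window} {z} f≤h 2f≤ 1≤ bd F k = do
      F₁ ← enlarges f t f≤h 2f≤ 1≤ ((lin48 {z} {unitCost} {t * unitCost} {cost h L ms}) bd) F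
      F₂ ← enlarge f f≤h (≤-trans 2f≤ (m≤m+n _ _)) 1≤ ((lin48 {z} {unitCost} {t * unitCost} {cost h L ms}) bd) F₁
      k (subst₂′ ((lin49 {window} {t * suc (f + f)} {f + f})) ((lin50 {z} {t * unitCost} {unitCost})) F₂)
      where
      subst₂′ : ∀ {r a b c d} → a ≡ b → c ≡ d → Flex r a c → Flex r b d
      subst₂′ refl refl F = F

    -- Shifts by 2h + 1 leave no gap only once the window has reached 2h. Hence the first 2h
    -- adjusters have f = 0 and widen it by 1 each.
    flexible : ∀ r → r ∈ W → 1 ≤ L + h → ∀ t → 2 + (h + h) * unitCost + t * unitCost + suc (cost h L ms) ≤ β →
      (Flex r ((h + h) + t * suc (h + h)) (2 + (h + h) * unitCost + t * unitCost) → ⊥) → ⊥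
    flexible r r∈W 1≤ t bd k = do
      F₀ ← start r r∈W ((lin51 {(h + h) * unitCost} {t * unitCost} {cost h L ms}) bd)
      F₁ ← enlarges 0 (h + h) z≤n z≤n 1≤ ((lin52 {(h + h) * unitCost} {t * unitCost} {cost h L ms}) bd) F₀
      F₂ ← enlarges h t ≤-refl (≤-reflexive (sym (*-identityʳ (h + h)))) 1≤ bd F₁
      k (subst (λ x → Flex r (x + t * suc (h + h)) (2 + (h + h) * unitCost + t * unitCost)) (*-identityʳ (h + h)) F₂)

-- The Chvátal–Erdős argument

Lst : {A : Set} → A → List A → Set
Lst r [] = ⊥
Lst r (x ∷ []) = r ≡ x
Lst r (_ ∷ y ∷ l) = Lst r (y ∷ l)

Lst-++ : {A : Set} {r : A} (l : List A) {x : A} {l′ : List A} → Lst r (x ∷ l′) → Lst r (l ++ x ∷ l′)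
Lst-++ [] p = p
Lst-++ (y ∷ []) p = p
Lst-++ (y ∷ z ∷ l) p = Lst-++ (z ∷ l) p

Lst-++⁻ : {A : Set} {r : A} (l : List A) {x : A} {l′ : List A} → Lst r (l ++ x ∷ l′) → Lst r (x ∷ l′)
Lst-++⁻ [] p = p
Lst-++⁻ (y ∷ []) p = p
Lst-++⁻ (y ∷ z ∷ l) p = Lst-++⁻ (z ∷ l) p

Lst⇒∷ʳ : {A : Set} {r : A} (l : List A) → Lst r l → Σ[ l′ ∈ List A ] l ≡ l′ ++ [ r ]
Lst⇒∷ʳ (x ∷ []) refl = [] , refl
Lst⇒∷ʳ (x ∷ y ∷ l) p with l′ , e ← Lst⇒∷ʳ (y ∷ l) p = x ∷ l′ , cong (x ∷_) e

Lst-∷ʳ : {A : Set} (l : List A) (r : A) → Lst r (l ++ [ r ])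
Lst-∷ʳ l r = Lst-++ l refl

Hd-replace : {A : Set} {p : A} (l : List A) {u : A} {X Y : List A} → Hd p (l ++ u ∷ X) → Hd p (l ++ u ∷ Y)
Hd-replace [] h = h
Hd-replace (_ ∷ _) h = h

shuffle : {A : Set} (l₁ : List A) (u : A) (ds M l₃ : List A) → ds ++ (l₁ ++ u ∷ M ++ l₃) ↭ l₁ ++ u ∷ ds ++ reverse M
    ++ l₃
shuffle l₁ u ds M l₃ = ↭-trans step₁ (++⁺ˡ l₁ (prep u (++⁺ˡ ds (++⁺ʳ l₃ (↭-sym (↭-reverse M))))))
  where
  step₁ : ds ++ (l₁ ++ u ∷ M ++ l₃) ↭ l₁ ++ u ∷ ds ++ M ++ l₃
  step₁ = ↭-trans (↭-reflexive (sym (++-assoc ds (l₁) (u ∷ M ++ l₃))))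
    (↭-trans (++⁺ʳ (u ∷ M ++ l₃) (++-comm ds l₁))
      (↭-trans (↭-reflexive (++-assoc l₁ ds (u ∷ M ++ l₃))) (++⁺ˡ l₁ (shift u ds (M ++ l₃)))))

module RestPath {N : ℕ} (G : Graph N) (W Z : Sub N) (Z⊆W : Z ⊆ W) (port r : Fin N)
  (port∈Z : port ∈ Z) (r∈Z : r ∈ Z) where
  open Basics G

  Inner : V → Set
  Inner v = v ≡ port ⊎ v ≡ r ⊎ (v ∈ W × v ∉ Z)

  -- Such a path meets the flexible path only in its two ends, so the two always form a cycle
  -- together.
  record Rest (P : List V) : Set where
    field
      head : Hd port P
      last : Lst r P
      chain : Ch P
      unique : Unique P
      inner : All Inner P

  Inner⊆W : ∀ {v} → Inner v → v ∈ W
  Inner⊆W (inj₁ refl) = Z⊆W port∈Z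
  Inner⊆W (inj₂ (inj₁ refl)) = Z⊆W r∈Z
  Inner⊆W (inj₂ (inj₂ (w , _))) = w

  Rest-length : ∀ P → Rest P → length P ≤ N
  Rest-length P R = ≤-trans (length≤# {A = full} (Rest.unique R) (All.tabulate (λ _ → full⁺))) (#≤n full)

  module Maximal (P : List V) (RP : Rest P) (max : ∀ P′ → Rest P′ → length P′ ≤ length P) where
    open Rest RP

    Q : Sub N
    Q = W ∖ (Z ∪ set P)

    Q∌P : ∀ {v} → v ∈ Q → v ∈ˡ P → ⊥
    Q∌P q i = proj₂ (∖⁻ q) (∪ʳ (set⁺ i))

    -- A detour through Q that reverses the middle part of P would be longer than P.
    no-detour : ∀ l₁ u l₂ u′ b l₃ a d → P ≡ l₁ ++ u ∷ (l₂ ++ u′ ∷ b ∷ l₃) → Hd a (l₂ ++ [ u′ ]) → a ~ b → u ~ d → Link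
        Q d u′ → ⊥
    no-detour l₁ u l₂ u′ b l₃ a d eq hd a~b u~d (ds , uds , ads , cds) =
      (lin53 {length P′} {length P} {length (d ∷ ds ++ P)} {length (ds ++ P)} {length ds})
        (max P′ rest′) (↭-length perm) refl (length-++ ds)
      where
      M : List V
      M = l₂ ++ [ u′ ]
      P′ : List V
      P′ = l₁ ++ u ∷ (d ∷ ds) ++ reverse M ++ b ∷ l₃
      eq′ : P ≡ l₁ ++ u ∷ M ++ b ∷ l₃
      eq′ = trans eq (cong (λ t → l₁ ++ u ∷ t) (sym (++-assoc l₂ [ u′ ] (b ∷ l₃))))
      perm : (d ∷ ds) ++ P ↭ P′
      perm = ↭-trans (↭-reflexive (cong ((d ∷ ds) ++_) eq′)) (shuffle l₁ u (d ∷ ds) M (b ∷ l₃))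
      chP : Ch (l₁ ++ u ∷ (l₂ ++ u′ ∷ b ∷ l₃))
      chP = subst Ch eq chain
      chM : Ch M
      chM = Ch-init l₂ u′ (Ch-tail u _ (Ch-++ʳ l₁ chP))
      chEnd : Ch (b ∷ l₃)
      chEnd = Ch-tail u′ (b ∷ l₃) (Ch-++ʳ l₂ (Ch-tail u _ (Ch-++ʳ l₁ chP)))
      back : ∀ M → Hd a M → Ch M → Ch (reverse M ++ b ∷ l₃)
      back (_ ∷ M₀) refl c rewrite unfold-reverse a M₀ | ++-assoc (reverse M₀) [ a ] (b ∷ l₃) =
        Ch-++ (reverse M₀) a (subst Ch (unfold-reverse a M₀) (Ch-reverse (a ∷ M₀) c)) (a~b , chEnd)
      chMid : Ch ((d ∷ ds) ++ reverse M ++ b ∷ l₃)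
      chMid = subst Ch (cong (λ t → (d ∷ ds) ++ t ++ b ∷ l₃) (sym (reverse-∷ʳ l₂ u′)))
        (Ch-++ (d ∷ ds) u′ cds (subst Ch (cong (_++ b ∷ l₃) (reverse-∷ʳ l₂ u′)) (back M hd chM)))
      rest′ : Rest P′
      rest′ = record
        { head = Hd-replace l₁ (subst (Hd port) eq head)
        ; last = subst (Lst r) (trans (++-assoc l₁ (u ∷ (d ∷ ds) ++ reverse M) (b ∷ l₃))
            (cong (λ t → l₁ ++ u ∷ d ∷ t) (++-assoc ds (reverse M) (b ∷ l₃))))
            (Lst-++ (l₁ ++ u ∷ (d ∷ ds) ++ reverse M)
                (Lst-++⁻ (l₁ ++ u ∷ M) (subst (Lst r) (trans eq′ (sym (++-assoc l₁ (u ∷ M) (b ∷ l₃)))) last)))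
        ; chain = Ch-++ l₁ u (Ch-init l₁ u chP) (u~d , chMid)
        ; unique = Unique-resp-↭ perm (Unique-++⁺ uds unique (λ i j → Q∌P (All.lookup ads i) j))
        ; inner = All-resp-↭ perm (All.++⁺ (All.map (λ q → inj₂ (inj₂ (∖⊆ q , λ z → proj₂ (∖⁻ q) (∪ˡ z)))) ads) inner)
            }

    module Around {a₀ : V} (C : Component Q a₀) where
      open Component C

      Touches : V → Set
      Touches v = ∃[ d ] (d ∈ D × v ~ d)

      touches? : ∀ v → Dec (Touches v)
      touches? v = any? (λ d → (d ∈? D) ×-dec (v ~? d))

      -- The successors on P of the neighbours of D.
      add : ∀ {u} → Dec (Touches u) → V → List V → List V
      add (yes _) a l = a ∷ l
      add (no _) a l = l

      marks′ : V → List V → List V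
      marks′ u [] = []
      marks′ u (a ∷ l) = add (touches? u) a (marks′ a l)

      marks : List V → List V
      marks [] = []
      marks (u ∷ l) = marks′ u l

      near : List V → List V
      near = filter touches?

      -- The last vertex of the path has no successor, which accounts for the extra 1.
      near≤ : ∀ u l → length (near (u ∷ l)) ≤ suc (length (marks′ u l))
      near≤ u l with touches? u in eq
      near≤ u [] | yes _ = ≤-refl
      near≤ u [] | no _ = z≤n
      near≤ u (a ∷ l) | yes _ rewrite eq = s≤s (near≤ a l)
      near≤ u (a ∷ l) | no _ rewrite eq = near≤ a l

      near≤P : ∀ l → length (near l) ≤ suc (length (marks l))
      near≤P [] = z≤n
      near≤P (u ∷ l) = near≤ u l

      marks-split : ∀ u l {b} → b ∈ˡ marks′ u l → Σ[ l₁ ∈ List V ] Σ[ u′ ∈ V ] Σ[ l₃ ∈ List V ] u ∷ l ≡ l₁ ++ u′ ∷ b ∷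
          l₃ × Touches u′
      marks-split u (a ∷ l) i with touches? u
      marks-split u (a ∷ l) (here refl) | yes t = [] , u , l , refl , t
      marks-split u (a ∷ l) (there i) | yes t with l₁ , u′ , l₃ , e , t′ ← marks-split a l i = u ∷ l₁ , u′ , l₃ , cong
          (u ∷_) e , t′
      marks-split u (a ∷ l) i | no _ with l₁ , u′ , l₃ , e , t′ ← marks-split a l i = u ∷ l₁ , u′ , l₃ , cong (u ∷_) e
          , t′

      -- The shape that `no-detour` takes apart: `a` succeeds `u` and `b` succeeds `u′`. The list
      -- `l₂` may be empty; then `a` is `u′`, and the detour is inserted between two consecutive
      -- vertices.
      Before : V → V → List V → Set
      Before a b l = Σ[ l₁ ∈ List V ] Σ[ u ∈ V ] Σ[ l₂ ∈ List V ] Σ[ u′ ∈ V ] Σ[ l₃ ∈ List V ]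
        (l ≡ l₁ ++ u ∷ (l₂ ++ u′ ∷ b ∷ l₃) × Hd a (l₂ ++ [ u′ ]) × Touches u × Touches u′)

      Before-∷ : ∀ {a b l} x → Before a b l → Before a b (x ∷ l)
      Before-∷ x (l₁ , u , l₂ , u′ , l₃ , e , rest) = x ∷ l₁ , u , l₂ , u′ , l₃ , cong (x ∷_) e , rest

      first : ∀ {u a l b} → Touches u → b ∈ˡ marks′ a l → Before a b (u ∷ a ∷ l)
      first {u} {a} {l} {b} t i with l₁ , u′ , l₃ , e , t′ ← marks-split a l i = [] , u , l₁ , u′ , l₃ , cong (u ∷_) e
          , hd l₁ e , t , t′
        where
        hd : ∀ l₁ → a ∷ l ≡ l₁ ++ u′ ∷ b ∷ l₃ → Hd a (l₁ ++ [ u′ ])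
        hd [] refl = refl
        hd (_ ∷ _) refl = refl

      compare : ∀ u l {a b} → a ∈ˡ marks′ u l → b ∈ˡ marks′ u l → a ≢ b → Before a b (u ∷ l) ⊎ Before b a (u ∷ l)
      compare u (x ∷ l) i j n with touches? u
      compare u (x ∷ l) (here refl) (here refl) n | yes t = ⊥-elim (n refl)
      compare u (x ∷ l) (here refl) (there j) n | yes t = inj₁ (first t j)
      compare u (x ∷ l) (there i) (here refl) n | yes t = inj₂ (first t i)
      compare u (x ∷ l) (there i) (there j) n | yes t with compare x l i j n
      ... | inj₁ b = inj₁ (Before-∷ u b)
      ... | inj₂ b = inj₂ (Before-∷ u b)
      compare u (x ∷ l) i j n | no _ with compare x l i j n
      ... | inj₁ b = inj₁ (Before-∷ u b)
      ... | inj₂ b = inj₂ (Before-∷ u b)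

      compareP : ∀ l {a b} → a ∈ˡ marks l → b ∈ˡ marks l → a ≢ b → Before a b l ⊎ Before b a l
      compareP (u ∷ l) = compare u l

      no-chord : ∀ {a b} → Before a b P → a ~ b → ⊥
      no-chord (l₁ , u , l₂ , u′ , l₃ , e , hd , (d , d∈ , ud) , (d′ , d′∈ , ud′)) ab =
        no-detour l₁ u l₂ u′ _ l₃ _ d e hd ab ud (linked d′∈ d∈ (link-start (D⊆Q d′∈) (~-sym ud′)))

      marks⊆ : ∀ l {a} → a ∈ˡ marks l → a ∈ˡ l
      marks⊆ (u ∷ l) i with l₁ , u′ , l₃ , e , _ ← marks-split u l i = subst (_ ∈ˡ_) (sym e)
          (∈-++⁺ʳ l₁ (there (here refl)))

      marks-tail : ∀ u l {a} → a ∈ˡ marks′ u l → a ∈ˡ l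
      marks-tail u l i with marks-split u l i
      ... | [] , _ , _ , refl , _ = here refl
      ... | (_ ∷ l₁) , _ , _ , refl , _ = ∈-++⁺ʳ l₁ (there (here refl))

      marks-unique : ∀ u l → Unique l → Unique (marks′ u l)
      marks-unique u [] _ = []
      marks-unique u (a ∷ l) (h ∷ uq) with touches? u
      ... | yes _ = All.tabulate (λ i → All.lookup h (marks-tail a l i)) ∷ marks-unique a l uq
      ... | no _ = marks-unique a l uq

      marks-uniqueP : ∀ l → Unique l → Unique (marks l)
      marks-uniqueP [] _ = []
      marks-uniqueP (u ∷ l) (_ ∷ uq) = marks-unique u l uq

      independent : Apart (set (marks P)) (set (marks P))
      independent p q e with compareP P (set⁻ p) (set⁻ q) (λ { refl → ~-irrefl e })
      ... | inj₁ b = no-chord b e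
      ... | inj₂ b = no-chord b (~-sym e)

      marks⊆W : set (marks P) ⊆ W
      marks⊆W i = Inner⊆W (All.lookup inner (marks⊆ P (set⁻ i)))

      near-bound : ∀ {K} → (∀ S → S ⊆ W → Apart S S → # S < K) → length (near P) ≤ K
      near-bound α = lin54 (near≤P P) (#-set (marks-uniqueP P unique)) (α _ marks⊆W independent)

      near⁺ : ∀ {v} → v ∈ˡ P → Touches v → v ∈ˡ near P
      near⁺ = ∈-filter⁺ touches?

      N-cover : N[ W ] D ⊆ (D ∪ Z) ∪ set (near P)
      N-cover {x} i with N⁻ i
      ... | w , inj₁ d = ∪ˡ (∪ˡ d)
      ... | w , inj₂ (d , d∈ , e) with x ∈? Z | ∈-list? _≟_ x P
      ...   | yes z | _ = ∪ˡ (∪ʳ z)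
      ...   | no _ | yes p = ∪ʳ (set⁺ (near⁺ p (d , d∈ , ~-sym e)))
      ...   | no n | no p = ∪ˡ (∪ˡ (closed d∈ (∖⁺ w (λ j → case ∪⁻ j of λ { (inj₁ k) → n k ; (inj₂ k) → p (set⁻ k) }))
          e))

      away : set P ∖ set (near P) ⊆ W ∖ N[ W ] D
      away {v} i with p , n ← ∖⁻ i = ∖⁺ (Inner⊆W (All.lookup inner (set⁻ p))) (λ j → case proj₂ (N⁻ j) of λ
        { (inj₁ d) → Q∌P (D⊆Q d) (set⁻ p) ; (inj₂ (d , d∈ , e)) → n (set⁺ (near⁺ (set⁻ p) (d , d∈ , ~-sym e))) })

      -- `D` has at most K neighbours on `P`, and the others lie in `Z`. If `D` is at most half of
      -- `W`, this contradicts its expansion. Otherwise pass to the complement of the closed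
      -- neighbourhood of `D`: it contains K vertices of `P`, is at most half of `W`, and its
      -- boundary is just as small.
      component-small : ∀ {K τ z} → (∀ S → S ⊆ W → Apart S S → # S < K) →
        (∀ A → A ⊆ W → K ≤ # A → # A + # A ≤ # W → # A + τ ≤ # (N[ W ] A)) →
        # Z ≤ z → K + z < τ → K + K ≤ length P → # D < K
      component-small {K} {τ} {z} α region Z≤z Kz<τ 2K≤P = ≰⇒> λ K≤D → big K≤D (# D + # D ≤? # W)
        where
        #N : # (N[ W ] D) ≤ # D + (K + z)
        #N = (lin55 {_} {_} {# (D ∪ Z)} {# (set (near P))} {# D} {# Z} {z} {_} {K})
          (#-mono N-cover) (#-∪ _ _) (#-∪ D Z) Z≤z (#-set≤ (near P)) (near-bound α)
        A : Sub N
        A = W ∖ N[ W ] D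
        #W : # W ≡ # (N[ W ] D) + # A
        #W = #-∖⊆ N⊆
        #A : K ≤ # A
        #A = (lin56 {# (set P)} {# (set (near P))} {# (set P ∖ set (near P))} {_} {length (near P)} {K} {length P})
          (#-∖ _ _) (#-mono away) (#-set≤ (near P)) (near-bound α) (#-set unique) 2K≤P
        NA : N[ W ] A ⊆ W ∖ D
        NA {x} i with N⁻ i
        ... | w , inj₁ a = ∖⁺ w (λ d → proj₂ (∖⁻ a) (N-self w d))
        ... | w , inj₂ (a , a∈ , e) = ∖⁺ w (λ d → proj₂ (∖⁻ a∈) (N-adj (∖⊆ a∈) d (~-sym e)))
        big : K ≤ # D → Dec (# D + # D ≤ # W) → ⊥
        big K≤D (yes le) = (lin57 {# D} {τ} {_} {K} {z}) (region D (λ d → ∖⊆ (D⊆Q d)) K≤D le) #N Kz<τ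
        big K≤D (no gt) = (lin58 {# A} {τ} {_} {# (W ∖ D)} {_} {# D} {# (N[ W ] D)} {K} {z})
            (region A ∖⊆ #A ((lin59 {_} {# D} {# (N[ W ] D)} {# A}) (≰⇒> gt) (#-mono (λ d → N-self (∖⊆ (D⊆Q d)) d))
                #W))
            (#-mono NA) (#-∖⊆ (λ d → ∖⊆ (D⊆Q d))) #W #N Kz<τ

    ClosedIn : Sub N → Set
    ClosedIn A = A ⊆ Q × (∀ {d e} → d ∈ A → e ∈ Q → d ~ e → e ∈ A)

    -- A smallest closed set of at least K vertices has at most 2K: otherwise a component, having
    -- fewer than K vertices, could be removed from it.
    closed-small : ∀ {K} → 1 ≤ K → (∀ {a} → (C : Component Q a) → # (Component.D C) < K) → ∀ A₀ → ClosedIn A₀ → K ≤ #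
        A₀ →
      (Σ[ A ∈ Sub N ] A ⊆ A₀ × ClosedIn A × K ≤ # A × # A ≤ K + K → ⊥) → ⊥
    closed-small {K} 1≤K small A₀ cl₀ K≤A₀ k = do
      A , (A⊆ , (A⊆Q , cl) , K≤A) , min ← minimum (λ A → A ⊆ A₀ × ClosedIn A × K ≤ # A) # A₀ (id , cl₀ , K≤A₀)
      k (A , A⊆ , (A⊆Q , cl) , K≤A , ≮⇒≥ (λ lt → reduce A A⊆ A⊆Q cl K≤A min lt))
      where
      reduce : ∀ A → A ⊆ A₀ → (A⊆Q : A ⊆ Q) → (∀ {d e} → d ∈ A → e ∈ Q → d ~ e → e ∈ A) → K ≤ # A →
        (∀ B → B ⊆ A₀ × ClosedIn B × K ≤ # B → # A ≤ # B) → K + K < # A → ⊥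
      reduce A A⊆ A⊆Q cl K≤A min lt with a , a∈ ← pick {A = A} (≤-trans 1≤K K≤A) = do
        C ← component (A⊆Q a∈)
        (lin60 {_} {# (A ∖ Component.D C)} {# (A ∩ Component.D C)})
          (min (A ∖ Component.D C) ((λ i → A⊆ (∖⊆ i)) ,
              (A⊆Q ∘ ∖⊆ , λ d∈ e∈ de → ∖⁺ (cl (∖⊆ d∈) e∈ de)
              (λ eD → proj₂ (∖⁻ d∈) (Component.closed C eD (A⊆Q (∖⊆ d∈)) (~-sym de)))) ,
              (lin61 {K} {_} {# (Component.D C)} {# (A ∖ Component.D C)}) lt (#-∖ A (Component.D C)) (small C)))
          (#-split A (Component.D C)) (∈⇒1≤# (∩⁺ a∈ (Component.origin C)))

    -- If P is short, two non-adjacent closed parts of Q see only few vertices.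
    long : ∀ {K τ z n δ} → 1 ≤ K → (∀ S → S ⊆ W → Apart S S → # S < K) →
      (∀ A → A ⊆ W → K ≤ # A → # A + # A ≤ # W → # A + τ ≤ # (N[ W ] A)) →
      (∀ A B → A ⊆ W → B ⊆ W → K ≤ # A → K ≤ # B → (∀ {x} → x ∈ A → x ∉ B) → Apart A B → n + δ ≤ #
          (N[ W ] A ∪ N[ W ] B)) →
      # Z ≤ z → K + z < τ → K + K ≤ length P → n + z + 3 * K ≤ # W → z + 4 * K < δ → n < length P
    long {K} {τ} {z} {n} {δ} 1≤K α region J Z≤z Kz<τ 2K≤P n≤W z<δ = ≰⇒> λ P≤n → (do
        A , _ , (A⊆Q , clA) , K≤A , A≤2K ← closed-small 1≤K small Q (id , λ _ e _ → e) (K≤Q P≤n)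
        second P≤n A A⊆Q clA K≤A A≤2K)
      where
      small : ∀ {a} → (C : Component Q a) → # (Component.D C) < K
      small C = Around.component-small C α region Z≤z Kz<τ 2K≤P
      #Q : # W ≤ # Z + length P + # Q
      #Q = (lin62 {_} {# (Z ∪ set P)} {# Q} {# Z} {# (set P)} {length P})
        (#-∖ W (Z ∪ set P)) (#-∪ Z (set P)) (#-set≤ P)
      K≤Q : length P ≤ n → K ≤ # Q
      K≤Q P≤n = (lin63 {_} {# Z} {length P} {# Q} {z} {n} {K}) #Q Z≤z P≤n n≤W
      second : length P ≤ n → ∀ A → A ⊆ Q → (∀ {d e} → d ∈ A → e ∈ Q → d ~ e → e ∈ A) → K ≤ # A → # A ≤ K + K → ⊥
      second P≤n A A⊆Q clA K≤A A≤2K = do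
        B , B⊆ , (B⊆Q , clB) , K≤B , B≤2K ← closed-small 1≤K small (Q ∖ A)
          (∖⊆ , λ d∈ e∈ de → ∖⁺ e∈ (λ eA → proj₂ (∖⁻ d∈) (clA eA (∖⊆ d∈) (~-sym de))))
          ((lin64 {_} {# Z} {length P} {# Q} {z} {n} {K} {# A} {# (Q ∖ A)})
            #Q Z≤z P≤n n≤W (#-∖ Q A) A≤2K)
        finish B B⊆ B⊆Q clB K≤B B≤2K
        where
        finish : ∀ B → B ⊆ Q ∖ A → B ⊆ Q → (∀ {d e} → d ∈ B → e ∈ Q → d ~ e → e ∈ B) → K ≤ # B → # B ≤ K + K → ⊥
        finish B B⊆ B⊆Q clB K≤B B≤2K = (lin65 {n} {δ} {_} {_} {# (A ∪ B)} {# (Z ∪ set P)} {# A} {# B} {# Z}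
            {# (set P)} {length P} {z} {K})
          (J A B (∖⊆ ∘ A⊆Q) (∖⊆ ∘ B⊆Q) K≤A K≤B (λ i j → proj₂ (∖⁻ (B⊆ j)) i)
              (λ i j e → proj₂ (∖⁻ (B⊆ j)) (clA i (B⊆Q j) e)))
          (#-mono (∪-⊆ (cover A (λ i → ∪ˡ i) A⊆Q clA) (cover B (λ i → ∪ʳ i) B⊆Q clB))) (#-∪ _ _) (#-∪ A B)
              (#-∪ Z (set P)) (#-set unique) P≤n Z≤z A≤2K B≤2K z<δ
          where
          cover : ∀ C → C ⊆ A ∪ B → C ⊆ Q → (∀ {d e} → d ∈ C → e ∈ Q → d ~ e → e ∈ C) → N[ W ] C ⊆ (A ∪ B) ∪
              (Z ∪ set P)
          cover C C⊆ C⊆Q cl {x} i with N⁻ i | x ∈? (Z ∪ set P)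
          ... | _ | yes j = ∪ʳ j
          ... | w , inj₁ c | no _ = ∪ˡ (C⊆ c)
          ... | w , inj₂ (c , c∈ , e) | no n′ = ∪ˡ (C⊆ (cl c∈ (∖⁺ w n′) e))

-- Shortening a path by chords and closing it to length n.

evens : {A : Set} → List A → List A
evens [] = []
evens (a ∷ []) = a ∷ []
evens (a ∷ _ ∷ l) = a ∷ evens l

evens⊆ : {A : Set} (l : List A) {a : A} → a ∈ˡ evens l → a ∈ˡ l
evens⊆ (x ∷ []) i = i
evens⊆ (x ∷ y ∷ l) (here e) = here e
evens⊆ (x ∷ y ∷ l) (there i) = there (there (evens⊆ l i))

evens-unique : {A : Set} (l : List A) → Unique l → Unique (evens l)
evens-unique [] u = []
evens-unique (x ∷ []) u = u
evens-unique (x ∷ y ∷ l) ((_ ∷ h) ∷ _ ∷ u) = All.tabulate (λ i → All.lookup h (evens⊆ l i)) ∷ evens-unique l u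

length-evens : {A : Set} (l : List A) → length l ≤ length (evens l) + length (evens l)
length-evens [] = z≤n
length-evens (x ∷ []) = s≤s z≤n
length-evens (x ∷ y ∷ l) = (lin66 {_} {length (evens l)}) (length-evens l)

Gap : {A : Set} → A → A → List A → Set
Gap {A} a b l = Σ[ l₁ ∈ List A ] Σ[ c ∈ A ] Σ[ l₂ ∈ List A ] Σ[ l₃ ∈ List A ] l ≡ l₁ ++ a ∷ (c ∷ l₂) ++ b ∷ l₃

compare-evens : {A : Set} (l : List A) {a b : A} → a ∈ˡ evens l → b ∈ˡ evens l → a ≢ b → Gap a b l ⊎ Gap b a l
compare-evens (x ∷ []) (here refl) (here refl) n = ⊥-elim (n refl)
compare-evens (x ∷ y ∷ l) (here refl) (here refl) n = ⊥-elim (n refl)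
compare-evens (x ∷ y ∷ l) (here refl) (there j) n with l₂ , l₃ , e ← ∈-∃++ (evens⊆ l j) = inj₁
    ([] , y , l₂ , l₃ , cong (λ t → x ∷ y ∷ t) e)
compare-evens (x ∷ y ∷ l) (there i) (here refl) n with l₂ , l₃ , e ← ∈-∃++ (evens⊆ l i) = inj₂
    ([] , y , l₂ , l₃ , cong (λ t → x ∷ y ∷ t) e)
compare-evens (x ∷ y ∷ l) (there i) (there j) n with compare-evens l i j n
... | inj₁ (l₁ , c , l₂ , l₃ , e) = inj₁ (x ∷ y ∷ l₁ , c , l₂ , l₃ , cong (λ t → x ∷ y ∷ t) e)
... | inj₂ (l₁ , c , l₂ , l₃ , e) = inj₂ (x ∷ y ∷ l₁ , c , l₂ , l₃ , cong (λ t → x ∷ y ∷ t) e)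

module Shortening {N : ℕ} (G : Graph N) (W Z : Sub N) (Z⊆W : Z ⊆ W) (port r : Fin N)
  (port∈Z : port ∈ Z) (r∈Z : r ∈ Z) (port≢r : port ≢ r) where
  open Basics G
  open RestPath G W Z Z⊆W port r port∈Z r∈Z

  shortcut : ∀ {P a b} Q R → P ≡ Q ++ R → Rest P → Gap a b Q → a ~ b → Σ[ P′ ∈ List V ] Rest P′ × length P′ < length P
      × length P ≤ length P′ + length Q
  shortcut {P} {a} {b} Q R eq RP (l₁ , c , l₂ , l₃ , eqQ) ab =
    P′ , record { head = Hd-replace l₁ (subst (Hd port) eqP head) ; last = last′ ; chain = Ch-++ l₁ a
        (Ch-init l₁ a chP) (ab , Ch-++ʳ (c ∷ l₂) (Ch-tail a _ (Ch-++ʳ l₁ chP)))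
      ; unique = proj₁ (proj₂ (Unique-++⁻ (c ∷ l₂) (Unique-resp-↭ perm unique)))
      ; inner = All.++⁻ʳ (c ∷ l₂) (All-resp-↭ perm inner) } ,
      (lin67 {_} {_} {length l₂} {length P′}) (↭-length perm) (length-++ (c ∷ l₂)) ,
      (lin68 {_} {_} {length l₂} {length P′} {length Q} {_} {length l₁} {length ((c ∷ l₂) ++ b ∷ l₃)}
          {length (b ∷ l₃)})
        (↭-length perm) (length-++ (c ∷ l₂)) (cong length eqQ) (length-++ l₁) (length-++ (c ∷ l₂))
    where
    open Rest RP
    P′ : List V
    P′ = l₁ ++ a ∷ b ∷ l₃ ++ R
    eqP : P ≡ l₁ ++ a ∷ (c ∷ l₂) ++ (b ∷ l₃ ++ R)
    eqP = trans eq (trans (cong (_++ R) eqQ) (trans (++-assoc l₁ (a ∷ (c ∷ l₂) ++ b ∷ l₃) R)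
        (cong (λ t → l₁ ++ a ∷ t) (++-assoc (c ∷ l₂) (b ∷ l₃) R))))
    chP : Ch (l₁ ++ a ∷ (c ∷ l₂) ++ (b ∷ l₃ ++ R))
    chP = subst Ch eqP chain
    last′ : Lst r P′
    last′ = subst (Lst r) (++-assoc l₁ [ a ] (b ∷ l₃ ++ R))
        (Lst-++ (l₁ ++ [ a ]) (Lst-++⁻ (l₁ ++ a ∷ c ∷ l₂)
        (subst (Lst r) (trans eqP (sym (++-assoc l₁ (a ∷ c ∷ l₂) (b ∷ l₃ ++ R)))) last)))
    perm : P ↭ (c ∷ l₂) ++ P′
    perm = ↭-trans (↭-reflexive eqP) (↭-sym (↭-trans (↭-reflexive (sym (++-assoc (c ∷ l₂) l₁ (a ∷ b ∷ l₃ ++ R))))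
      (↭-trans (++⁺ʳ (a ∷ b ∷ l₃ ++ R) (++-comm (c ∷ l₂) l₁))
      (↭-trans (↭-reflexive (++-assoc l₁ (c ∷ l₂) (a ∷ b ∷ l₃ ++ R))) (++⁺ˡ l₁ (shift a (c ∷ l₂) (b ∷ l₃ ++ R)))))))

  -- Every other vertex among the first 2K gives K vertices, which cannot be independent. A chord
  -- between two of them skips at least one vertex and stays within the first 2K.
  shorter : ∀ {K} → (∀ S → S ⊆ W → Apart S S → # S < K) → ∀ P → Rest P → K + K ≤ length P →
    (Σ[ P′ ∈ List V ] (Rest P′ × length P′ < length P × length P ≤ length P′ + (K + K)) → ⊥) → ⊥
  shorter {K} α P RP 2K≤P k = (lin69 {_} {K} {length (evens Q)} {length Q})
      (α (set (evens Q)) (λ i → Inner⊆W (All.lookup (All.take⁺ (K + K) inner) (evens⊆ Q (set⁻ i)))) apart)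
          (#-set (evens-unique Q uQ)) (length-evens Q) lenQ
    where
    open Rest RP
    Q R : List V
    Q = take (K + K) P
    R = drop (K + K) P
    eq : P ≡ Q ++ R
    eq = sym (take++drop≡id (K + K) P)
    lenQ : length Q ≡ K + K
    lenQ = trans (length-take (K + K) P) (m≤n⇒m⊓n≡m 2K≤P)
    uQ : Unique Q
    uQ = proj₁ (Unique-++⁻ Q (subst Unique eq unique))
    apply : ∀ {a b} → Gap a b Q → a ~ b → ⊥
    apply g e with P′ , RP′ , lt , le ← shortcut Q R eq RP g e = k
        (P′ , RP′ , lt , subst (λ t → length P ≤ length P′ + t) lenQ le)
    apart : Apart (set (evens Q)) (set (evens Q))
    apart i j e with compare-evens Q (set⁻ i) (set⁻ j) (λ { refl → ~-irrefl e })
    ... | inj₁ g = apply g e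
    ... | inj₂ g = apply g (~-sym e)

  Flexible : ℕ → ℕ → Set
  Flexible base window = ∀ j → j ≤ window → Σ[ l ∈ List V ] Unique (port ∷ l ++ [ r ]) × Ch (port ∷ l ++ [ r ]) × All
      (_∈ Z) (port ∷ l ++ [ r ]) × length l ≡ base + j

  close : ∀ {n base window} → NoCycle n → Flexible base window → ∀ P → Rest P → length P + base ≤ n → n ≤ length P +
      base + window → ⊥
  close {n} {base} {window} noC flex P RP lo hi with Lst⇒∷ʳ P (Rest.last RP)
  ... | [] , refl = port≢r (Rest.head RP)
  ... | (p ∷ m) , refl with refl ← Rest.head RP
    with l , u , c , a , len ← flex (n ∸ (length (port ∷ m ++ [ r ]) + base))
        (≤-trans (∸-monoˡ-≤ (length (port ∷ m ++ [ r ]) + base) hi)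
        (≤-reflexive (m+n∸m≡n (length (port ∷ m ++ [ r ]) + base) window))) =
    noC port (l ++ r ∷ reverse m) uniq ch
      ((lin70 {_} {length l} {length (reverse m)} {length m} {base} {n ∸ (length (port ∷ m ++ [ r ]) + base)}
          {length (m ++ [ r ])}) (length-++ l) (length-reverse m) len (length-++ m) (m+[n∸m]≡n lo))
    where
    open Rest RP
    rev : reverse (port ∷ m ++ [ r ]) ≡ r ∷ reverse m ++ [ port ]
    rev = trans (unfold-reverse port (m ++ [ r ])) (cong (_++ [ port ]) (reverse-∷ʳ m r))
    ch : Ch (port ∷ (l ++ r ∷ reverse m) ++ [ port ])
    ch = subst Ch (cong (port ∷_) (sym (++-assoc l (r ∷ reverse m) [ port ])))
        (Ch-++ (port ∷ l) r c (subst Ch rev (Ch-reverse _ chain)))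
    m∉Z : ∀ {v} → v ∈ˡ m → v ∈ Z → ⊥
    m∉Z {v} i z with All.lookup inner (there (∈-++⁺ˡ i)) | unique
    ... | inj₁ refl | h ∷ _ = All.lookup h (∈-++⁺ˡ i) refl
    ... | inj₂ (inj₁ refl) | _ ∷ u′ = proj₂ (proj₂ (Unique-++⁻ m u′)) i (here refl)
    ... | inj₂ (inj₂ (_ , n′)) | _ = n′ z
    uniq : Unique (port ∷ l ++ r ∷ reverse m)
    uniq = subst Unique (cong (port ∷_) (++-assoc l [ r ] (reverse m)))
      (Unique-++⁺ u (Unique-resp-↭ (↭-sym (↭-reverse m)) (proj₁ (Unique-++⁻ m (case unique of λ { (_ ∷ u′) → u′ }))))
        (λ i j → m∉Z (∈-resp-↭ (↭-reverse m) j) (All.lookup a i)))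

  -- Among the paths that the window can still extend to n take a shortest. If it is too long, one
  -- more chord removes at most 2K vertices, which the window absorbs, contrary to the choice.
  exact : ∀ {n base window K} → NoCycle n → Flexible base window → (∀ S → S ⊆ W → Apart S S → # S < K) → K + K ≤
      window → base + (K + K) ≤ n →
    ∀ P → Rest P → n ≤ length P → ⊥
  exact {n} {base} {window} {K} noC flex α 2K≤w bound P₀ R₀ n≤ = do
    P , (RP , hi) , min ← minimum (λ P → Rest P × n ≤ length P + base + window) length P₀
      (R₀ , (lin71 {_} {length P₀} {base} {window}) n≤)
    examine P RP hi min (length P + base ≤? n)
    where
    examine : ∀ P → Rest P → n ≤ length P + base + window →
        (∀ P′ → Rest P′ × n ≤ length P′ + base + window → length P ≤ length P′) → Dec (length P + base ≤ n) → ⊥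
    examine P RP hi min (yes lo) = close noC flex P RP lo hi
    examine P RP hi min (no gt) = do
      P′ , RP′ , lt , le ← shorter α P RP ((lin72 {_} {length P} {base} {K}) (≰⇒> gt) bound)
      <⇒≱ lt (min P′ (RP′ , (lin73 {_} {length P} {base} {length P′} {K} {window}) (≰⇒> gt) le 2K≤w))

Unique-head : {A : Set} {x : A} {l : List A} → Unique (x ∷ l) → All (x ≢_) l
Unique-head (h ∷ _) = h

-- Joining the two ends of the flexible path.

module CloseUp {N : ℕ} (G : Graph N) (W W′ : Sub N) (K β τ z : ℕ) (1≤K : 1 ≤ K)
  (thick : ∀ U → U ⊆ W′ → K ≤ # U → # U ≤ K + K → # U + (4 * K + β) < # (Basics.N[_]_ G W′ U))
  (small : ∀ U → U ⊆ W′ → 1 ≤ # U → # U ≤ K → 4 * # U < # (Basics.N[_]_ G W′ U))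
  (W′⊆W : W′ ⊆ W) (removed : # (W ∖ W′) ≤ K)
  (region : ∀ A → A ⊆ W → K ≤ # A → # A + # A ≤ # W → # A + τ ≤ # (Basics.N[_]_ G W A))
  (z≤β : z + 3 * K ≤ β) (z<τ : z + 4 * K < τ) where
  open Chains G W′ K β 1≤K thick small
  open Image {N}

  record Tail (st₀ : State) (s : V) (j : ℕ) : Set where
    field
      st : State
      ext : Ext st₀ s st
      t : V
      fresh : Fresh st t
      l : List V
      chain : Ch (t ∷ l ++ [ s ])
      unique : Unique (t ∷ l)
      all-new : All (New st₀ st) (t ∷ l)
      len : length l ≡ j
      size : #Z st ≤ #Z st₀ + suc j

  tail : ∀ {st₀ s} → s ∈ Z st₀ → # (children st₀ s) ≤ 1 → ∀ j → #Z st₀ + j ≤ β → (Tail st₀ s j → ⊥) → ⊥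
  tail {st₀} {s} s∈ deg zero b k = do
    L ← addLeaf st₀ (≤-trans (m≤m+n _ _) b) s s∈ deg
    k record { st = Leaf.st′ L ; ext = Leaf.ext L ; t = Leaf.y L ; fresh = leaf-fresh L ; l = [] ; chain = ~-sym
        (Leaf.p~y L) , tt
      ; unique = [] ∷ [] ; all-new = (Leaf.y∈Z′ L , Leaf.y∉Z L) ∷ [] ; len = refl ; size = (lin74 {_} {#Z st₀})
          (#Z-Leaf L) }
  tail {st₀} {s} s∈ deg (suc j) b k = do
    T₀ ← tail s∈ deg j ((lin75 {#Z st₀} {j}) b)
    extend T₀
    where
    extend : Tail st₀ s j → ⊥
    extend T₀ = do
      L ← addLeaf T.st ((lin76 {#Z st₀} {j}) b T.size) T.t (proj₁ T.fresh) (Fresh-deg {T.st} {T.t} T.fresh)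
      k record { st = Leaf.st′ L ; ext = Ext-trans (inj₂ (proj₂ (All.head T.all-new))) T.ext (Leaf.ext L) ; t = Leaf.y
          L ; fresh = leaf-fresh L ; l = T.t ∷ T.l
        ; chain = ~-sym (Leaf.p~y L) , T.chain
        ; unique = All.tabulate (λ { i refl → Leaf.y∉Z L (proj₁ (All.lookup T.all-new i)) }) ∷ T.unique
        ; all-new = (Leaf.y∈Z′ L , λ i → Leaf.y∉Z L (grow T.ext i)) ∷ All.map (λ (p , q) → grow (Leaf.ext L) p , q)
            T.all-new
        ; len = cong suc T.len ; size = (lin77 {_} {#Z T.st} {#Z st₀} {j}) (#Z-Leaf L) T.size }
      where module T = Tail T₀

  free : State → Sub N
  free st = W′ ∖ Z st

  -- A set that is closed in the free part and contains a vertex with at most one child cannot expand.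
  closed-big : ∀ {st x} → x ∈ Z st → # (children st x) ≤ 1 → ∀ E → x ∈ E → E ⊆ free st ∪ ⁅ x ⁆ →
    (∀ {d e} → d ∈ E → e ∈ free st → d ~ e → e ∈ E) → K + K < # E
  closed-big {st} {x} x∈Z deg E x∈E E⊆ cl = ≰⇒> λ E≤ →
    (lin78 {# E} {_} {_} {# (E ∖ ⁅ x ⁆)} {# (children st x)} {# (⁅ x ⁆)})
      (good st E E⊆W E≤) (#-mono cover) (#-∪ _ _) deg (#-∖⊆ {A = E} {⁅ x ⁆} (λ i → subst (_∈ E) (sym (⁅⁆⁻ i)) x∈E))
          (#-⁅⁆ x)
    where
    E⊆W : E ⊆ W′
    E⊆W i with ∪⁻ (E⊆ i)
    ... | inj₁ j = ∖⊆ j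
    ... | inj₂ j = subst (_∈ W′) (sym (⁅⁆⁻ j)) (Z⊆W st x∈Z)
    cover : img (ρ st) E ⊆ (E ∖ ⁅ x ⁆) ∪ children st x
    cover {y} i with u , u∈ , t ← img⁻ i with y ∈? Z st
    ... | no n = ∪ˡ (∖⁺ (cl u∈ (∖⁺ (proj₁ (ρ⇒~ st t)) n) (proj₂ (ρ⇒~ st t)))
        (λ j → n (subst (_∈ Z st) (sym (⁅⁆⁻ j)) x∈Z)))
    ... | yes p with ∪⁻ (E⊆ u∈)
    ...   | inj₁ j = ⊥-elim (proj₂ (∖⁻ j) (parent∈Z st p t))
    ...   | inj₂ j with refl ← ⁅⁆⁻ j = ∪ʳ (children⁺ st p t)

  module _ {r window} (F : Flex r window z) where
    module F = Flex F
    open RestPath G W (Z F.st) (λ i → W′⊆W (Z⊆W F.st i)) F.port r F.port∈Z F.r∈Z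

    -- A tail of 2K + 1 embedded vertices provides the length that `component-small` demands. If its
    -- end `t` cannot reach `r` through free vertices, then the component of `t` and the remaining
    -- free vertices with `r` are two closed sets of more than 2K vertices. The smaller one is at
    -- most half of `W`, and its boundary consists of embedded and removed vertices, too few for
    -- expansion.
    connect : (Σ[ P ∈ List V ] (Rest P × K + K ≤ length P) → ⊥) → ⊥
    connect k = do
      T₀ ← tail F.port∈Z F.port-deg (K + K) ((lin79 {#Z F.st} {z} {K}) F.size z≤β)
      C ← component {free (Tail.st T₀) ∪ ⁅ Tail.t T₀ ⁆} {Tail.t T₀} (∪ʳ ⁅⁆⁺)
      examine T₀ C (any? (λ e → (e ∈? Component.D C) ×-dec (e ~? r)))
      where
      examine : (T₀ : Tail F.st F.port (K + K)) (C : Component (free (Tail.st T₀) ∪ ⁅ Tail.t T₀ ⁆) (Tail.t T₀)) → Dec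
          (∃[ e ] (e ∈ Component.D C × e ~ r)) → ⊥
      examine T₀ C (yes (e , e∈ , er)) with ds , u , a , c ← Component.linked C e∈ (Component.origin C)
          (link-start (Component.D⊆Q C e∈) er) =
        k (P , record { head = refl ; last = Lst-∷ʳ (F.port ∷ X) r ; chain = ch ; unique = uniq ; inner = inn } ,
           (lin80 {length l} {K} {length (reverse l)} {length X} {length ds} {length (X ++ [ r ])}) len
               (length-reverse l) (length-++ (reverse l)) (length-++ X))
        where
        open Tail T₀
        X : List V
        X = reverse l ++ t ∷ ds
        P : List V
        P = F.port ∷ X ++ [ r ]
        ds-free : ∀ {v} → v ∈ˡ ds → v ∈ free st
        ds-free i with ∪⁻ (All.lookup a (there i))
        ... | inj₁ j = j
        ... | inj₂ j = ⊥-elim (All.lookup (Unique-head u) i (sym (⁅⁆⁻ j)))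
        perm : X ↭ (t ∷ l) ++ ds
        perm = ↭-trans (++⁺ʳ (t ∷ ds) (↭-reverse l)) (shift t l ds)
        all-X : ∀ {v} → v ∈ˡ X → v ∈ W′ × v ∉ Z F.st
        all-X i with ∈-++⁻ (t ∷ l) (∈-resp-↭ perm i)
        ... | inj₁ j = Z⊆W st (proj₁ (All.lookup all-new j)) , proj₂ (All.lookup all-new j)
        ... | inj₂ j = ∖⊆ (ds-free j) , λ q → proj₂ (∖⁻ (ds-free j)) (grow ext q)
        uniq : Unique P
        uniq = All.tabulate (λ { {v} i refl → case ∈-++⁻ X i of λ
            { (inj₁ j) → proj₂ (all-X j) F.port∈Z ; (inj₂ (here e′)) → F.r≢port (sym e′) } })
          ∷ ∉⇒Unique-∷ʳ (Unique-resp-↭ (↭-sym perm)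
              (Unique-++⁺ unique (case u of λ { (_ ∷ u′) → u′ })
              (λ i j → proj₂ (∖⁻ (ds-free j)) (proj₁ (All.lookup all-new i)))))
              (λ i → proj₂ (all-X i) F.r∈Z)
        inn : All Inner P
        inn = inj₁ refl ∷ All.++⁺ (All.tabulate (λ i → inj₂ (inj₂ (W′⊆W (proj₁ (all-X i)) , proj₂ (all-X i)))))
            (inj₂ (inj₁ refl) ∷ [])
        ch : Ch P
        ch = subst Ch (cong (F.port ∷_) (sym (++-assoc (reverse l) (t ∷ ds) [ r ])))
          (Ch-++ (F.port ∷ reverse l) t (subst Ch (trans (unfold-reverse t (l ++ [ F.port ]))
              (cong (_++ [ t ]) (reverse-∷ʳ l F.port))) (Ch-reverse _ chain)) c)
      examine T₀ C (no none) = separate (<-≤-connex (# E) (# D))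
        where
        open Tail T₀
        open Component C
        E : Sub N
        E = (free st ∪ ⁅ r ⁆) ∖ D
        D⊆ : D ⊆ free st ∪ ⁅ t ⁆
        D⊆ = D⊆Q
        r∈Z′ : r ∈ Z st
        r∈Z′ = grow ext F.r∈Z
        r≢t : r ≢ t
        r≢t refl = proj₂ (All.head all-new) F.r∈Z
        r∉D : r ∉ D
        r∉D i with ∪⁻ (D⊆ i)
        ... | inj₁ j = proj₂ (∖⁻ j) r∈Z′
        ... | inj₂ j = r≢t (⁅⁆⁻ j)
        D-big : K + K < # D
        D-big = closed-big {st} (proj₁ fresh) (Fresh-deg {st} {t} fresh) D origin D⊆ (λ d∈ e∈ e → closed d∈ (∪ˡ e∈) e)
        E-closed : ∀ {d e} → d ∈ E → e ∈ free st → d ~ e → e ∈ E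
        E-closed {d} {e} d∈ e∈ de = ∖⁺ (∪ˡ e∈) (λ eD → case ∪⁻ (∖⊆ d∈) of λ
          { (inj₁ j) → proj₂ (∖⁻ d∈) (closed eD (∪ˡ j) (~-sym de))
          ; (inj₂ j) → none (e , eD , ~-sym (subst (_~ e) (⁅⁆⁻ j) de)) })
        E-big : K + K < # E
        E-big = closed-big {st} r∈Z′ (≤-trans (#-mono (children-Ext ext F.r∈Z F.r≢port)) F.r-deg) E (∖⁺ (∪ʳ ⁅⁆⁺) r∉D)
            ∖⊆ E-closed
        D⊆W : D ⊆ W
        D⊆W i with ∪⁻ (D⊆ i)
        ... | inj₁ j = W′⊆W (∖⊆ j)
        ... | inj₂ j = W′⊆W (Z⊆W st (subst (_∈ Z st) (sym (⁅⁆⁻ j)) (proj₁ fresh)))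
        E⊆W : E ⊆ W
        E⊆W i with ∪⁻ (∖⊆ i)
        ... | inj₁ j = W′⊆W (∖⊆ j)
        ... | inj₂ j = W′⊆W (Z⊆W st (subst (_∈ Z st) (sym (⁅⁆⁻ j)) r∈Z′))
        D+E : # D + # E ≤ # W
        D+E = ≤-trans (≤-reflexive (sym (#-⊎ (λ i j → proj₂ (∖⁻ j) i)))) (#-mono (∪-⊆ D⊆W E⊆W))
        contradict : ∀ A → A ⊆ W → K + K < # A → # A + # A ≤ # W → (∀ {d e} → d ∈ A → e ∈ free st → d ~ e → e ∈ A) → ⊥
        contradict A A⊆W big half cl = (lin81 {# A} {τ} {_} {_} {# (Z st ∪ (W ∖ W′))} {#Z st} {# (W ∖ W′)} {K}
            {#Z F.st} {z})
          (region A A⊆W (≤-trans (m≤m+n K K) (<⇒≤ big)) half) (#-mono cover) (#-∪ A (Z st ∪ (W ∖ W′)))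
              (#-∪ (Z st) (W ∖ W′)) removed size F.size z<τ 1≤K
          where
          cover : N[ W ] A ⊆ A ∪ (Z st ∪ (W ∖ W′))
          cover {x} i with N⁻ i
          ... | w , inj₁ a = ∪ˡ a
          ... | w , inj₂ (a , a∈ , e) with x ∈? Z st | x ∈? W′
          ...   | yes p | _ = ∪ʳ (∪ˡ p)
          ...   | no _ | no q = ∪ʳ (∪ʳ (∖⁺ w q))
          ...   | no p | yes q = ∪ˡ (cl a∈ (∖⁺ q p) e)
        separate : # E < # D ⊎ # D ≤ # E → ⊥
        separate (inj₁ lt) = contradict E E⊆W E-big ((lin82 {# D} {# E}) D+E lt) E-closed
        separate (inj₂ le) = contradict D D⊆W D-big ((lin83 {# D} {# E}) D+E le) (λ d∈ e∈ e → closed d∈ (∪ˡ e∈) e)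

    finish : ∀ {n δ} → NoCycle n → (∀ S → S ⊆ W → Apart S S → # S < K) →
      (∀ A B → A ⊆ W → B ⊆ W → K ≤ # A → K ≤ # B → (∀ {x} → x ∈ A → x ∉ B) → Apart A B → n + δ ≤ #
          (N[ W ] A ∪ N[ W ] B)) →
      n + z + 3 * K ≤ # W → z + 4 * K < δ → K + K ≤ window → z + (K + K) ≤ n → ⊥
    finish {n} {δ} noC α J n≤W z<δ 2K≤w z+2K≤n = do
      P₀ , R₀ , 2K≤P₀ ← connect
      P , RP , max ← maximum Rest length N Rest-length P₀ R₀
      Shortening.exact G W (Z F.st) (λ i → W′⊆W (Z⊆W F.st i)) F.port r F.port∈Z F.r∈Z (λ e → F.r≢port (sym e)) {n}
          {F.base} {window} {K} noC F.path α 2K≤w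
        ((lin84 {F.base} {window} {z} {K}) F.base≤z z+2K≤n) P RP
        (<⇒≤ (Maximal.long P RP max {K} {τ} {z} {n} {δ} 1≤K α region J F.size ((lin85 {z} {K}) z<τ)
            (≤-trans 2K≤P₀ (max P₀ R₀)) n≤W z<δ))

-- The case of a region noticeably larger than n.

module Slack {N : ℕ} (G : Graph N) (W : Sub N) (K h L t β τ n δ : ℕ) (ms : List ℕ) (1≤K : 1 ≤ K)
  (region : ∀ A → A ⊆ W → K ≤ # A → # A + # A ≤ # W → # A + τ ≤ # (Basics.N[_]_ G W A))
  (J : ∀ A B → A ⊆ W → B ⊆ W → K ≤ # A → K ≤ # B → (∀ {x} → x ∈ A → x ∉ B) → Basics.Apart G A B → n + δ ≤ #
      (Basics.N[_]_ G W A ∪ Basics.N[_]_ G W B))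
  (noHole : ∀ S → S ⊆ W → Basics.Hole G ms S → ⊥) (noC : Basics.NoCycle G n)
  (sum≤K : sum ms ≤ K) (ms≤ : length ms ≤ 2 ^ L) (Small : All (λ m → ⌈log₂ m ⌉ ≤ h × m ≤ 2 ^ ⌈log₂ m ⌉) ms) where
  open Basics G

  unitCost : ℕ
  unitCost = suc ((h + suc L) + (h + suc L))

  -- All classes together have at most K vertices and would fit into an independent set of that
  -- size.
  α : ∀ S → S ⊆ W → Apart S S → # S < K
  α S S⊆W ap = ≰⇒> λ K≤S → noHole S S⊆W (independent-hole ms ap (≤-trans sum≤K K≤S))

  slack : ∀ z → 2 + (h + h) * unitCost + t * unitCost ≡ z → 1 ≤ L + h → z + suc (cost h L ms) ≤ β → z + 3 * K ≤ β → β
      + 6 * K ≤ τ →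
    n + z + 3 * K ≤ # W → z + 4 * K < δ → K + K ≤ (h + h) + t * suc (h + h) → z + (K + K) ≤ n → ⊥
  slack z refl 1≤Lh cost≤ z≤β β≤τ n≤W z<δ 2K≤w z+2K≤n = do
    B , B⊆W , B<K , NB , small ← Cleaning.clean G {W} K 1≤K mid
    build B B⊆W B<K small
    where
    half : ∀ {U} → # U ≤ K + K → # U + # U ≤ # W
    half {U} le = (lin86 {# U} {K} {n} {z}) le n≤W z+2K≤n
    mid : ∀ U → U ⊆ W → K ≤ # U → # U < K + K → 4 * # U < # (N[ W ] U)
    mid U U⊆W K≤U U<2K = (lin87 {# U} {τ} {_} {K} {β}) (region U U⊆W K≤U (half {U} (<⇒≤ U<2K))) U<2K β≤τ
    module _ (B : Sub N) (B⊆W : B ⊆ W) (B<K : # B < K) (small : ∀ U → U ⊆ W ∖ B → 1 ≤ # U → # U ≤ K → 4 * # U < # (N[ W ∖ B ] U)) where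
      W′ : Sub N
      W′ = W ∖ B
      thick : ∀ U → U ⊆ W′ → K ≤ # U → # U ≤ K + K → # U + (4 * K + β) < # (N[ W′ ] U)
      thick U U⊆ K≤U U≤2K = (lin88 {# U} {τ} {_} {# B} {# (N[ W ] U ∖ B)} {_} {K} {β})
        (region U (∖⊆ ∘ U⊆) K≤U (half {U} U≤2K)) (#-∖ (N[ W ] U) B) (#-mono f) B<K β≤τ
        where
        f : N[ W ] U ∖ B ⊆ N[ W′ ] U
        f i with j , x∉ ← ∖⁻ i = N⁺ (∖⁺ (N⊆ j) x∉) (proj₂ (N⁻ j))
      removed : # (W ∖ W′) ≤ K
      removed = ≤-trans (#-mono g) (<⇒≤ B<K)
        where
        g : W ∖ W′ ⊆ B
        g {x} i with j , x∉ ← ∖⁻ i with x ∈? B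
        ... | yes b = b
        ... | no b = ⊥-elim (x∉ (∖⁺ j b))
      module C = CloseUp G W W′ K β τ z 1≤K thick small ∖⊆ removed region z≤β ((lin89 {z} {K} {β}) z≤β β≤τ 1≤K)
      module Ch = Chains G W′ K β 1≤K thick small
      module Bu = Ch.Building h L ms ms≤ Small (λ S S⊆ → noHole S (∖⊆ ∘ S⊆))
      build : ⊥
      build with r , r∈ ← pick {A = W′} ((lin90 {_} {# B} {_} {K} {n} {z}) (#-∖ W B) B<K n≤W) = do
        F ← Bu.flexible r r∈ 1≤Lh t cost≤
        C.finish F {n} {δ} noC α J n≤W z<δ 2K≤w z+2K≤n

-- Pósa rotations

Next : {A : Set} → List A → A → A → Set
Next [] u v = ⊥
Next (a ∷ []) u v = ⊥
Next (a ∷ b ∷ l) u v = (u ≡ a × v ≡ b) ⊎ Next (b ∷ l) u v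

module _ {A : Set} where

  Next-∷ : ∀ x (l : List A) {u v} → Next l u v → Next (x ∷ l) u v
  Next-∷ x (a ∷ b ∷ l) n = inj₂ n

  Next-++ʳ : ∀ (l : List A) {m u v} → Next m u v → Next (l ++ m) u v
  Next-++ʳ [] n = n
  Next-++ʳ (x ∷ l) n = Next-∷ x _ (Next-++ʳ l n)

  Next-++ˡ : ∀ (l : List A) {m u v} → Next l u v → Next (l ++ m) u v
  Next-++ˡ (a ∷ b ∷ l) (inj₁ e) = inj₁ e
  Next-++ˡ (a ∷ b ∷ l) (inj₂ n) = inj₂ (Next-++ˡ (b ∷ l) n)

  Next-mid : ∀ (l : List A) {m u v} → Lst u l → Hd v m → Next (l ++ m) u v
  Next-mid (a ∷ []) {x ∷ m} refl refl = inj₁ (refl , refl)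
  Next-mid (a ∷ b ∷ l) p q = inj₂ (Next-mid (b ∷ l) p q)

  Next-++⁻ : ∀ (l : List A) {m u v} → Next (l ++ m) u v → Next l u v ⊎ Next m u v ⊎ (Lst u l × Hd v m)
  Next-++⁻ [] n = inj₂ (inj₁ n)
  Next-++⁻ (a ∷ []) {x ∷ m} (inj₁ (p , q)) = inj₂ (inj₂ (p , q))
  Next-++⁻ (a ∷ []) {x ∷ m} (inj₂ n) = inj₂ (inj₁ n)
  Next-++⁻ (a ∷ b ∷ l) (inj₁ e) = inj₁ (inj₁ e)
  Next-++⁻ (a ∷ b ∷ l) (inj₂ n) with Next-++⁻ (b ∷ l) n
  ... | inj₁ m = inj₁ (inj₂ m)
  ... | inj₂ m = inj₂ m

  Lst-reverse : ∀ (l : List A) {x} → Hd x l → Lst x (reverse l)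
  Lst-reverse (x ∷ l) refl = subst (Lst x) (sym (unfold-reverse x l)) (Lst-∷ʳ (reverse l) x)

  Hd-reverse : ∀ (l : List A) {x} → Lst x l → Hd x (reverse l)
  Hd-reverse l {x} p with l′ , refl ← Lst⇒∷ʳ l p = subst (Hd x) (sym (reverse-∷ʳ l′ x)) refl

  Lst-unique : ∀ (l : List A) {x y} → Lst x l → Lst y l → x ≡ y
  Lst-unique (a ∷ []) p q = trans p (sym q)
  Lst-unique (a ∷ b ∷ l) p q = Lst-unique (b ∷ l) p q

  Next-reverse : ∀ (l : List A) {u v} → Next l u v → Next (reverse l) v u
  Next-reverse (a ∷ b ∷ l) (inj₁ (refl , refl)) = subst (λ t → Next t b a) (sym (unfold-reverse a (b ∷ l)))
      (Next-mid (reverse (b ∷ l)) (Lst-reverse (b ∷ l) refl) refl)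
  Next-reverse (a ∷ b ∷ l) (inj₂ n) = subst (λ t → Next t _ _) (sym (unfold-reverse a (b ∷ l)))
      (Next-++ˡ (reverse (b ∷ l)) (Next-reverse (b ∷ l) n))

  Next-reverse⁻ : ∀ (l : List A) {u v} → Next (reverse l) u v → Next l v u
  Next-reverse⁻ l n = subst (λ t → Next t _ _) (reverse-involutive l) (Next-reverse (reverse l) n)

  Next⇒∈ : ∀ (l : List A) {u v} → Next l u v → u ∈ˡ l × v ∈ˡ l
  Next⇒∈ (a ∷ b ∷ l) (inj₁ (refl , refl)) = here refl , there (here refl)
  Next⇒∈ (a ∷ b ∷ l) (inj₂ n) with p , q ← Next⇒∈ (b ∷ l) n = there p , there q

  last-exists : ∀ x (l : List A) → ∃[ z ] Lst z (x ∷ l)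
  last-exists x [] = x , refl
  last-exists x (y ∷ l) = last-exists y l

  Cons : List A → A → A → Set
  Cons l u v = Next l u v ⊎ Next l v u

module _ {n : ℕ} (A : Sub n) where

  place : ∀ {x : Fin n} → Dec (x ∈ A) → Fin n → List (Fin n) → List (Fin n)
  place (yes _) y l = y ∷ l
  place (no _) y l = l

  -- One entry for each incidence of a path edge with `A`, repetitions included; this makes the
  -- bound 2|A| a plain count.
  around′ : Fin n → List (Fin n) → List (Fin n)
  around′ u [] = []
  around′ u (v ∷ l) = place (u ∈? A) v (place (v ∈? A) u (around′ v l))

  around : List (Fin n) → List (Fin n)
  around [] = []
  around (u ∷ l) = around′ u l

  members : List (Fin n) → ℕ
  members l = length (filter (_∈? A) l)

  place⁺ : ∀ {x} (d : Dec (x ∈ A)) {y l v} → v ∈ˡ l → v ∈ˡ place d y l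
  place⁺ (yes _) i = there i
  place⁺ (no _) i = i

  place-here : ∀ {x} (d : Dec (x ∈ A)) {y l} → x ∈ A → y ∈ˡ place d y l
  place-here (yes _) i = here refl
  place-here (no n) i = ⊥-elim (n i)

  around′⁺ : ∀ w l {u v} → Cons (w ∷ l) u v → v ∈ A → u ∈ˡ around′ w l
  around′⁺ w (x ∷ l) (inj₁ (inj₁ (refl , refl))) i = place⁺ (w ∈? A) (place-here (x ∈? A) i)
  around′⁺ w (x ∷ l) (inj₂ (inj₁ (refl , refl))) i = place-here (w ∈? A) i
  around′⁺ w (x ∷ l) (inj₁ (inj₂ n)) i = place⁺ (w ∈? A) (place⁺ (x ∈? A) (around′⁺ x l (inj₁ n) i))
  around′⁺ w (x ∷ l) (inj₂ (inj₂ n)) i = place⁺ (w ∈? A) (place⁺ (x ∈? A) (around′⁺ x l (inj₂ n) i))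

  around⁺ : ∀ l {u v} → Cons l u v → v ∈ A → u ∈ˡ around l
  around⁺ (w ∷ l) c i = around′⁺ w l c i
  around⁺ [] (inj₁ ())
  around⁺ [] (inj₂ ())

  place⁻ : ∀ {x} (d : Dec (x ∈ A)) {y l v} → v ∈ˡ place d y l → (v ≡ y × x ∈ A) ⊎ v ∈ˡ l
  place⁻ (yes p) (here e) = inj₁ (e , p)
  place⁻ (yes p) (there i) = inj₂ i
  place⁻ (no _) i = inj₂ i

  around′⁻ : ∀ w l {u} → u ∈ˡ around′ w l → ∃[ v ] (Cons (w ∷ l) u v × v ∈ A)
  around′⁻ w (x ∷ l) i with place⁻ (w ∈? A) i
  ... | inj₁ (refl , p) = w , inj₂ (inj₁ (refl , refl)) , p
  ... | inj₂ j with place⁻ (x ∈? A) j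
  ...   | inj₁ (refl , p) = x , inj₁ (inj₁ (refl , refl)) , p
  ...   | inj₂ k with around′⁻ x l k
  ...     | v , inj₁ c , p = v , inj₁ (inj₂ c) , p
  ...     | v , inj₂ c , p = v , inj₂ (inj₂ c) , p

  around⁻ : ∀ l {u} → u ∈ˡ around l → ∃[ v ] (Cons l u v × v ∈ A)
  around⁻ (w ∷ l) i = around′⁻ w l i

  length-around′ : ∀ w l → length (around′ w l) ≤ members (w ∷ l) + members l
  length-around′ w [] = z≤n
  length-around′ w (x ∷ l) with w ∈? A | x ∈? A | length-around′ x l
  ... | yes _ | yes p | h with x ∈? A
  ...   | yes _ = (lin91 {_} {members l}) h
  ...   | no q = ⊥-elim (q p)
  length-around′ w (x ∷ l) | yes _ | no p | h with x ∈? A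
  ...   | yes q = ⊥-elim (p q)
  ...   | no _ = (lin92 {_} {members l}) h
  length-around′ w (x ∷ l) | no _ | yes p | h with x ∈? A
  ...   | yes _ = (lin93 {_} {members l}) h
  ...   | no q = ⊥-elim (q p)
  length-around′ w (x ∷ l) | no _ | no p | h with x ∈? A
  ...   | yes q = ⊥-elim (p q)
  ...   | no _ = h

  members≤ : ∀ l → Unique l → members l ≤ # A
  members≤ l u = length≤# (Unique.filter⁺ (_∈? A) u) (All.all-filter (_∈? A) l)

  length-around : ∀ l → Unique l → length (around l) ≤ # A + # A
  length-around [] _ = z≤n
  length-around (w ∷ l) (h ∷ u) = ≤-trans (length-around′ w l) (+-mono-≤ (members≤ (w ∷ l) (h ∷ u)) (members≤ l u))

module Rotation {N : ℕ} (G : Graph N) where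
  open Basics G

  -- A step adds the edge from the first vertex `x` to `p` and drops the edge by which the path
  -- entered `p`; the other end of the dropped edge becomes the first vertex.
  data Rot (h : List V) : List V → Set where
    start : Rot h h
    step : ∀ x l p m → Rot h ((x ∷ l) ++ p ∷ m) → x ~ p → Rot h (reverse (x ∷ l) ++ p ∷ m)

  Rot-↭ : ∀ {h f} → Rot h f → f ↭ h
  Rot-↭ start = ↭-refl
  Rot-↭ (step x l p m R _) = ↭-trans (++⁺ʳ (p ∷ m) (↭-reverse (x ∷ l))) (Rot-↭ R)

  Rot-Lst : ∀ {h f} → Rot h f → ∀ {z} → Lst z h → Lst z f
  Rot-Lst start e = e
  Rot-Lst (step x l p m R _) e = Lst-++ (reverse (x ∷ l)) (Lst-++⁻ (x ∷ l) (Rot-Lst R e))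

  Rot-Ch : ∀ {h f} → Rot h f → Ch h → Ch f
  Rot-Ch start c = c
  Rot-Ch (step x l p m R e) c = subst Ch (sym eq)
      (Ch-++ (reverse l) x (subst Ch (unfold-reverse x l) (Ch-reverse (x ∷ l) (Ch-++ˡ (x ∷ l) c′)))
      (e , Ch-++ʳ (x ∷ l) c′))
    where
    c′ : Ch ((x ∷ l) ++ p ∷ m)
    c′ = Rot-Ch R c
    eq : reverse (x ∷ l) ++ p ∷ m ≡ reverse l ++ x ∷ p ∷ m
    eq = trans (cong (_++ p ∷ m) (unfold-reverse x l)) (++-assoc (reverse l) [ x ] (p ∷ m))

  Rot-∷ʳ : ∀ {h f} u → Rot h f → Rot (h ++ [ u ]) (f ++ [ u ])
  Rot-∷ʳ u start = start
  Rot-∷ʳ u (step x l p m R e) = subst (Rot _) (sym (++-assoc (reverse (x ∷ l)) (p ∷ m) [ u ]))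
    (step x l p (m ++ [ u ]) (subst (Rot _) (++-assoc (x ∷ l) (p ∷ m) [ u ]) (Rot-∷ʳ u R)) e)

  -- The field `closed` is Pósa's lemma for the set of first vertices of all rotations. Together
  -- with `length-around` it bounds `A` and its neighbours on `h` by 3|A|.
  record Closure (h : List V) : Set where
    field
      A : Sub N
      sound : ∀ {a} → a ∈ A → Σ[ f ∈ List V ] Rot h f × Hd a f
      complete : ∀ {a f} → Rot h f → Hd a f → a ∈ A
      closed : ∀ {a p} → a ∈ A → p ∈ˡ h → a ~ p → p ∈ A ⊎ p ∈ˡ around A h

    A⊆h : ∀ {a} → a ∈ A → a ∈ˡ h
    A⊆h {a} i with (x ∷ f) , R , refl ← sound i = ∈-resp-↭ (Rot-↭ R) (here refl)

  closure : ∀ h → (Closure h → ⊥) → ⊥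
  closure h k = do
    A , sound , max ← maximum Sound # N (λ A _ → #≤n A) ∅ (λ i → ⊥-elim (∅⁻ i))
    k (build A sound max)
    where
    Sound : Sub N → Set
    Sound A = ∀ {a} → a ∈ A → Σ[ f ∈ List V ] Rot h f × Hd a f
    module _ (A : Sub N) (sound : Sound A) (max : ∀ B → Sound B → # B ≤ # A) where
      complete : ∀ {a f} → Rot h f → Hd a f → a ∈ A
      complete {a} {f} R e with a ∈? A
      ... | yes i = i
      ... | no n = ⊥-elim ((lin94 {# (A ∪ ⁅ a ⁆)} {# A} {# (⁅ a ⁆)})
          (max (A ∪ ⁅ a ⁆) (λ i → case ∪⁻ i of λ { (inj₁ j) → sound j ; (inj₂ j) → f , R , subst (λ t → Hd t f)
              (sym (⁅⁆⁻ j)) e }))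
          (#-⊎ (λ i j → n (subst (_∈ A) (⁅⁆⁻ j) i))) (#-⁅⁆ a))
      -- Every edge of h at a vertex far from A survives all rotations.
      invariant : ∀ {u} → u ∉ A → (∀ {v} → Cons h u v → v ∉ A) → ∀ {f} → Rot h f → ∀ {v} → Cons f u v → Cons h u v
      invariant u∉ far start c = c
      invariant {u} u∉ far (step x l p m R e) {v} c = case c of λ
          { (inj₁ n) → forth (Next-++⁻ (reverse (x ∷ l)) n) ; (inj₂ n) → back (Next-++⁻ (reverse (x ∷ l)) n) }
        where
        ih : ∀ {v} → Cons ((x ∷ l) ++ p ∷ m) u v → Cons h u v
        ih = invariant u∉ far R
        x∈A : x ∈ A
        x∈A = complete R refl
        isx : ∀ {y} → Lst y (reverse (x ∷ l)) → y ≡ x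
        isx y = Lst-unique (reverse (x ∷ l)) y (Lst-reverse (x ∷ l) refl)
        forth : Next (reverse (x ∷ l)) u v ⊎ Next (p ∷ m) u v ⊎ (Lst u (reverse (x ∷ l)) × Hd v (p ∷ m)) → Cons h u v
        forth (inj₁ n) = ih (inj₂ (Next-++ˡ (x ∷ l) (Next-reverse⁻ (x ∷ l) n)))
        forth (inj₂ (inj₁ n)) = ih (inj₁ (Next-++ʳ (x ∷ l) n))
        forth (inj₂ (inj₂ (y , _))) = ⊥-elim (u∉ (subst (_∈ A) (sym (isx y)) x∈A))
        back : Next (reverse (x ∷ l)) v u ⊎ Next (p ∷ m) v u ⊎ (Lst v (reverse (x ∷ l)) × Hd u (p ∷ m)) → Cons h u v
        back (inj₁ n) = ih (inj₁ (Next-++ˡ (x ∷ l) (Next-reverse⁻ (x ∷ l) n)))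
        back (inj₂ (inj₁ n)) = ih (inj₂ (Next-++ʳ (x ∷ l) n))
        back (inj₂ (inj₂ (_ , refl))) with w , lw ← last-exists x l =
          ⊥-elim (far (ih (inj₂ (Next-mid (x ∷ l) lw refl)))
              (complete (step x l p m R e) (Hd-++ (reverse (x ∷ l)) (Hd-reverse (x ∷ l) lw))))
      closed : ∀ {a p} → a ∈ A → p ∈ˡ h → a ~ p → p ∈ A ⊎ p ∈ˡ around A h
      closed {a} {p} i p∈ e with p ∈? A | ∈-list? _≟_ p (around A h)
      ... | yes q | _ = inj₁ q
      ... | no _ | yes q = inj₂ q
      ... | no p∉ | no q with f , R , hd ← sound i = ⊥-elim (turn (∈-∃++ (∈-resp-↭ (↭-sym (Rot-↭ R)) p∈)))
        where
        far : ∀ {v} → Cons h p v → v ∉ A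
        far c v∈ = q (around⁺ A h c v∈)
        -- Rotating at `p` turns its predecessor in `f` into a first vertex. Since the edges at `p`
        -- have survived, that predecessor is also next to `p` on `h`.
        turn : (∃[ l ] ∃[ m ] f ≡ l ++ p ∷ m) → ⊥
        turn ([] , m , eq) = p∉ (subst (_∈ A) (subst (Hd a) eq hd) i)
        turn ((y ∷ l) , m , eq) with refl ← subst (Hd a) eq hd | w , lw ← last-exists y l =
          far (invariant p∉ far R′ (inj₂ (Next-mid (y ∷ l) lw refl)))
              (complete (step y l p m R′ e) (Hd-++ (reverse (y ∷ l)) (Hd-reverse (y ∷ l) lw)))
          where
          R′ : Rot h ((a ∷ l) ++ p ∷ m)
          R′ = subst (Rot h) eq R
      build : Closure h
      build = record { A = A ; sound = sound ; complete = complete ; closed = closed }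

-- A cycle on at least n vertices from a longest path.

module LongCycles {N : ℕ} (G : Graph N) where
  open Basics G
  open Rotation G

  Ch-join : ∀ f {z t} → Ch f → Lst z f → Ch (z ∷ t) → Ch (f ++ t)
  Ch-join f {z} {t} c lz ct with l , refl ← Lst⇒∷ʳ f lz = subst Ch (sym (++-assoc l [ z ] t)) (Ch-++ l z c ct)

  Ch-replace : ∀ h f {t} → 1 ≤ length h → Ch f → (∀ {z} → Lst z h → Lst z f) → Ch (h ++ t) → Ch (f ++ t)
  Ch-replace (y ∷ h′) f {t} _ c lst cP with h″ , z , e ← unsnoc y h′ =
    Ch-join f c (lst (subst (Lst z) (sym e) (Lst-∷ʳ h″ z)))
        (Ch-++ʳ h″ (subst Ch (trans (cong (_++ t) e) (++-assoc h″ [ z ] t)) cP))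

  Closure-positive : ∀ h → 1 ≤ length h → (C : Closure h) → 1 ≤ # (Closure.A C)
  Closure-positive (x ∷ h) _ C = ∈⇒1≤# (Closure.complete C start refl)

  module _ (Y : Sub N) (s n : ℕ) (1≤s : 1 ≤ s)
    (expand : ∀ U → U ⊆ Y → 1 ≤ # U → # U ≤ s → 4 * # U < # (N[ Y ] U))
    (large : ∀ U → U ⊆ Y → s < # U → n ≤ # (N[ Y ] U)) (nonempty : 1 ≤ # Y) where

    record PathIn (P : List V) : Set where
      field
        chain : Ch P
        unique : Unique P
        inside : All (_∈ Y) P
        positive : 1 ≤ length P

    LongCycle : Set
    LongCycle = Σ[ x ∈ V ] Σ[ r ∈ List V ] Unique (x ∷ r) × Ch (x ∷ r ++ [ x ]) × All (_∈ Y) (x ∷ r) × n ≤ length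
        (x ∷ r)

    module _ (P : List V) (pathP : PathIn P) (max : ∀ P′ → PathIn P′ → length P′ ≤ length P) where
      open PathIn pathP

      -- A prefix of the longest path whose rotated first vertices see nothing of the remainder. The
      -- whole path is one; a shortest one closes up to a cycle.
      record Split (h : List V) : Set where
        field
          t : List V
          eq : P ≡ h ++ t
          positive-h : 1 ≤ length h
          cl : Closure h
          quiet : ∀ {a v} → a ∈ Closure.A cl → v ∈ˡ t → ¬ (a ~ v)

      module _ (h : List V) (S : Split h) where
        open Split S
        open Closure cl

        Ch-h : Ch h
        Ch-h = Ch-++ˡ h (subst Ch eq chain)

        Unique-h : Unique h
        Unique-h = proj₁ (Unique-++⁻ h (subst Unique eq unique))

        h⊆Y : ∀ {v} → v ∈ˡ h → v ∈ Y
        h⊆Y i = All.lookup inside (subst (_ ∈ˡ_) (sym eq) (∈-++⁺ˡ i))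

        -- A neighbour of A outside P would extend a rotated path.
        nbr∈P : ∀ {a v} → a ∈ A → v ∈ Y → a ~ v → v ∈ˡ P
        nbr∈P {a} {v} a∈ v∈Y av with ∈-list? _≟_ v P
        ... | yes i = i
        ... | no v∉ with (x ∷ f) , R , refl ← sound a∈ = ⊥-elim ((lin95 {length P})
            (≤-trans (≤-reflexive (↭-length perm)) (max (v ∷ (x ∷ f) ++ t) record
              { chain = ~-sym av , joined ; unique = Unique-resp-↭ perm (All.tabulate (λ { i refl → v∉ i }) ∷ unique)
              ; inside = All-resp-↭ perm (v∈Y ∷ inside) ; positive = s≤s z≤n })))
          where
          perm : v ∷ P ↭ v ∷ (x ∷ f) ++ t
          perm = prep v (↭-trans (↭-reflexive eq) (++⁺ʳ t (↭-sym (Rot-↭ R))))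
          joined : Ch ((x ∷ f) ++ t)
          joined = Ch-replace h (x ∷ f) positive-h (Rot-Ch R Ch-h) (Rot-Lst R) (subst Ch eq chain)

        N⊆h : N[ Y ] A ⊆ set h
        N⊆h {v} i with N⁻ i
        ... | _ , inj₁ a = set⁺ (A⊆h a)
        ... | y , inj₂ (a , a∈ , e) with ∈-++⁻ h (subst (v ∈ˡ_) eq (nbr∈P a∈ y e))
        ...   | inj₁ j = set⁺ j
        ...   | inj₂ j = ⊥-elim (quiet a∈ j e)

        N⊆A : N[ Y ] A ⊆ A ∪ set (around A h)
        N⊆A {v} i with N⁻ i
        ... | _ , inj₁ a = ∪ˡ a
        ... | y , inj₂ (a , a∈ , e) with closed a∈ (set⁻ (N⊆h i)) e
        ...   | inj₁ j = ∪ˡ j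
        ...   | inj₂ j = ∪ʳ (set⁺ j)

        A-positive : 1 ≤ # A
        A-positive = Closure-positive h positive-h cl

        A⊆Y : A ⊆ Y
        A⊆Y i = h⊆Y (A⊆h i)

        N-small : # (N[ Y ] A) ≤ 3 * # A
        N-small = (lin96 {_} {_} {# A} {# (set (around A h))}) (#-mono N⊆A) (#-∪ _ _) (#-set≤ (around A h))
            (length-around A h Unique-h)

        A-large : s < # A
        A-large = ≰⇒> λ le → (lin97 {# A}) (expand A A⊆Y A-positive le) N-small

        length-h : n ≤ length h
        length-h = ≤-trans (large A A⊆Y A-large) (≤-trans (#-mono N⊆h) (≤-reflexive (#-set Unique-h)))

        two : 2 ≤ length h
        two = lin98 (#-mono (λ i → set⁺ (A⊆h i))) (#-set Unique-h) A-large 1≤s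

      -- The neighbours of the rotated ends lie in `h`, so Pósa's lemma allows only 3|A| of them.
      -- Expansion then forces |A| above `s`, and `h` has at least n vertices. Without its last
      -- vertex `u` a shortest `h` is no longer quiet. As rotations of the shorter prefix extend to
      -- `h`, only an edge to `u` can be the reason, and it closes a cycle through all of `h`.
      cycle : ∀ h → (S : Split h) → (∀ h′ → Split h′ → length h ≤ length h′) → (LongCycle → ⊥) → ⊥
      cycle [] S min k = case Split.positive-h S of λ ()
      cycle (y ∷ h₀) S min k with unsnoc y h₀
      ... | [] , u , refl = case two (u ∷ []) S of λ { (s≤s ()) }
      ... | (x ∷ h₁) , u , refl = do
          cl′ ← closure (x ∷ h₁)
          chord ← lem (∃[ a ] (a ∈ Closure.A cl′ × a ~ u))
          examine cl′ chord
        where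
        h : List V
        h = x ∷ h₁ ++ [ u ]
        module S = Split S
        module C = Closure S.cl
        examine : (cl′ : Closure (x ∷ h₁)) → (∃[ a ] (a ∈ Closure.A cl′ × a ~ u)) ⊎
            (¬ (∃[ a ] (a ∈ Closure.A cl′ × a ~ u))) → ⊥
        examine cl′ (inj₂ none) = (lin99 {_} {length h₁}) (length-++ h₁ {[ u ]}) (min (x ∷ h₁) record
          { t = u ∷ S.t ; eq = trans S.eq (++-assoc (x ∷ h₁) [ u ] S.t) ; positive-h = s≤s z≤n ; cl = cl′
          ; quiet = λ { a∈ (here refl) e → none (_ , a∈ , e)
                      ; a∈ (there i) e → let f , R , hd = Closure.sound cl′ a∈ in S.quiet (C.complete (Rot-∷ʳ u R) (Hd-++ f hd)) i e } })
        examine cl′ (inj₁ (a , a∈ , au)) with (a ∷ f) , R , refl ← Closure.sound cl′ a∈ = k (a , f ++ [ u ] ,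
            Unique-resp-↭ perm (Unique-h h S) ,
            Ch-join ((a ∷ f) ++ [ u ]) (Ch-join (a ∷ f) (Rot-Ch R (Ch-++ˡ (x ∷ h₁) (Ch-h h S)))
                (Rot-Lst R (subst (Lst z) (sym ez) (Lst-∷ʳ h₂ z))) z~u) (Lst-∷ʳ (a ∷ f) u) (~-sym au , tt) ,
            All-resp-↭ perm (All.tabulate (h⊆Y h S)) ,
            ≤-trans (length-h h S) (≤-reflexive (↭-length perm)))
          where
          perm : h ↭ (a ∷ f) ++ [ u ]
          perm = ++⁺ʳ [ u ] (↭-sym (Rot-↭ R))
          h₂ : List V
          h₂ = proj₁ (unsnoc x h₁)
          z : V
          z = proj₁ (proj₂ (unsnoc x h₁))
          ez : x ∷ h₁ ≡ h₂ ++ [ z ]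
          ez = proj₂ (proj₂ (unsnoc x h₁))
          z~u : Ch (z ∷ u ∷ [])
          z~u = Ch-++ʳ h₂ (subst Ch (trans (cong (_++ [ u ]) ez) (++-assoc h₂ [ z ] [ u ])) (Ch-h h S))

    long-cycle : (LongCycle → ⊥) → ⊥
    long-cycle k with y , y∈ ← pick {A = Y} nonempty = do
      P , pathP , max ← maximum PathIn length N
        (λ P p → ≤-trans (length≤# {A = full} (PathIn.unique p) (All.tabulate (λ _ → full⁺))) (#≤n full))
        [ y ] record { chain = tt ; unique = [] ∷ [] ; inside = y∈ ∷ [] ; positive = s≤s z≤n }
      cl ← closure P
      h , S , min ← minimum (Split P pathP max) length P record
        { t = [] ; eq = sym (++-identityʳ P) ; positive-h = PathIn.positive pathP ; cl = cl ; quiet = λ _ () }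
      cycle P pathP max h S min k

-- Shortening a cycle by a prescribed amount

module _ {n : ℕ} (T₁ T₂ : Sub n) where

  -- Cutting out s consecutive elements so that the elements before and after the gap avoid T₂ and T₁.
  find-cut : ∀ s (u : List (Fin n)) →
    (∀ l₁ b seg c l₂ → u ≡ (l₁ ++ [ b ]) ++ seg ++ c ∷ l₂ → length seg ≡ s → b ∉ T₂ → c ∉ T₁ → ⊥) →
    length u ≤ suc s + members T₂ u + members T₁ (drop (suc s) u)
  find-cut s [] none = z≤n
  find-cut s (a ∷ u) none = go (drop s u) refl
    where
    ih : length u ≤ suc s + members T₂ u + members T₁ (drop (suc s) u)
    ih = find-cut s u (λ l₁ b seg c l₂ e → none (a ∷ l₁) b seg c l₂ (cong (a ∷_) e))
    drop-suc : ∀ s (u : List (Fin n)) {b l} → drop s u ≡ b ∷ l → drop (suc s) u ≡ l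
    drop-suc zero (x ∷ u) refl = refl
    drop-suc (suc s) (x ∷ u) e = drop-suc s u e
    len-u : length u ≤ s + length (drop s u)
    len-u = ≤-trans (m≤n+m∸n (length u) s) (≤-reflexive (cong (s +_) (sym (length-drop s u))))
    go : ∀ d → drop s u ≡ d → suc (length u) ≤ suc s + members T₂ (a ∷ u) + members T₁ (drop s u)
    go [] e = (lin100 {_} {s} {length (drop s u)} {members T₂ (a ∷ u)} {members T₁ (drop s u)}) len-u (cong length e)
    go (b ∷ l₂) e rewrite e with a ∈? T₂ | b ∈? T₁
    ... | no p | no q = ⊥-elim (none [] a (take s u) b l₂
        (cong (a ∷_) (trans (sym (take++drop≡id s u)) (cong (take s u ++_) e))) len p q)
      where
      len : length (take s u) ≡ s
      len = trans (length-take s u) (m≤n⇒m⊓n≡m (≮⇒≥ (λ lt → case trans (sym e) (drop-all s u (<⇒≤ lt)) of λ ())))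
    ... | yes _ | yes _ = bump (members≡ e)
      where
      members≡ : drop s u ≡ b ∷ l₂ → members T₁ (drop (suc s) u) ≡ members T₁ l₂
      members≡ e′ = cong (members T₁) (drop-suc s u e′)
      bump : members T₁ (drop (suc s) u) ≡ members T₁ l₂ → suc (length u) ≤ suc s + suc (members T₂ u) + suc
          (members T₁ l₂)
      bump q = (lin101 {_} {s} {members T₂ u} {members T₁ (drop (suc s) u)} {members T₁ l₂}) ih q
    ... | yes _ | no _ = (lin102 {_} {s} {members T₂ u} {members T₁ (drop (suc s) u)} {members T₁ l₂}) ih
        (cong (members T₁) (drop-suc s u e))
    ... | no _ | yes _ = (lin103 {_} {s} {members T₂ u} {members T₁ (drop (suc s) u)} {members T₁ l₂}) ih
        (cong (members T₁) (drop-suc s u e))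

module Shorten {N : ℕ} (G : Graph N) (Y : Sub N) (s : ℕ) (1≤s : 1 ≤ s)
  (joined : ∀ A B → A ⊆ Y → B ⊆ Y → s ≤ # A → s ≤ # B → (∀ {x} → x ∈ A → x ∉ B) → Basics.Apart G A B → ⊥) where
  open Basics G
  open Rotation G
  open LongCycles G using (Ch-join)

  -- Sets of rotated end vertices are closed in this sense; the notion only depends on the list u ++ v,
  -- not on the place in u where it is cut.
  module Half (u v : List V) (unique : Unique (u ++ v)) (inside : All (_∈ Y) (u ++ v)) (long : 7 * s ≤ length v) where

    Closed : Sub N → Set
    Closed A = A ⊆ Y × (∀ {a p} → a ∈ A → p ∈ˡ v → a ~ p → p ∈ A ⊎ p ∈ˡ around A (u ++ v))

    Closed-∪ : ∀ {A B} → Closed A → Closed B → Closed (A ∪ B)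
    Closed-∪ {A} {B} (a , f) (b , g) = ∪-⊆ a b , λ i p∈ e → case ∪⁻ i of λ
      { (inj₁ j) → case f j p∈ e of λ { (inj₁ k) → inj₁ (∪ˡ k) ; (inj₂ k) → let w , c , q = around⁻ A (u ++ v) k in inj₂ (around⁺ (A ∪ B) (u ++ v) c (∪ˡ q)) }
      ; (inj₂ j) → case g j p∈ e of λ { (inj₁ k) → inj₁ (∪ʳ k) ; (inj₂ k) → let w , c , q = around⁻ B (u ++ v) k in inj₂ (around⁺ (A ∪ B) (u ++ v) c (∪ʳ q)) } }

    -- `C` and its neighbours along the path have fewer than 6s vertices. So s vertices of `v`
    -- remain that `C` does not see, contrary to `joined`; hence the length 7s.
    no-middle : ∀ {C} → Closed C → s ≤ # C → # C < s + s → ⊥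
    no-middle {C} (C⊆Y , cl) s≤ <2s = joined C R C⊆Y (λ i → All.lookup (All.++⁻ʳ u inside) (set⁻ (∖⊆ i))) s≤
      ((lin104 {# (set v)} {# (C ∪ set (around C (u ++ v)))} {# R} {# C} {# (set (around C (u ++ v)))} {_} {s})
        (#-∖ (set v) _) (#-∪ C _) (#-set≤ (around C (u ++ v))) (length-around C (u ++ v) unique) <2s
            (#-set (proj₁ (proj₂ (Unique-++⁻ u unique)))) long)
      (λ i j → proj₂ (∖⁻ j) (∪ˡ i))
      (λ i j e → case cl i (set⁻ (∖⊆ j)) e of λ
          { (inj₁ k) → proj₂ (∖⁻ j) (∪ˡ k) ; (inj₂ k) → proj₂ (∖⁻ j) (∪ʳ (set⁺ k)) })
      where
      R : Sub N
      R = set v ∖ (C ∪ set (around C (u ++ v)))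

    Ends : Sub N → Set
    Ends T₀ = # T₀ < s × (∀ p x q → u ≡ p ++ x ∷ q → x ∉ T₀ → (C : Closure ((x ∷ q) ++ v)) → s ≤ # (Closure.A C))

    -- `T₀` is a largest closed set of fewer than s vertices. A set of fewer than s rotated ends
    -- starting from some other `x` could be added: the union has fewer than 2s vertices, hence by
    -- `no-middle` fewer than s. Thus one small set of exceptions serves all cutting points.
    exceptional : (Σ[ T₀ ∈ Sub N ] Ends T₀ → ⊥) → ⊥
    exceptional k = do
      T₀ , (clT , T<s) , max ← maximum (λ T₀ → Closed T₀ × # T₀ < s) # N (λ A _ → #≤n A) ∅
          (((λ i → ⊥-elim (∅⁻ i)) , λ i → ⊥-elim (∅⁻ i)) , ≤-trans (s≤s (≤-reflexive #-∅)) 1≤s)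
      k (T₀ , T<s , λ p x q e x∉ C → ≮⇒≥ (λ A<s → contradiction′ T₀ clT T<s max p x q e x∉ C A<s))
      where
      contradiction′ : ∀ T₀ → Closed T₀ → # T₀ < s → (∀ A → Closed A × # A < s → # A ≤ # T₀) →
        ∀ p x q → u ≡ p ++ x ∷ q → x ∉ T₀ → (C : Closure ((x ∷ q) ++ v)) → # (Closure.A C) < s → ⊥
      contradiction′ T₀ clT T<s max p x q e x∉ C A<s = conclude (<-≤-connex (# U) s)
        where
        open Closure C
        U : Sub N
        U = A ∪ T₀
        whole : u ++ v ≡ p ++ (x ∷ q) ++ v
        whole = trans (cong (_++ v) e) (++-assoc p (x ∷ q) v)
        wider : ∀ {a b} → Cons ((x ∷ q) ++ v) a b → Cons (u ++ v) a b
        wider (inj₁ c) = inj₁ (subst (λ t → Next t _ _) (sym whole) (Next-++ʳ p c))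
        wider (inj₂ c) = inj₂ (subst (λ t → Next t _ _) (sym whole) (Next-++ʳ p c))
        clA : Closed A
        clA = (λ i → All.lookup inside (subst (_ ∈ˡ_) (sym whole) (∈-++⁺ʳ p (A⊆h i)))) ,
          λ i p∈ ed → case closed i (∈-++⁺ʳ (x ∷ q) p∈) ed of λ
            { (inj₁ j) → inj₁ j ; (inj₂ j) → let w , c , w∈ = around⁻ A ((x ∷ q) ++ v) j in inj₂ (around⁺ A (u ++ v) (wider c) w∈) }
        clU : Closed U
        clU = Closed-∪ clA clT
        U<2s : # U < s + s
        U<2s = (lin105 {_} {# A} {# T₀} {s}) (#-∪ A T₀) A<s T<s
        conclude : # U < s ⊎ s ≤ # U → ⊥
        conclude (inj₂ ge) = no-middle clU ge U<2s
        conclude (inj₁ lt) = (lin14 {# U} {# T₀} {# (U ∖ T₀)}) (max U (clU , lt)) (#-∖⊆ {A = U} {T₀} ∪ʳ)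
          (∈⇒1≤# {A = U ∖ T₀} (∖⁺ (∪ˡ (complete start refl)) x∉))

  -- Both ends of the path left after cutting can be rotated inside disjoint halves.
  two-ends : ∀ h₁ h₂ {n} → NoCycle n → Ch (h₁ ++ reverse h₂) → Unique (h₁ ++ reverse h₂) → All (_∈ Y)
      (h₁ ++ reverse h₂) → length (h₁ ++ reverse h₂) ≡ n →
    1 ≤ length h₁ → 1 ≤ length h₂ → (C₁ : Closure h₁) (C₂ : Closure h₂) → s ≤ # (Closure.A C₁) → s ≤ # (Closure.A C₂)
        → ⊥
  two-ends [] h₂ _ _ _ _ _ () _
  two-ends (_ ∷ _) [] _ _ _ _ _ _ ()
  two-ends h₁@(y₁ ∷ g₁) h₂@(y₂ ∷ g₂) {n} noC ch uq ins len _ _ C₁ C₂ s≤₁ s≤₂ =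
    joined C₁.A C₂.A (λ i → All.lookup ins (∈-++⁺ˡ (C₁.A⊆h i))) (λ i → All.lookup ins (∈-++⁺ʳ h₁ (rev∈ (C₂.A⊆h i))))
        s≤₁ s≤₂
      (λ i j → proj₂ (proj₂ (Unique-++⁻ h₁ uq)) (C₁.A⊆h i) (rev∈ (C₂.A⊆h j))) edge
    where
    module C₁ = Closure C₁
    module C₂ = Closure C₂
    rev∈ : ∀ {v} → v ∈ˡ h₂ → v ∈ˡ reverse h₂
    rev∈ = ∈-resp-↭ (↭-sym (↭-reverse h₂))
    edge : Apart C₁.A C₂.A
    edge {a} {b} i j ab with C₁.sound i | C₂.sound j | last-exists y₁ g₁ | last-exists y₂ g₂
    ... | (a ∷ f₁) , R₁ , refl | (b ∷ f₂) , R₂ , refl | z₁ , l₁ | z₂ , l₂ =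
      noC a (f₁ ++ reverse (b ∷ f₂)) (Unique-resp-↭ perm uq) closedCh (trans (sym (↭-length perm)) len)
      where
      perm : h₁ ++ reverse h₂ ↭ (a ∷ f₁) ++ reverse (b ∷ f₂)
      perm = ++⁺ (↭-sym (Rot-↭ R₁)) (↭-trans (↭-reverse h₂) (↭-trans (↭-sym (Rot-↭ R₂)) (↭-sym (↭-reverse (b ∷ f₂)))))
      Ch₁ : Ch (a ∷ f₁)
      Ch₁ = Rot-Ch R₁ (Ch-++ˡ h₁ ch)
      Ch₂ : Ch (b ∷ f₂)
      Ch₂ = Rot-Ch R₂ (subst Ch (reverse-involutive h₂) (Ch-reverse (reverse h₂) (Ch-++ʳ h₁ ch)))
      Ch₃ : Ch (reverse (b ∷ f₂) ++ [ a ])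
      Ch₃ = Ch-join (reverse (b ∷ f₂)) (Ch-reverse (b ∷ f₂) Ch₂) (Lst-reverse (b ∷ f₂) refl) (~-sym ab , tt)
      z₁~z₂ : z₁ ~ z₂
      z₁~z₂ = bridge h₁ (reverse h₂) ch l₁ (Hd-reverse h₂ l₂)
        where
        bridge : ∀ l m → Ch (l ++ m) → Lst z₁ l → Hd z₂ m → z₁ ~ z₂
        bridge (x ∷ []) (y ∷ m) (e , _) refl refl = e
        bridge (x ∷ x′ ∷ l) m (_ , c) p q = bridge (x′ ∷ l) m c p q
      Ch₄ : Ch (z₁ ∷ reverse (b ∷ f₂) ++ [ a ])
      Ch₄ = cons (reverse (b ∷ f₂) ++ [ a ]) (Hd-++ (reverse (b ∷ f₂)) (Hd-reverse (b ∷ f₂) (Rot-Lst R₂ l₂))) Ch₃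
        where
        cons : ∀ l → Hd z₂ l → Ch l → Ch (z₁ ∷ l)
        cons (x ∷ l) refl c = z₁~z₂ , c
      closedCh : Ch (a ∷ (f₁ ++ reverse (b ∷ f₂)) ++ [ a ])
      closedCh = subst Ch (sym (++-assoc (a ∷ f₁) (reverse (b ∷ f₂)) [ a ]))
          (Ch-join (a ∷ f₁) Ch₁ (Rot-Lst R₁ l₁) Ch₄)

  reverse₃ : ∀ (l₁ seg l₂ : List V) → reverse (l₁ ++ seg ++ l₂) ≡ reverse l₂ ++ reverse seg ++ reverse l₁
  reverse₃ l₁ seg l₂ = trans (reverse-++ l₁ (seg ++ l₂))
      (trans (cong (_++ reverse l₁) (reverse-++ seg l₂)) (++-assoc (reverse l₂) (reverse seg) (reverse l₁)))

  -- Cutting `g` vertices out of `u` leaves a path on n vertices. Its first end rotates with the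
  -- help of `v₁`, its other end, read backwards, with the help of `v₂`. The exceptions for the two
  -- directions block fewer than 2s positions of `u`, so an admissible cut exists.
  shorten : ∀ u v₁ v₂ {n} g → NoCycle n → Unique (u ++ v₁ ++ v₂) → All (_∈ Y) (u ++ v₁ ++ v₂) →
    Ch (u ++ v₁ ++ v₂) → (∀ {x y} → Hd x u → Lst y v₂ → y ~ x) →
    7 * s ≤ length v₁ → 7 * s ≤ length v₂ → length (u ++ v₁ ++ v₂) ≡ g + n → suc g + (s + s) < length u → ⊥
  shorten u v₁ v₂ {n} g noC uq ins ch cyc long₁ long₂ len enough = do
      T₁ , T₁<s , ends₁ ← Half.exceptional u v₁ uq₁ ins₁ long₁
      T₂ , T₂<s , ends₂ ← Half.exceptional (reverse u) (reverse v₂) uq₂ ins₂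
          (≤-trans long₂ (≤-reflexive (sym (length-reverse v₂))))
      final T₁ T₁<s ends₁ T₂ T₂<s ends₂
    where
    uv₁ : u ++ v₁ ++ v₂ ≡ (u ++ v₁) ++ v₂
    uv₁ = sym (++-assoc u v₁ v₂)
    uq₁ : Unique (u ++ v₁)
    uq₁ = proj₁ (Unique-++⁻ (u ++ v₁) (subst Unique uv₁ uq))
    ins₁ : All (_∈ Y) (u ++ v₁)
    ins₁ = All.++⁻ˡ (u ++ v₁) (subst (All (_∈ Y)) uv₁ ins)
    perm₂ : u ++ v₁ ++ v₂ ↭ v₁ ++ (reverse u ++ reverse v₂)
    perm₂ = ↭-trans (↭-reflexive uv₁) (↭-trans (++⁺ʳ v₂ (++-comm u v₁))
        (↭-trans (↭-reflexive (++-assoc v₁ u v₂)) (++⁺ˡ v₁ (++⁺ (↭-sym (↭-reverse u)) (↭-sym (↭-reverse v₂))))))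
    uq₂ : Unique (reverse u ++ reverse v₂)
    uq₂ = proj₁ (proj₂ (Unique-++⁻ v₁ (Unique-resp-↭ perm₂ uq)))
    ins₂ : All (_∈ Y) (reverse u ++ reverse v₂)
    ins₂ = All.++⁻ʳ v₁ (All-resp-↭ perm₂ ins)
    final : ∀ T₁ → # T₁ < s → (∀ p x q → u ≡ p ++ x ∷ q → x ∉ T₁ → (C : Closure ((x ∷ q) ++ v₁)) → s ≤ #
        (Closure.A C)) →
      ∀ T₂ → # T₂ < s → (∀ p x q → reverse u ≡ p ++ x ∷ q → x ∉ T₂ → (C : Closure ((x ∷ q) ++ reverse v₂)) → s ≤ #
          (Closure.A C)) → ⊥
    final T₁ T₁<s ends₁ T₂ T₂<s ends₂ = (lin106 {length u} {g} {members T₂ u} {members T₁ (drop (suc g) u)} {_} {s})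
      (find-cut T₁ T₂ g u cut) (members≤ T₂ u uqu) T₂<s
          (members≤ T₁ (drop (suc g) u) (proj₁ (proj₂
          (Unique-++⁻ (take (suc g) u) (subst Unique (sym (take++drop≡id (suc g) u)) uqu))))) T₁<s enough
      where
      uqu : Unique u
      uqu = proj₁ (Unique-++⁻ u uq)
      cut : ∀ l₁ b seg c l₂ → u ≡ (l₁ ++ [ b ]) ++ seg ++ c ∷ l₂ → length seg ≡ g → b ∉ T₂ → c ∉ T₁ → ⊥
      cut l₁ b seg c l₂ e lseg b∉ c∉ = do
          C₁ ← closure ((c ∷ l₂) ++ v₁)
          C₂ ← closure ((b ∷ reverse l₁) ++ reverse v₂)
          two-ends ((c ∷ l₂) ++ v₁) ((b ∷ reverse l₁) ++ reverse v₂) noC chP uqP insP lenP (s≤s z≤n) (s≤s z≤n) C₁ C₂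
            (ends₁ ((l₁ ++ [ b ]) ++ seg) c l₂ (trans e (sym (++-assoc (l₁ ++ [ b ]) seg (c ∷ l₂)))) c∉ C₁)
            (ends₂ (reverse (c ∷ l₂) ++ reverse seg) b (reverse l₁)
                (trans (cong reverse e) (trans (reverse₃ (l₁ ++ [ b ]) seg (c ∷ l₂))
                (trans (sym (++-assoc (reverse (c ∷ l₂)) (reverse seg) (reverse (l₁ ++ [ b ]))))
                (cong ((reverse (c ∷ l₂) ++ reverse seg) ++_) (reverse-∷ʳ l₁ b))))) b∉ C₂)
        where
        left : List V
        left = l₁ ++ [ b ]
        right : List V
        right = (c ∷ l₂) ++ v₁
        rev : reverse ((b ∷ reverse l₁) ++ reverse v₂) ≡ v₂ ++ left
        rev = trans (reverse-++ (b ∷ reverse l₁) (reverse v₂))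
            (cong₂ _++_ (reverse-involutive v₂) (trans (unfold-reverse b (reverse l₁))
            (cong (_++ [ b ]) (reverse-involutive l₁))))
        P : List V
        P = right ++ reverse ((b ∷ reverse l₁) ++ reverse v₂)
        P≡ : P ≡ right ++ (v₂ ++ left)
        P≡ = cong (right ++_) rev
        o≡ : u ++ v₁ ++ v₂ ≡ left ++ seg ++ (right ++ v₂)
        o≡ = trans (cong (_++ v₁ ++ v₂) e) (trans (++-assoc left (seg ++ c ∷ l₂) (v₁ ++ v₂))
            (cong (left ++_) (trans (++-assoc seg (c ∷ l₂) (v₁ ++ v₂))
            (cong (seg ++_) (sym (++-assoc (c ∷ l₂) v₁ v₂))))))
        perm : u ++ v₁ ++ v₂ ↭ seg ++ P
        perm = ↭-trans (↭-reflexive o≡) (↭-trans (++-comm left (seg ++ (right ++ v₂)))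
          (↭-trans (↭-reflexive (trans (++-assoc seg (right ++ v₂) left)
              (cong (seg ++_) (trans (++-assoc right v₂ left) (sym P≡))))) ↭-refl))
        uqP : Unique P
        uqP = proj₁ (proj₂ (Unique-++⁻ seg (Unique-resp-↭ perm uq)))
        insP : All (_∈ Y) P
        insP = All.++⁻ʳ seg (All-resp-↭ perm ins)
        lenP : length P ≡ n
        lenP = (lin107 {_} {g} {n} {_} {length seg} {length P}) len (↭-length perm) (length-++ seg) lseg
        chR : Ch (right ++ v₂)
        chR = Ch-++ʳ seg (Ch-++ʳ left (subst Ch o≡ ch))
        chL : Ch left
        chL = Ch-++ˡ left (subst Ch o≡ ch)
        chP : Ch P
        chP = subst Ch (sym (trans P≡ (sym (++-assoc right v₂ left)))) (wrap v₂ refl)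
          where
          head-exists : ∀ l → ∃[ x ] Hd x (l ++ [ b ])
          head-exists [] = b , refl
          head-exists (x ∷ _) = x , refl
          wrap : ∀ w → w ≡ v₂ → Ch ((right ++ w) ++ left)
          wrap [] eq = ⊥-elim ((lin108 {s}) long₂ (cong length eq) 1≤s)
          wrap (w ∷ ws) refl with y , ly ← last-exists w ws | x , hx ← head-exists l₁ =
            Ch-join (right ++ w ∷ ws) chR (Lst-++ right ly) (cons left hx chL)
            where
            cons : ∀ l → Hd x l → Ch l → Ch (y ∷ l)
            cons (_ ∷ l) refl cl = cyc (subst (Hd x) (sym e) (Hd-++ left hx)) ly , cl

-- The case of a region not much larger than n.

module Tight {N : ℕ} (G : Graph N) (X W : Sub N) (K φ n : ℕ) (1≤K : 1 ≤ K) (W⊆X : W ⊆ X)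
  (E : ∀ A → A ⊆ X → K ≤ # A → n ≤ # (Basics.N[_]_ G X A))
  (J : ∀ A B → A ⊆ X → B ⊆ X → K ≤ # A → K ≤ # B → (∀ {x} → x ∈ A → x ∉ B) → Basics.Apart G A B → n + n ≤ suc
      (# (Basics.N[_]_ G X A ∪ Basics.N[_]_ G X B)))
  (noC : Basics.NoCycle G n) (boundary : # (Basics.N[_]_ G X W) ≤ # W + φ) (K≤W : K ≤ # W) (W< : # W < n + (K + φ)) (big : 50 * (K + φ) ≤ n) where
  open Basics G

  -- Vertices of `W` keep all their neighbours in `X`, so the bound `E` carries over without loss.
  -- The cycle must have at least n vertices, and nothing could make up for a deficit of φ.
  Ŵ : Sub N
  Ŵ = N[ X ] W

  s : ℕ
  s = K + φ

  1≤s : 1 ≤ s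
  1≤s = ≤-trans 1≤K (m≤m+n K φ)

  W⊆Ŵ : W ⊆ Ŵ
  W⊆Ŵ i = N-self (W⊆X i) i

  #Ŵ : # Ŵ ≡ # W + # (Ŵ ∖ W)
  #Ŵ = #-∖⊆ W⊆Ŵ

  core : ∀ {A} → A ⊆ Ŵ → # A ≤ # (A ∩ W) + φ
  core {A} A⊆ = (lin109 {_} {# (A ∩ W)} {# (A ∖ W)} {# (Ŵ ∖ W)} {_} {# W} {φ})
    (#-split A W) (#-mono (λ i → ∖⁺ (A⊆ (∖⊆ i)) (proj₂ (∖⁻ i)))) #Ŵ boundary

  core-large : ∀ {A} → A ⊆ Ŵ → s ≤ # A → K ≤ # (A ∩ W)
  core-large {A} A⊆ le = (lin110 {_} {# (A ∩ W)} {φ} {K}) (core A⊆) le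

  joined : ∀ A B → A ⊆ Ŵ → B ⊆ Ŵ → s ≤ # A → s ≤ # B → (∀ {x} → x ∈ A → x ∉ B) → Apart A B → ⊥
  joined A B A⊆ B⊆ s≤A s≤B disj ap = (lin111 {n} {_} {_} {# W} {φ} {K})
    (J (A ∩ W) (B ∩ W) (W⊆X ∘ ∩⊆ʳ) (W⊆X ∘ ∩⊆ʳ) (core-large A⊆ s≤A) (core-large B⊆ s≤B) (λ i j → disj (∩⊆ˡ i) (∩⊆ˡ j))
        (λ i j → ap (∩⊆ˡ i) (∩⊆ˡ j)))
    (#-mono (∪-⊆ (N-mono id ∩⊆ʳ) (N-mono id ∩⊆ʳ))) boundary W< big

  N-large : ∀ {U} → U ⊆ Ŵ → s ≤ # U → n ≤ # (N[ Ŵ ] U)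
  N-large {U} U⊆ le = ≤-trans (E (U ∩ W) (W⊆X ∘ ∩⊆ʳ) (core-large U⊆ le))
      (#-mono (λ i → N⁺ (N-mono id ∩⊆ʳ i) (proj₂ (N⁻ (N-mono id ∩⊆ˡ i)))))

  -- Here 4|U| < 48s, whereas 50s ≤ n.
  mid : ∀ U → U ⊆ Ŵ → 6 * s ≤ # U → # U < 6 * s + 6 * s → 4 * # U < # (N[ Ŵ ] U)
  mid U U⊆ le lt = (lin112 {_} {_} {# U} {K} {φ}) (N-large U⊆ (≤-trans (m≤m+n s (5 * s)) le)) lt big

  module _ (B : Sub N) (B⊆ : B ⊆ Ŵ) (B<6s : # B < 6 * s) (NB : # (N[ Ŵ ] B) ≤ 4 * # B)
    (expand : ∀ U → U ⊆ Ŵ ∖ B → 1 ≤ # U → # U ≤ 6 * s → 4 * # U < # (N[ Ŵ ∖ B ] U)) where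

    Y : Sub N
    Y = Ŵ ∖ B

    B<s : # B < s
    B<s = ≰⇒> λ le → (lin113 {_} {_} {# B} {K} {φ}) (N-large B⊆ le) NB B<6s big

    -- The vertices of U that are not adjacent to B keep all their neighbours in Y.
    large : ∀ U → U ⊆ Y → 6 * s < # U → n ≤ # (N[ Y ] U)
    -- At most φ vertices of `U` lie outside `W` and fewer than 4s are in the closed neighbourhood
    -- of `B`; out of more than 6s, at least K remain.
    large U U⊆ lt = ≤-trans (E C (W⊆X ∘ ∩⊆ʳ ∘ ∖⊆)
        ((lin114 {# U} {# (U ∩ W)} {φ} {K} {# (N[ Ŵ ] B)} {# C} {# B}) (core (∖⊆ ∘ U⊆)) lt (#-∖ (U ∩ W) (N[ Ŵ ] B)) NB
        B<s)) (#-mono sees)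
      where
      C : Sub N
      C = (U ∩ W) ∖ N[ Ŵ ] B
      sees : N[ X ] C ⊆ N[ Y ] U
      sees {x} i with N⁻ i
      ... | x∈ , inj₁ c = N-self (U⊆ (∩⊆ˡ (∖⊆ c))) (∩⊆ˡ (∖⊆ c))
      ... | x∈ , inj₂ (c , c∈ , e) = N-adj (∖⁺ (N-adj x∈ (∩⊆ʳ (∖⊆ c∈)) e)
          (λ b → proj₂ (∖⁻ c∈) (N-adj (W⊆Ŵ (∩⊆ʳ (∖⊆ c∈))) b (~-sym e)))) (∩⊆ˡ (∖⊆ c∈)) e

    Y-nonempty : 1 ≤ # Y
    Y-nonempty = (lin115 {_} {_} {# B} {# Y} {K} {φ}) (E W W⊆X K≤W) (#-∖ Ŵ B) B<s big

    use-cycle : LongCycles.LongCycle G Y (6 * s) n (≤-trans 1≤s (m≤m+n s (5 * s))) expand large Y-nonempty → ⊥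
    use-cycle (x , r , uq , ch , ins , n≤) = Shorten.shorten G Ŵ s 1≤s joined u v₁ v₂ g noC (subst Unique (sym o≡) uq)
        (subst (All (_∈ Ŵ)) (sym o≡) (All.map ∖⊆ ins))
        (subst Ch (sym o≡) (Ch-++ˡ (x ∷ r) ch)) cyc (≤-reflexive (sym len-v₁)) long-v₂
            (trans (cong length o≡) (trans (sym (m+[n∸m]≡n n≤)) (+-comm n g))) (≤-reflexive (sym len-u))
      where
      o : List V
      o = x ∷ r
      g a : ℕ
      g = length o ∸ n
      -- Space for the `g` vertices to be cut and for the positions blocked by exceptions; the rest
      -- is long enough for two pieces of 7s vertices.
      a = suc (suc g + (s + s))
      u v₁ v₂ : List V
      u = take a o
      v₁ = take (7 * s) (drop a o)
      v₂ = drop (7 * s) (drop a o)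
      o≡ : u ++ v₁ ++ v₂ ≡ o
      o≡ = trans (cong (u ++_) (take++drop≡id (7 * s) (drop a o))) (take++drop≡id a o)
      len-o : length o ≡ n + g
      len-o = sym (m+[n∸m]≡n n≤)
      len-u : length u ≡ a
      len-u = trans (length-take a o) (m≤n⇒m⊓n≡m ((lin116 {_} {n} {g} {K} {φ}) len-o big 1≤K))
      rest : 7 * s + 7 * s ≤ length (drop a o)
      rest = (lin117 {_} {n} {g} {K} {φ} {a} {length (drop a o)}) len-o big 1≤K
        (≤-trans (m≤n+m∸n (length o) a) (≤-reflexive (cong (a +_) (sym (length-drop a o))))) refl
      len-v₁ : length v₁ ≡ 7 * s
      len-v₁ = trans (length-take (7 * s) (drop a o)) (m≤n⇒m⊓n≡m (≤-trans (m≤m+n (7 * s) (7 * s)) rest))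
      long-v₂ : 7 * s ≤ length v₂
      long-v₂ = ≤-trans (≤-reflexive (sym (m+n∸m≡n (7 * s) (7 * s))))
          (≤-trans (∸-monoˡ-≤ (7 * s) rest) (≤-reflexive (sym (length-drop (7 * s) (drop a o)))))
      cyc : ∀ {x′ y} → Hd x′ u → Lst y v₂ → y ~ x′
      cyc {x′} {y} hx ly with refl ← subst (Hd x′) o≡ (Hd-++ u {v₁ ++ v₂} hx) = bridge o ch
          (subst (Lst y) (trans (++-assoc u v₁ v₂) o≡) (last-++ (u ++ v₁) v₂ ly))
        where
        last-++ : ∀ (l m : List V) → Lst y m → Lst y (l ++ m)
        last-++ l (_ ∷ _) p = Lst-++ l p
        bridge : ∀ l → Ch (l ++ [ x ]) → Lst y l → y ~ x
        bridge (_ ∷ []) (e , _) refl = e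
        bridge (_ ∷ b ∷ l) (_ , c) p = bridge (b ∷ l) c p

  tight : ⊥
  tight = do
    B , B⊆ , B< , NB , expand ← Cleaning.clean G {Ŵ} (6 * s) (≤-trans 1≤s (m≤m+n s (5 * s))) mid
    LongCycles.long-cycle G (Y B B⊆ B< NB expand) (6 * s) n (≤-trans 1≤s (m≤m+n s (5 * s))) expand
        (large B B⊆ B< NB expand) (Y-nonempty B B⊆ B< NB expand) (use-cycle B B⊆ B< NB expand)

-- Expanding regions with small boundary.

module Regions {N : ℕ} (G : Graph N) (X : Sub N) (K τ n : ℕ)
  (E : ∀ A → A ⊆ X → K ≤ # A → n ≤ # (Basics.N[_]_ G X A)) where
  open Basics G

  record Region (φ : ℕ) : Set where
    field
      W : Sub N
      W⊆X : W ⊆ X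
      K≤W : K ≤ # W
      boundary : # (N[ X ] W) ≤ # W + φ
      expands : ∀ A → A ⊆ W → K ≤ # A → # A + # A ≤ # W → # A + τ ≤ # (N[ W ] A)

  -- A set with small boundary in W is at most half as large; its boundary in X grows by at most τ.
  region : ∀ L b W → W ⊆ X → K ≤ # W → # W ≤ 2 ^ L * n → # (N[ X ] W) ≤ # W + b → n + (b + τ) + (b + τ) + L * (τ + τ)
      < n + n →
    (Region (b + L * τ) → ⊥) → ⊥
  region L b W W⊆X K≤W size bd room k = do
      d ← lem (Σ[ A ∈ Sub N ] (A ⊆ W × K ≤ # A × # A + # A ≤ # W × # (N[ W ] A) < # A + τ))
      split d
    where
    boundary-A : ∀ A → A ⊆ W → # (N[ W ] A) < # A + τ → # (N[ X ] A) ≤ # A + (b + τ)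
    boundary-A A A⊆W small = (lin118 {_} {_} {# (N[ W ] A)} {# (N[ X ] W ∖ W)} {# A} {τ} {_} {# W} {b})
      (#-mono cover) (#-∪ (N[ W ] A) (N[ X ] W ∖ W)) small (#-∖⊆ (λ i → N-self (W⊆X i) i)) bd
      where
      cover : N[ X ] A ⊆ N[ W ] A ∪ (N[ X ] W ∖ W)
      cover {x} i with x ∈? W
      ... | yes w = ∪ˡ (N⁺ w (proj₂ (N⁻ i)))
      ... | no x∉ = ∪ʳ (∖⁺ (N-mono id A⊆W i) x∉)
    split : (Σ[ A ∈ Sub N ] (A ⊆ W × K ≤ # A × # A + # A ≤ # W × # (N[ W ] A) < # A + τ)) ⊎
        (¬ (Σ[ A ∈ Sub N ] (A ⊆ W × K ≤ # A × # A + # A ≤ # W × # (N[ W ] A) < # A + τ))) → ⊥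
    split (inj₂ none) = k record { W = W ; W⊆X = W⊆X ; K≤W = K≤W ; boundary = (lin119 {_} {# W} {b} {L * τ}) bd
      ; expands = λ A A⊆ K≤ half → ≮⇒≥ (λ lt → none (A , A⊆ , K≤ , half , lt)) }
    split (inj₁ (A , A⊆W , K≤A , half , small)) = descend L size room k
      where
      A⊆X : A ⊆ X
      A⊆X = W⊆X ∘ A⊆W
      descend : ∀ L → # W ≤ 2 ^ L * n → n + (b + τ) + (b + τ) + L * (τ + τ) < n + n → (Region (b + L * τ) → ⊥) → ⊥
      -- Now 2|A| ≤ n, while `E` gives `A` at least n - b - τ vertices.
      descend zero size room k = (lin120 {n} {_} {# A} {b} {τ}) (E A A⊆X K≤A) (boundary-A A A⊆W small) half size room
      descend (suc L) size room k = region L (b + τ) A A⊆X K≤A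
        ((lin121 {# A} {_} {_} {2 ^ L * n}) half size
            (trans (*-assoc 2 (2 ^ L) n) (cong (2 ^ L * n +_) (+-identityʳ (2 ^ L * n)))))
        (boundary-A A A⊆W small)
        ((lin122 {n} {b} {τ} {L * (τ + τ)}) room)
        (λ R → k (subst Region ((lin123 {b} {τ} {L * τ})) R))

-- The two cases combined.

module Main {N : ℕ} (G : Graph N) (X : Sub N) (K h L t z β τ n : ℕ) (ms : List ℕ) (1≤K : 1 ≤ K)
  (E : ∀ A → A ⊆ X → K ≤ # A → n ≤ # (Basics.N[_]_ G X A))
  (J : ∀ A B → A ⊆ X → B ⊆ X → K ≤ # A → K ≤ # B → (∀ {x} → x ∈ A → x ∉ B) → Basics.Apart G A B → n + n ≤ suc
      (# (Basics.N[_]_ G X A ∪ Basics.N[_]_ G X B)))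
  (noHole : Basics.Hole G ms X → ⊥) (noC : Basics.NoCycle G n)
  (sum≤K : sum ms ≤ K) (ms≤ : length ms ≤ 2 ^ L) (Small : All (λ m → ⌈log₂ m ⌉ ≤ h × m ≤ 2 ^ ⌈log₂ m ⌉) ms)
  (1≤L : 1 ≤ L) (z≡ : 2 + (h + h) * suc ((h + suc L) + (h + suc L)) + t * suc ((h + suc L) + (h + suc L)) ≡ z)
  (cost≤ : z + suc (cost h L ms) ≤ β) (z≤β : z + 3 * K ≤ β) (β≤τ : β + 6 * K ≤ τ)
      (window : K + K ≤ (h + h) + t * suc (h + h))
  (big : 50 * (K + L * τ) ≤ n) (K≤X : K ≤ # X) (X≤ : # X ≤ 2 ^ L * n) where
  open Basics G
  open Regions G X K τ n E

  φ : ℕ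
  φ = L * τ

  τ≤φ : τ ≤ φ
  τ≤φ = ≤-trans (≤-reflexive (sym (*-identityˡ τ))) (*-monoˡ-≤ τ 1≤L)

  contradict : Region (L * τ) → ⊥
  contradict R with <-≤-connex (# (Region.W R)) (n + (K + φ))
  ... | inj₁ lt = Tight.tight G X W K φ n 1≤K W⊆X E J noC boundary K≤W lt big
    where open Region R
  -- Two non-adjacent sets see 2n - 1 vertices of `X`, at most φ of them outside `W`; what exceeds n
  -- is n - 1 - φ.
  ... | inj₂ ge = Slack.slack G W K h L t β τ n (n ∸ suc φ) ms 1≤K expands J′
      (λ S S⊆ H → noHole (Hole-mono ms (W⊆X ∘ S⊆) H)) noC sum≤K ms≤ Small
      z z≡ (≤-trans 1≤L (m≤m+n L h)) cost≤ z≤β β≤τ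
      ((lin124 {n} {K} {φ} {_} {z} {β} {τ}) ge z≤β β≤τ τ≤φ)
      ((lin125 {φ} {_} {n} {z} {K} {β} {τ}) φ<n z≤β β≤τ τ≤φ big 1≤K) window
      ((lin126 {z} {K} {β} {τ} {φ} {n}) z≤β β≤τ τ≤φ big)
    where
    open Region R
    φ<n : suc φ + (n ∸ suc φ) ≡ n
    φ<n = m+[n∸m]≡n ((lin127 {K} {φ}) big 1≤K)
    J′ : ∀ A B → A ⊆ W → B ⊆ W → K ≤ # A → K ≤ # B → (∀ {x} → x ∈ A → x ∉ B) → Apart A B → n + (n ∸ suc φ) ≤ #
        (N[ W ] A ∪ N[ W ] B)
    J′ A B A⊆ B⊆ K≤A K≤B disj ap = (lin128 {n} {# (N[ X ] A ∪ N[ X ] B)} {_} {# (N[ W ] A ∪ N[ W ] B)}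
        {# (N[ X ] W ∖ W)} {_} {# W} {φ} {n ∸ suc φ})
      (J A B (W⊆X ∘ A⊆) (W⊆X ∘ B⊆) K≤A K≤B disj ap) (#-mono (∪-⊆ (cover A A⊆ ∪ˡ) (cover B B⊆ ∪ʳ)))
          (#-∪ _ (N[ X ] W ∖ W)) (#-∖⊆ (λ i → N-self (W⊆X i) i)) boundary φ<n
      where
      cover : ∀ C → C ⊆ W → N[ W ] C ⊆ N[ W ] A ∪ N[ W ] B → N[ X ] C ⊆ (N[ W ] A ∪ N[ W ] B) ∪ (N[ X ] W ∖ W)
      cover C C⊆ sub {x} i with x ∈? W
      ... | yes w = ∪ˡ (sub (N⁺ w (proj₂ (N⁻ i))))
      ... | no x∉ = ∪ʳ (∖⁺ (N-mono id C⊆ i) x∉)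

  main : ⊥
  main = region L 0 X id K≤X X≤ (≤-trans (#-mono N⊆) (≤-reflexive (sym (+-identityʳ _))))
    ((lin129 {K} {φ} {n} {τ} {L * (τ + τ)}) big τ≤φ 1≤K (*-distribˡ-+ L τ τ)) contradict

-- Numerical estimates

⌈n/2⌉-double : ∀ n → ⌈ n /2⌉ + ⌈ n /2⌉ ≤ suc n
⌈n/2⌉-double zero = z≤n
⌈n/2⌉-double (suc zero) = ≤-refl
⌈n/2⌉-double (suc (suc n)) = (lin130 {⌈ n /2⌉} {n}) (⌈n/2⌉-double n)

⌈log₂⌉-step : ∀ n → 2 ^ ⌈log₂ suc (suc n) ⌉ ≡ 2 ^ ⌈log₂ ⌈ suc (suc n) /2⌉ ⌉ + 2 ^ ⌈log₂ ⌈ suc (suc n) /2⌉ ⌉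
⌈log₂⌉-step n = double ⌈log₂ suc (suc n) ⌉ _ (⌈log₂⌉-mono-≤ {2} {suc (suc n)} (s≤s (s≤s z≤n)))
    (⌈log₂⌈n/2⌉⌉≡⌈log₂n⌉∸1 (suc (suc n)))
  where
  double : ∀ e e′ → 1 ≤ e → e′ ≡ e ∸ 1 → 2 ^ e ≡ 2 ^ e′ + 2 ^ e′
  double (suc e) .e _ refl = cong (2 ^ e +_) (+-identityʳ (2 ^ e))

-- The summand 2 in the upper bound absorbs the rounding of n/2 and so keeps the induction going.
⌈log₂⌉-bounds : ∀ fuel n → n ≤ fuel → n ≤ 2 ^ ⌈log₂ n ⌉ × (2 ≤ n → 2 + 2 ^ ⌈log₂ n ⌉ ≤ n + n)
⌈log₂⌉-bounds fuel zero _ = z≤n , λ ()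
⌈log₂⌉-bounds fuel (suc zero) _ = m^n>0 2 ⌈log₂ 1 ⌉ , λ { (s≤s ()) }
⌈log₂⌉-bounds (suc fuel) (suc (suc n)) (s≤s le) = lower , λ _ → upper
  where
  m : ℕ
  m = ⌈ suc (suc n) /2⌉
  ih : m ≤ 2 ^ ⌈log₂ m ⌉ × (2 ≤ m → 2 + 2 ^ ⌈log₂ m ⌉ ≤ m + m)
  ih = ⌈log₂⌉-bounds fuel m (≤-trans (s≤s⁻¹ (⌈n/2⌉<n n)) le)
  lower : suc (suc n) ≤ 2 ^ ⌈log₂ suc (suc n) ⌉
  lower = (lin131 {⌊ suc (suc n) /2⌋} {m} {_} {2 ^ ⌈log₂ m ⌉})
    (⌊n/2⌋≤⌈n/2⌉ (suc (suc n))) (⌊n/2⌋+⌈n/2⌉≡n (suc (suc n))) (proj₁ ih) (⌈log₂⌉-step n)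
  upper : 2 + 2 ^ ⌈log₂ suc (suc n) ⌉ ≤ suc (suc n) + suc (suc n)
  upper with 2 ≤? m
  ... | yes 2≤m = (lin132 {2 ^ ⌈log₂ m ⌉} {m} {2 ^ ⌈log₂ suc (suc n) ⌉} {suc (suc n)}) (proj₂ ih 2≤m) (⌈log₂⌉-step n)
      (⌈n/2⌉-double (suc (suc n)))
  ... | no m<2 = base n m<2
    where
    base : ∀ n → ¬ (2 ≤ ⌈ suc (suc n) /2⌉) → 2 + 2 ^ ⌈log₂ suc (suc n) ⌉ ≤ suc (suc n) + suc (suc n)
    base zero _ = ≤-refl
    base (suc _) m<2 = ⊥-elim (m<2 (s≤s (s≤s z≤n)))

n≤2^⌈log₂n⌉ : ∀ n → n ≤ 2 ^ ⌈log₂ n ⌉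
n≤2^⌈log₂n⌉ n = proj₁ (⌈log₂⌉-bounds n n ≤-refl)

2^⌈log₂n⌉≤2n+1 : ∀ n → 2 ^ ⌈log₂ n ⌉ ≤ suc (n + n)
2^⌈log₂n⌉≤2n+1 zero = ≤-refl
2^⌈log₂n⌉≤2n+1 (suc zero) = s≤s z≤n
2^⌈log₂n⌉≤2n+1 n@(suc (suc _)) = (lin133 {2 ^ ⌈log₂ n ⌉} {n}) (proj₂ (⌈log₂⌉-bounds n n ≤-refl) (s≤s (s≤s z≤n)))

2^⌈log₂n⌉≤2n : ∀ n → 1 ≤ n → 2 ^ ⌈log₂ n ⌉ ≤ n + n
2^⌈log₂n⌉≤2n (suc zero) _ = s≤s z≤n
2^⌈log₂n⌉≤2n n@(suc (suc _)) _ = (lin134 {2 ^ ⌈log₂ n ⌉} {n}) (proj₂ (⌈log₂⌉-bounds n n ≤-refl) (s≤s (s≤s z≤n)))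

n<2^n : ∀ n → n < 2 ^ n
n<2^n zero = s≤s z≤n
n<2^n (suc n) = (lin135 {_} {2 ^ n}) (n<2^n n)

n*n≤2*2^n : ∀ n → n * n ≤ 2 * 2 ^ n
n*n≤2*2^n zero = z≤n
n*n≤2*2^n (suc n) = (lin136 {n * n} {2 ^ n} {n}) (n*n≤2*2^n n) (n<2^n n) (*-suc n n)

fullCost≤ : ∀ e → 2 + fullCost e ≤ 2 * 2 ^ e
fullCost≤ zero = ≤-refl
fullCost≤ (suc e) = (lin137 {fullCost e} {2 ^ e}) (fullCost≤ e)

groupCost≤ : ∀ h m → groupCost h m ≤ h + 4 * m
groupCost≤ h m = (lin138 {h ∸ ⌈log₂ m ⌉} {h} {fullCost ⌈log₂ m ⌉} {2 ^ ⌈log₂ m ⌉} {m})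
  (m∸n≤m h ⌈log₂ m ⌉) (fullCost≤ ⌈log₂ m ⌉) (2^⌈log₂n⌉≤2n+1 m)

groupCosts≤ : ∀ h ms → sum (map (groupCost h) ms) ≤ length ms * h + 4 * sum ms
groupCosts≤ h [] = z≤n
groupCosts≤ h (m ∷ ms) = (lin139 {groupCost h m} {h} {m} {sum (map (groupCost h) ms)} {length ms * h} {sum ms})
    (groupCost≤ h m) (groupCosts≤ h ms)

sum-++ : ∀ (f : ℕ → ℕ) l r → sum (map f (l ++ r)) ≡ sum (map f l) + sum (map f r)
sum-++ f [] r = refl
sum-++ f (x ∷ l) r = trans (cong (f x +_) (sum-++ f l r)) (sym (+-assoc (f x) _ _))

cost≤ : ∀ h i ms → 2 + cost h i ms ≤ 2 * 2 ^ i + sum (map (groupCost h) ms)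
cost≤ h zero ms = ≤-refl
cost≤ h (suc i) ms = (lin140 {cost h i (take (2 ^ i) ms)} {2 ^ i} {sum (map (groupCost h) (take (2 ^ i) ms))}
    {cost h i (drop (2 ^ i) ms)} {sum (map (groupCost h) (drop (2 ^ i) ms))} {sum (map (groupCost h) ms)})
  (cost≤ h i (take (2 ^ i) ms)) (cost≤ h i (drop (2 ^ i) ms))
      (trans (cong (λ l → sum (map (groupCost h) l)) (sym (take++drop≡id (2 ^ i) ms)))
      (sum-++ (groupCost h) (take (2 ^ i) ms) _))

module Estimates (K L : ℕ) (1≤K : 1 ≤ K) (1≤L : 1 ≤ L) (2^L≤2K : 2 ^ L ≤ K + K) where

  h M d t u z : ℕ
  h = ⌈log₂ K ⌉
  M = K * L
  -- Each adjuster of the second kind widens the window by 2h + 1, so d + 1 of them suffice for 2K.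
  d = (K + K) / suc (h + h)
  t = suc d
  u = suc ((h + suc L) + (h + suc L))
  z = 2 + (h + h) * u + t * u

  K≤M : K ≤ M
  K≤M = ≤-trans (≤-reflexive (sym (*-identityʳ K))) (*-monoʳ-≤ K 1≤L)

  2^h≤2K : 2 ^ h ≤ K + K
  2^h≤2K = 2^⌈log₂n⌉≤2n K 1≤K

  h≤2K : h ≤ 2 * K
  h≤2K = (lin141 {_} {_} {K}) (n<2^n h) 2^h≤2K

  window : K + K ≤ (h + h) + t * suc (h + h)
  window = (lin142 {_} {(K + K) % suc (h + h)} {d * suc (h + h)} {h + h}) (m≡m%n+[m/n]*n (K + K) (suc (h + h)))
      (m%n<n (K + K) (suc (h + h)))

  -- Split `u` into 2h + 1 and 2L + 2. Multiplied by `d`, the first part is at most 2K and the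
  -- second at most 2K(2L + 2). The square of `h` is at most 2 · 2^h ≤ 4K, so no factor h is left.
  z≤ : z ≤ 57 * M
  z≤ = (lin143 {(h + h) * u} {h * h} {h * L} {h} {t * u} {d * suc (h + h)} {L} {d * (L + L + 2)} {2 ^ h} {K} {M}
      {(2 * K) * (L + L + 2)})
    (solve 2 (λ h L → (h :+ h) :* (con 1 :+ ((h :+ (con 1 :+ L)) :+ (h :+ (con 1 :+ L)))) := con 4 :* (h :* h) :+ con
        4 :* (h :* L) :+ con 6 :* h) refl h L)
    (solve 3 (λ h L d → (con 1 :+ d) :* (con 1 :+ ((h :+ (con 1 :+ L)) :+ (h :+ (con 1 :+ L)))) := (con 1 :+ (h :+ h))
        :+ d :* (con 1 :+ (h :+ h)) :+ (L :+ L :+ con 2) :+ d :* (L :+ L :+ con 2)) refl h L d)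
    (n*n≤2*2^n h) 2^h≤2K h≤2K (≤-trans (*-monoˡ-≤ L h≤2K) (≤-reflexive (*-assoc 2 K L)))
        (m/n*n≤m (K + K) (suc (h + h)))
    (*-monoˡ-≤ (L + L + 2) (≤-trans (m/n≤m (K + K) (suc (h + h))) (≤-reflexive (cong (K +_) (sym (+-identityʳ K))))))
    (solve 2 (λ K L → (con 2 :* K) :* (L :+ L :+ con 2) := con 4 :* (K :* L) :+ con 4 :* K) refl K L)
    K≤M (≤-trans (≤-reflexive (sym (*-identityˡ L))) (*-monoˡ-≤ L 1≤K)) 1≤K
    where open +-*-Solver

  -- Write h as about L plus the logarithm of K / 2^L. The latter is at most 1 + K / 2^L, and times
  -- 2^L this is at most 2^L + K. Estimating 2^L by 2K alone would leave a factor log K.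
  2^L*h≤ : 2 ^ L * h ≤ 2 * M + 3 * K
  2^L*h≤ = (lin144 {2 ^ L * h} {_} {2 ^ L * L} {2 ^ L} {K / 2 ^ L * 2 ^ L} {_} {M} {K})
    (*-monoʳ-≤ (2 ^ L) h≤) (solve 3 (λ p L e → p :* (L :+ (con 1 :+ e)) := p :* L :+ (p :+ e :* p)) refl (2 ^ L) L
        (K / 2 ^ L))
    (*-monoˡ-≤ L 2^L≤2K) (*-distribʳ-+ L K K) (m/n*n≤m K (2 ^ L)) 2^L≤2K
    where
    open +-*-Solver
    instance
      2^L≢0 : NonZero (2 ^ L)
      2^L≢0 = m^n≢0 2 L
    a₀ : ℕ
    a₀ = suc (K / 2 ^ L)
    K≤ : K ≤ 2 ^ (L + a₀)
    K≤ = (lin145 {_} {K % 2 ^ L} {K / 2 ^ L * 2 ^ L} {2 ^ L} {_} {2 ^ L * 2 ^ a₀} {2 ^ L * a₀})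
      (m≡m%n+[m/n]*n K (2 ^ L)) (m%n<n K (2 ^ L)) (^-distribˡ-+-* 2 L a₀) (*-monoʳ-≤ (2 ^ L) (<⇒≤ (n<2^n a₀)))
          (*-comm (2 ^ L) a₀)
    h≤ : h ≤ L + a₀
    h≤ = ≤-trans (⌈log₂⌉-mono-≤ K≤) (≤-reflexive (⌈log₂2^n⌉≡n (L + a₀)))

  cost-bound : ∀ ms → sum ms ≤ K → length ms ≤ 2 ^ L → suc (cost h L ms) ≤ 13 * M
  cost-bound ms sum≤ len≤ = (lin146 {cost h L ms} {2 ^ L} {sum (map (groupCost h) ms)} {length ms * h} {sum ms}
      {2 ^ L * h} {K} {M})
    (cost≤ h L ms) (groupCosts≤ h ms) (*-monoˡ-≤ h len≤) sum≤ 2^L*h≤ 2^L≤2K K≤M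

-- The induction on the number of colour classes

module Induction {N : ℕ} (G : Graph N) (K L n : ℕ) (1≤K : 1 ≤ K) (1≤L : 1 ≤ L) (2^L≤2K : 2 ^ L ≤ K + K)
  (big : 50 * (100 * (K * (L * L))) ≤ n) (noC : Basics.NoCycle G n) where
  open Basics G
  open Estimates K L 1≤K 1≤L 2^L≤2K

  -- The last class only needs room for itself, so it should be a smallest one.
  need : ℕ → List ℕ → ℕ
  need m [] = m
  need m (m′ ∷ ms) = (n ∸ 1) + need m′ ms

  -- In units of `M`, the flexible path takes 57 and a search tree 13, and 3K are needed for joining
  -- the ends: 80 suffices. Another 6K separates `τ` from `β`, and the 100 in `big` covers K + L τ.
  -- With the factor 50 of the tight case this gives 5000.
  β τ : ℕ
  β = 80 * M
  τ = 86 * M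

  big′ : 50 * (K + L * τ) ≤ n
  big′ = ≤-trans (*-monoʳ-≤ 50 ((lin147 {K} {K * (L * L)} {L * τ})
      (≤-trans (≤-reflexive (sym (*-identityʳ K))) (*-monoʳ-≤ K (*-mono-≤ 1≤L 1≤L)))
      (solve 2 (λ K L → L :* (con 86 :* (K :* L)) := con 86 :* (K :* (L :* L))) refl K L))) big
    where open +-*-Solver

  K<n : K < n
  K<n = (lin148 {K} {L * τ}) big′ 1≤K

  n≡ : suc (n ∸ 1) ≡ n
  n≡ = m+[n∸m]≡n {1} (≤-trans (s≤s z≤n) K<n)

  need≤ : ∀ m ms → m + sum ms ≤ K → need m ms ≤ length (m ∷ ms) * n
  need≤ m [] le = (lin149 {m} {_} {n}) le K<n
  need≤ m (m′ ∷ ms) le = (lin150 {n ∸ 1} {n} {need m′ ms} {length (m′ ∷ ms) * n}) n≡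
      (need≤ m′ ms (≤-trans (m≤n+m _ m) le))

  all-small : ∀ ms → sum ms ≤ K → All (λ m → ⌈log₂ m ⌉ ≤ h × m ≤ 2 ^ ⌈log₂ m ⌉) ms
  all-small [] _ = []
  all-small (m ∷ ms) le = (⌈log₂⌉-mono-≤ (≤-trans (m≤m+n m _) le) , n≤2^⌈log₂n⌉ m) ∷ all-small ms
      (≤-trans (m≤n+m _ m) le)

  hole : ∀ m ms X → m + sum ms ≤ K → length (m ∷ ms) ≤ 2 ^ L → need m ms ≤ # X → (Hole (m ∷ ms) X → ⊥) → ⊥
  hole m [] X _ _ le k = k (X , id , le , tt)
  -- Cutting `X₀` down to exactly the required size bounds |X| by 2^L n and thereby the number of
  -- halvings.
  hole m (m′ ∷ ms) X₀ sum≤ len≤ le k with X , X⊆ , #X ← subset-of-size {A = X₀} (need m (m′ ∷ ms)) le =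
    Main.main G X K h L t z β τ n (m ∷ m′ ∷ ms) 1≤K E J noHole noC sum≤ len≤ (all-small (m ∷ m′ ∷ ms) sum≤) 1≤L refl
      ((lin151 {z} {M} {cost h L (m ∷ m′ ∷ ms)}) z≤ (cost-bound (m ∷ m′ ∷ ms) sum≤ len≤))
      ((lin152 {z} {M} {K}) z≤ K≤M)
      ((lin153 {K} {M}) K≤M)
      window big′
      ((lin154 {_} {n ∸ 1} {need m′ ms}) #X n≡ K<n)
      (≤-trans (≤-reflexive #X) (≤-trans (need≤ m (m′ ∷ ms) sum≤) (*-monoˡ-≤ n len≤)))
    where
    noHole : Hole (m ∷ m′ ∷ ms) X → ⊥
    noHole H = k (Hole-mono (m ∷ m′ ∷ ms) X⊆ H)
    E : ∀ A → A ⊆ X → K ≤ # A → n ≤ # (N[ X ] A)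
    E A A⊆ K≤A = ≮⇒≥ λ lt → hole m′ ms (X ∖ N[ X ] A) (≤-trans (m≤n+m _ m) sum≤) (≤-trans (n≤1+n _) len≤)
      ((lin155 {_} {n ∸ 1} {need m′ ms} {_} {# (N[ X ] A)} {# (X ∖ N[ X ] A)}) #X n≡ lt (#-∖ X (N[ X ] A)))
      (λ H → noHole (A , A⊆ , ≤-trans (m≤m+n m _) (≤-trans sum≤ K≤A) , H))
    J : ∀ A B → A ⊆ X → B ⊆ X → K ≤ # A → K ≤ # B → (∀ {x} → x ∈ A → x ∉ B) → Apart A B → n + n ≤ suc
        (# (N[ X ] A ∪ N[ X ] B))
    J A B A⊆ B⊆ K≤A K≤B disj ap = ≮⇒≥ λ lt → two-classes ms sum≤ len≤ #X lt noHole
      where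
      X₁ : Sub N
      X₁ = X ∖ N[ X ] A
      B⊆₁ : B ⊆ X₁
      B⊆₁ b = ∖⁺ (B⊆ b) (λ i → case proj₂ (N⁻ i) of λ { (inj₁ a) → disj a b ; (inj₂ (_ , a , e)) → ap a b e })
      two-classes : ∀ ms → m + (m′ + sum ms) ≤ K → length (m ∷ m′ ∷ ms) ≤ 2 ^ L → # X ≡ need m (m′ ∷ ms) → suc
          (# (N[ X ] A ∪ N[ X ] B)) < n + n → (Hole (m ∷ m′ ∷ ms) X → ⊥) → ⊥
      two-classes [] sum≤ _ _ _ none = none (A , A⊆ , ≤-trans (m≤m+n m _) (≤-trans sum≤ K≤A) , B , B⊆₁ , ≤-trans
          (≤-trans (m≤m+n m′ 0) (m≤n+m _ m)) (≤-trans sum≤ K≤B) , tt)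
      two-classes (m″ ∷ ms) sum≤ len≤ #X lt none = hole m″ ms (X ∖ (N[ X ] A ∪ N[ X ] B))
          (≤-trans (≤-trans (m≤n+m _ m′) (m≤n+m _ m)) sum≤) (≤-trans (≤-trans (n≤1+n _) (n≤1+n _)) len≤)
        ((lin156 {_} {n ∸ 1} {need m″ ms} {n} {# (N[ X ] A ∪ N[ X ] B)} {# (X ∖ (N[ X ] A ∪ N[ X ] B))}) #X n≡ lt
            (#-∖ X _))
        (λ H → none (A , A⊆ , ≤-trans (m≤m+n m _) (≤-trans sum≤ K≤A) , B , B⊆₁ , ≤-trans
            (≤-trans (m≤m+n m′ _) (m≤n+m _ m)) (≤-trans sum≤ K≤B) ,
          Hole-mono (m″ ∷ ms) (λ i → let j , x∉ = ∖⁻ i in ∖⁺ (∖⁺ j (λ q → x∉ (∪ˡ q))) (λ q → x∉ (∪ʳ (N⁺ j (proj₂ (N⁻ q)))))) H))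

-- Embeddings of graphs

extend : ∀ {a b : ℕ} → Fin b → (Fin a → Fin b) → Fin (suc a) → Fin b
extend x f zero = x
extend x f (suc i) = f i

any-function? : ∀ a {b} {P : (Fin a → Fin b) → Set} → (∀ {f g} → (∀ i → f i ≡ g i) → P f → P g) → (∀ f → Dec (P f)) →
    Dec (∃ P)
any-function? zero resp P? with P? (λ ())
... | yes p = yes (_ , p)
... | no n = no (λ (f , p) → n (resp (λ ()) p))
any-function? (suc a) {P = P} resp P? with any?
    (λ x → any-function? a {P = λ f → P (extend x f)} (λ e → resp (λ { zero → refl ; (suc i) → e i }))
    (λ f → P? (extend x f)))
... | yes (x , f , p) = yes (extend x f , p)
... | no n = no (λ (f , p) → n (f zero , f ∘ suc , resp (λ { zero → refl ; (suc i) → refl }) p))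

_⊆G?_ : ∀ {a b} (F : Graph a) (G : Graph b) → Dec (F ⊆G G)
_⊆G?_ {a} {b} F G = map′
    (λ (f , p) → f , (λ {i} {j} e → proj₁ (p i j) e) , λ i j → proj₂ (p i j))
    (λ (f , inj , hom) → f , λ i j → inj , hom i j)
    (any-function? a {P = λ f → ∀ i j → (f i ≡ f j → i ≡ j) × (T (adj F i j) → T (adj G (f i) (f j)))}
      (λ e p i j → (λ q → proj₁ (p i j) (trans (e i) (trans q (sym (e j))))) ,
        λ t → subst T (cong₂ (adj G) (e i) (e j)) (proj₂ (p i j) t))
      (λ f → all? λ i → all? λ j → ((f i ≟ f j) →-dec (i ≟ j)) ×-dec (T? (adj F i j) →-dec T? (adj G (f i) (f j)))))

compl⁺ : ∀ {N} (G : Graph N) {i j} → i ≢ j → ¬ T (adj G i j) → T (adj (compl G) i j)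
compl⁺ G {i} {j} i≢j n with i ≟ j
... | yes e = i≢j e
... | no _ with adj G i j
...   | true = n tt
...   | false = tt

compl⁻ : ∀ {N} (G : Graph N) {i j} → T (adj (compl G) i j) → i ≢ j × ¬ T (adj G i j)
compl⁻ G {i} {j} t with i ≟ j
... | no i≢j with adj G i j
...   | false = i≢j , λ ()

-- For a cycle the default is its first vertex: position n, just past the end of the list, then
-- means the return to the start.
at : {A : Set} → A → List A → ℕ → A
at d [] _ = d
at d (x ∷ l) zero = x
at d (x ∷ l) (suc i) = at d l i

at∈ : {A : Set} (d : A) (l : List A) {i : ℕ} → i < length l → at d l i ∈ˡ l
at∈ d (x ∷ l) {zero} _ = here refl
at∈ d (x ∷ l) {suc i} (s≤s p) = there (at∈ d l p)

at-injective : {A : Set} (d : A) (l : List A) → Unique l → ∀ {i j} → i < length l → j < length l → at d l i ≡ at d l j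
    → i ≡ j
at-injective d (x ∷ l) (h ∷ u) {zero} {zero} _ _ _ = refl
at-injective d (x ∷ l) (h ∷ u) {zero} {suc j} _ (s≤s q) e = ⊥-elim (All.lookup h (at∈ d l q) e)
at-injective d (x ∷ l) (h ∷ u) {suc i} {zero} (s≤s p) _ e = ⊥-elim (All.lookup h (at∈ d l p) (sym e))
at-injective d (x ∷ l) (h ∷ u) {suc i} {suc j} (s≤s p) (s≤s q) e = cong suc (at-injective d l u p q e)

at-end : {A : Set} (d : A) (l : List A) → at d l (length l) ≡ d
at-end d [] = refl
at-end d (x ∷ l) = at-end d l

module CycleEmbedding {N : ℕ} (G : Graph N) where
  open Basics G

  at-Ch : ∀ d l → Ch (l ++ [ d ]) → ∀ {i} → i < length l → at d l i ~ at d l (suc i)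
  at-Ch d (x ∷ []) (e , _) {zero} _ = e
  at-Ch d (x ∷ y ∷ l) (e , _) {zero} _ = e
  at-Ch d (x ∷ y ∷ l) (_ , c) {suc i} (s≤s p) = at-Ch d (y ∷ l) c p
  at-Ch d (x ∷ []) _ {suc i} (s≤s ())

  no-cycle : ∀ n (n≥3 : 3 ≤ n) → ¬ (Cycle n n≥3 ⊆G G) → NoCycle n
  no-cycle n n≥3 none x r u c refl = none (f ,
      (λ {i} {j} e → toℕ-injective (at-injective x (x ∷ r) u (toℕ<n i) (toℕ<n j) e)) , λ i j t → edges i j
      (Equivalence.to T-∨ t))
    where
    f : Fin n → V
    f i = at x (x ∷ r) (toℕ i)
    Step : Fin n → Fin n → Bool
    Step i j = (suc (toℕ i) ≡ᵇ toℕ j) ∨ ((toℕ j ≡ᵇ 0) ∧ (suc (toℕ i) ≡ᵇ n))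
    one : ∀ i j → T (Step i j) → f i ~ f j
    one i j t with Equivalence.to T-∨ t
    ... | inj₁ e = subst (λ y → f i ~ at x (x ∷ r) y) (≡ᵇ⇒≡ (suc (toℕ i)) (toℕ j) e) (at-Ch x (x ∷ r) c (toℕ<n i))
    ... | inj₂ e with e₀ , e₁ ← Equivalence.to T-∧ e = subst (f i ~_)
      (trans (cong (at x (x ∷ r)) (≡ᵇ⇒≡ (suc (toℕ i)) n e₁))
          (trans (at-end x (x ∷ r)) (cong (at x (x ∷ r)) (sym (≡ᵇ⇒≡ (toℕ j) 0 e₀)))))
      (at-Ch x (x ∷ r) c (toℕ<n i))
    edges : ∀ i j → T (Step i j) ⊎ T (Step j i) → f i ~ f j
    edges i j (inj₁ t) = one i j t
    edges i j (inj₂ t) = ~-sym (one j i t)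

-- Injections between sets

choose : {B : Set} {n : ℕ} → Fin n → B → (Fin n → B) → Fin n → B
choose v b g w with w ≟ v
... | yes _ = b
... | no _ = g w

injection : ∀ {a b} (d : Fin b) j (S : Sub a) (A : Sub b) → # S ≤ j → # S ≤ # A →
  Σ[ g ∈ (Fin a → Fin b) ] (∀ {v} → v ∈ S → g v ∈ A) × (∀ {v w} → v ∈ S → w ∈ S → g v ≡ g w → v ≡ w)
injection d j S A S≤j S≤A with 1 ≤? # S
injection d j S A S≤j S≤A | no n = (λ _ → d) , (λ i → ⊥-elim (n (∈⇒1≤# i))) , λ i → ⊥-elim (n (∈⇒1≤# i))
injection d zero S A S≤j S≤A | yes 1≤S = ⊥-elim (1+n≰n (≤-trans 1≤S S≤j))
injection {a} {b} d (suc j) S A S≤j S≤A | yes 1≤S with v , v∈ ← pick {A = S} 1≤S | y , y∈ ← pick {A = A}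
    (≤-trans 1≤S S≤A) = result
  where
  #S : # S ≡ # ⁅ v ⁆ + # (S ∖ ⁅ v ⁆)
  #S = #-∖⊆ {A = S} (λ i → subst (_∈ S) (sym (⁅⁆⁻ i)) v∈)
  #A : # A ≡ # ⁅ y ⁆ + # (A ∖ ⁅ y ⁆)
  #A = #-∖⊆ {A = A} (λ i → subst (_∈ A) (sym (⁅⁆⁻ i)) y∈)
  IH : Σ[ g ∈ (Fin a → Fin b) ] (∀ {w} → w ∈ S ∖ ⁅ v ⁆ → g w ∈ A ∖ ⁅ y ⁆) ×
      (∀ {w x} → w ∈ S ∖ ⁅ v ⁆ → x ∈ S ∖ ⁅ v ⁆ → g w ≡ g x → w ≡ x)
  IH = injection d j (S ∖ ⁅ v ⁆) (A ∖ ⁅ y ⁆)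
    ((lin157 {_} {# ⁅ v ⁆} {# (S ∖ ⁅ v ⁆)}) #S (#-⁅⁆ v) S≤j)
    ((lin158 {_} {# ⁅ v ⁆} {# (S ∖ ⁅ v ⁆)} {_} {# ⁅ y ⁆} {# (A ∖ ⁅ y ⁆)}) #S (#-⁅⁆ v) #A (#-⁅⁆ y) S≤A)
  g₀ : Fin a → Fin b
  g₀ = proj₁ IH
  minus : ∀ {w} → w ∈ S → w ≢ v → w ∈ S ∖ ⁅ v ⁆
  minus i n = ∖⁺ i (λ j → n (⁅⁆⁻ j))
  into : ∀ {w} → w ∈ S → choose v y g₀ w ∈ A
  into {w} i with w ≟ v
  ... | yes _ = y∈
  ... | no n = ∖⊆ (proj₁ (proj₂ IH) (minus i n))
  apart : ∀ {w} → w ∈ S → w ≢ v → g₀ w ≢ y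
  apart i n e = proj₂ (∖⁻ (proj₁ (proj₂ IH) (minus i n))) (subst (_∈ ⁅ y ⁆) (sym e) ⁅⁆⁺)
  inj : ∀ {w x} → w ∈ S → x ∈ S → choose v y g₀ w ≡ choose v y g₀ x → w ≡ x
  inj {w} {x} i j e with w ≟ v | x ≟ v
  ... | yes refl | yes refl = refl
  ... | yes _ | no n = ⊥-elim (apart j n (sym e))
  ... | no n | yes _ = ⊥-elim (apart i n e)
  ... | no m | no n = proj₂ (proj₂ IH) (minus i m) (minus j n) e
  result : Σ[ g ∈ (Fin a → Fin b) ] (∀ {v} → v ∈ S → g v ∈ A) × (∀ {v w} → v ∈ S → w ∈ S → g v ≡ g w → v ≡ w)
  result = choose v y g₀ , into , inj

#-injective : ∀ {a b} (g : Fin a → Fin b) j {S : Sub a} {A : Sub b} → # S ≤ j → (∀ {v} → v ∈ S → g v ∈ A) →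
    (∀ {v w} → v ∈ S → w ∈ S → g v ≡ g w → v ≡ w) → # S ≤ # A
#-injective g j {S} {A} S≤j into inj with 1 ≤? # S
#-injective g j {S} {A} S≤j into inj | no n = ≤-trans (s≤s⁻¹ (≰⇒> n)) z≤n
#-injective g zero {S} {A} S≤j into inj | yes 1≤S = ⊥-elim (1+n≰n (≤-trans 1≤S S≤j))
#-injective g (suc j) {S} {A} S≤j into inj | yes 1≤S with v , v∈ ← pick {A = S} 1≤S =
  (lin159 {_} {# ⁅ v ⁆} {# (S ∖ ⁅ v ⁆)} {_} {# ⁅ g v ⁆} {# (A ∖ ⁅ g v ⁆)}) #S (#-⁅⁆ v)
      (#-∖⊆ {A = A} (λ i → subst (_∈ A) (sym (⁅⁆⁻ i)) (into v∈))) (#-⁅⁆ (g v))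
    (#-injective g j ((lin157 {_} {# ⁅ v ⁆} {# (S ∖ ⁅ v ⁆)}) #S (#-⁅⁆ v) S≤j)
      (λ {w} i → ∖⁺ (into (∖⊆ i)) (λ e → proj₂ (∖⁻ i) (subst (_∈ ⁅ v ⁆) (inj v∈ (∖⊆ i) (sym (⁅⁆⁻ e))) ⁅⁆⁺)))
      (λ i j → inj (∖⊆ i) (∖⊆ j)))
  where
  #S : # S ≡ # ⁅ v ⁆ + # (S ∖ ⁅ v ⁆)
  #S = #-∖⊆ {A = S} (λ i → subst (_∈ S) (sym (⁅⁆⁻ i)) v∈)

-- Colour classes

module Colouring {k q : ℕ} (c : Fin k → Fin q) where

  class : Fin q → Sub k
  class x = set (filter (λ v → c v ≟ x) (allFin k))

  class⁺ : ∀ {x v} → c v ≡ x → v ∈ class x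
  class⁺ {x} {v} e = set⁺ (∈-filter⁺ (λ w → c w ≟ x) (∈-allFin v) e)

  class⁻ : ∀ {x v} → v ∈ class x → c v ≡ x
  class⁻ {x} i = proj₂ (∈-filter⁻ (λ w → c w ≟ x) {xs = allFin k} (set⁻ i))

  #-class : ∀ x → # (class x) ≡ classSize c x
  #-class x = #-set (Unique.filter⁺ (λ v → c v ≟ x) (Unique.allFin⁺ k))

  coloured : List (Fin q) → Sub k
  coloured cs = sep (λ v → ∈-list? _≟_ (c v) cs)

  sizes≤ : ∀ cs → Unique cs → sum (map (classSize c) cs) ≤ # (coloured cs)
  sizes≤ [] _ = z≤n
  sizes≤ (x ∷ cs) (h ∷ u) = (lin160 {# (class x)} {classSize c x} {sum (map (classSize c) cs)} {# (coloured cs)})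
    (#-class x) (sizes≤ cs u) (#-⊎ (λ i j → All.lookup h (sep⁻ (λ v → ∈-list? _≟_ (c v) cs) j) (sym (class⁻ i))))
    (#-mono (∪-⊆ (λ i → sep⁺ (λ v → ∈-list? _≟_ (c v) (x ∷ cs)) (here (class⁻ i)))
        (λ i → sep⁺ (λ v → ∈-list? _≟_ (c v) (x ∷ cs)) (there (sep⁻ (λ v → ∈-list? _≟_ (c v) cs) i)))))

  others : Fin q → List (Fin q)
  others x = filter (λ y → ¬? (y ≟ x)) (allFin q)

  -- `x` stands for a smallest class and comes last, since `need` grants the last class only its own
  -- size.
  colours : Fin q → List (Fin q)
  colours x = others x ++ [ x ]

  colours-unique : ∀ x → Unique (colours x)
  colours-unique x = ∉⇒Unique-∷ʳ (Unique.filter⁺ (λ y → ¬? (y ≟ x)) (Unique.allFin⁺ q))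
      (λ i → proj₂ (∈-filter⁻ (λ y → ¬? (y ≟ x)) {xs = allFin q} i) refl)

  ∈-colours : ∀ x y → y ∈ˡ colours x
  ∈-colours x y with y ≟ x
  ... | yes refl = ∈-++⁺ʳ (others x) (here refl)
  ... | no n = ∈-++⁺ˡ (∈-filter⁺ (λ y → ¬? (y ≟ x)) (∈-allFin y) n)

  length-colours : ∀ x → length (colours x) ≡ q
  length-colours x = trans (sym (#-set (colours-unique x)))
      (trans (≤-antisym (#≤n _) (≤-trans (≤-reflexive (sym #-full)) (#-mono (λ {y} _ → set⁺ (∈-colours x y))))) refl)

  module _ {N : ℕ} (G : Graph N) (d : Fin N) where
    open Basics G

    place-classes : ∀ cs X → Hole (map (classSize c) cs) X → Σ[ f ∈ (Fin k → V) ]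
      (∀ {v} → c v ∈ˡ cs → f v ∈ X) × (∀ {v w} → c v ∈ˡ cs → c w ∈ˡ cs → f v ≡ f w → v ≡ w) ×
          (∀ {v w} → c v ∈ˡ cs → c w ∈ˡ cs → c v ≢ c w → ¬ (f v ~ f w))
    place-classes [] X _ = (λ _ → d) , (λ ()) , (λ ()) , λ ()
    place-classes (x ∷ cs) X (A , A⊆X , le , H)
      with f , f-in , f-inj , f-apart ← place-classes cs (X ∖ N[ X ] A) H
         | g , g-in , g-inj ← injection d (# (class x)) (class x) A ≤-refl (≤-trans (≤-reflexive (#-class x)) le) = F
             , in-X , inj , apart
      where
      F : Fin k → V
      F v with c v ≟ x
      ... | yes _ = g v
      ... | no _ = f v
      rest : ∀ {v} → c v ∈ˡ x ∷ cs → c v ≢ x → c v ∈ˡ cs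
      rest (here e) n = ⊥-elim (n e)
      rest (there i) _ = i
      in-X : ∀ {v} → c v ∈ˡ x ∷ cs → F v ∈ X
      in-X {v} i with c v ≟ x
      ... | yes e = A⊆X (g-in (class⁺ e))
      ... | no n = ∖⊆ (f-in (rest i n))
      cross : ∀ {v w} → c v ≡ x → c w ∈ˡ cs → g v ≢ f w × ¬ (g v ~ f w)
      cross e i with f∈ , f∉ ← ∖⁻ (f-in i) = (λ eq → f∉ (N-self f∈ (subst (_∈ A) eq (g-in (class⁺ e))))) , λ ad → f∉
          (N-adj f∈ (g-in (class⁺ e)) ad)
      inj : ∀ {v w} → c v ∈ˡ x ∷ cs → c w ∈ˡ x ∷ cs → F v ≡ F w → v ≡ w
      inj {v} {w} i j e with c v ≟ x | c w ≟ x
      ... | yes p | yes q = g-inj (class⁺ p) (class⁺ q) e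
      ... | yes p | no n = ⊥-elim (proj₁ (cross p (rest j n)) e)
      ... | no n | yes p = ⊥-elim (proj₁ (cross p (rest i n)) (sym e))
      ... | no m | no n = f-inj (rest i m) (rest j n) e
      apart : ∀ {v w} → c v ∈ˡ x ∷ cs → c w ∈ˡ x ∷ cs → c v ≢ c w → ¬ (F v ~ F w)
      apart {v} {w} i j n e with c v ≟ x | c w ≟ x
      ... | yes p | yes q = n (trans p (sym q))
      ... | yes p | no m = proj₂ (cross p (rest j m)) e
      ... | no m | yes p = proj₂ (cross p (rest i m)) (~-sym e)
      ... | no l | no m = f-apart (rest i l) (rest j m) n e

    hole⇒embedding : ∀ (H : Graph k) → (∀ i j → T (adj H i j) → c i ≢ c j) → ∀ cs → (∀ y → y ∈ˡ cs) → Hole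
        (map (classSize c) cs) full → H ⊆G compl G
    hole⇒embedding H proper cs all hole with f , _ , inj , apart ← place-classes cs full hole =
      f , (λ {i} {j} → inj (all (c i)) (all (c j))) , λ i j t → compl⁺ G
          (λ e → proper i j t (cong c (inj (all _) (all _) e))) (apart (all _) (all _) (proper i j t))

upper-bound : ∀ {k} (H : Graph k) q s n L (n≥3 : 3 ≤ n) → (pc : ProperColouring H (suc (suc q))) → ∀ x → classSize
    (proj₁ pc) x ≡ s →
  1 ≤ k → 1 ≤ L → 2 ^ L ≤ k + k → suc (suc q) ≤ 2 ^ L → 50 * (100 * (k * (L * L))) ≤ n → RamseyProperty (Cycle n n≥3)
      H (suc q * (n ∸ 1) + s)
upper-bound {k} H q s n L n≥3 (c , proper) x size 1≤k 1≤L 2^L≤ q≤2^L big G with Cycle n n≥3 ⊆G? G | H ⊆G? compl G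
... | yes p | _ = inj₁ p
... | no _ | yes p = inj₂ p
... | no p | no ¬H = ⊥-elim (run (others x) refl)
  where
  open Colouring c
  open Basics G
  sz : List (Fin (suc (suc q))) → List ℕ
  sz = map (classSize c)
  open Induction G k L n 1≤k 1≤L 2^L≤ big (CycleEmbedding.no-cycle G n n≥3 p)
  need-∷ʳ : ∀ m ms a → need m (ms ++ [ a ]) ≡ suc (length ms) * (n ∸ 1) + a
  need-∷ʳ m [] a = cong (_+ a) (sym (+-identityʳ (n ∸ 1)))
  need-∷ʳ m (m′ ∷ ms) a = trans (cong ((n ∸ 1) +_) (need-∷ʳ m′ ms a)) (sym (+-assoc (n ∸ 1) _ a))
  sum≤ : sum (sz (colours x)) ≤ k
  sum≤ = ≤-trans (sizes≤ (colours x) (colours-unique x)) (#≤n _)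
  -- A default vertex for maps that are so far defined on no class; it exists because n ≥ 3.
  d : Fin (suc q * (n ∸ 1) + s)
  d = fromℕ< {0} (≤-trans (∸-monoˡ-≤ 1 (≤-trans (s≤s (s≤s z≤n)) n≥3))
      (≤-trans (m≤m+n (n ∸ 1) (q * (n ∸ 1))) (m≤m+n _ s)))
  run : ∀ os → os ≡ others x → ⊥
  run [] e = case trans (cong (λ l → length (l ++ [ x ])) e) (length-colours x) of λ ()
  run (y ∷ ys) e = hole (classSize c y) (map (classSize c) ys ++ [ classSize c x ]) full
      (subst (λ l → sum l ≤ k) (sym sizes≡) sum≤)
      (subst (λ l → length l ≤ 2 ^ L) (sym sizes≡)
          (≤-trans (≤-reflexive (trans (length-map (classSize c) (colours x)) (length-colours x))) q≤2^L))
      (≤-reflexive (trans (need-∷ʳ (classSize c y) (map (classSize c) ys) (classSize c x))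
          (trans (cong₂ (λ a b → suc a * (n ∸ 1) + b) (trans (length-map (classSize c) ys) len-ys) size)
          (sym #-full))))
      (λ H′ → ¬H (hole⇒embedding G d H proper (colours x) (∈-colours x) (subst (λ l → Hole l full) sizes≡ H′)))
    where
    sizes≡ : classSize c y ∷ map (classSize c) ys ++ [ classSize c x ] ≡ sz (colours x)
    sizes≡ = trans (sym (map-++ (classSize c) (y ∷ ys) [ x ])) (cong (λ l → sz (l ++ [ x ])) e)
    len-ys : length ys ≡ q
    len-ys = (lin161 {length (ys ++ [ x ])} {q} {length ys})
        (trans (cong (λ l → length (l ++ [ x ])) e) (length-colours x)) (length-++ ys)

-- The lower bound by disjoint cliques.

#-tail : ∀ {N} a → # {N} (sep (λ i → a ≤? toℕ i)) ≤ N ∸ a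
#-tail {N} a with N ∸ a in eq
... | zero = ≤-reflexive (empty⇒#≡0 (λ {i} p → <⇒≱ (≤-trans (toℕ<n i) (m∸n≡0⇒m≤n eq)) (sep⁻ (λ i → a ≤? toℕ i) p)))
... | suc m = ≤-trans (#-injective g N {A = full} (#≤n _) (λ _ → full⁺) inj) (≤-reflexive #-full)
  where
  P? : ∀ (i : Fin N) → Dec (toℕ i ∸ a < suc m)
  P? i = toℕ i ∸ a <? suc m
  g : Fin N → Fin (suc m)
  g i with P? i
  ... | yes p = fromℕ< p
  ... | no _ = zero
  g≡ : ∀ {i} → i ∈ sep (λ i → a ≤? toℕ i) → toℕ (g i) ≡ toℕ i ∸ a
  g≡ {i} p with P? i
  ... | yes q = toℕ-fromℕ< q
  ... | no n = ⊥-elim (n (subst (toℕ i ∸ a <_) eq (∸-monoˡ-< (toℕ<n i) (sep⁻ (λ i → a ≤? toℕ i) p))))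
  inj : ∀ {i j} → i ∈ sep (λ i → a ≤? toℕ i) → j ∈ sep (λ i → a ≤? toℕ i) → g i ≡ g j → i ≡ j
  inj {i} {j} p q e = toℕ-injective (∸-cancelʳ-≡ (sep⁻ (λ i → a ≤? toℕ i) p) (sep⁻ (λ i → a ≤? toℕ i) q)
      (trans (sym (g≡ p)) (trans (cong toℕ e) (g≡ q))))

module Blocks (N q p : ℕ) .{{_ : NonZero p}} (N< : N < suc q * p) where

  block : Fin N → Fin (suc q)
  block i = fromℕ< (m<n*o⇒m/o<n {toℕ i} {suc q} {p} (<-trans (toℕ<n i) N<))

  toℕ-block : ∀ i → toℕ (block i) ≡ toℕ i / p
  toℕ-block i = toℕ-fromℕ< (m<n*o⇒m/o<n {toℕ i} {suc q} {p} (<-trans (toℕ<n i) N<))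

  Same? : ∀ i j → Dec (block i ≡ block j × i ≢ j)
  Same? i j = (block i ≟ block j) ×-dec ¬? (i ≟ j)

  blocks : Graph N
  blocks = record
    { adj = λ i j → does (Same? i j)
    ; sym = λ i j → does-⇔ (mk⇔ (λ (e , n) → sym e , n ∘ sym) (λ (e , n) → sym e , n ∘ sym)) (Same? i j) (Same? j i)
    ; irrefl = λ i → dec-false (Same? i i) (λ (_ , n) → n refl) }

  -- Consecutive vertices of the cycle share a block, hence all of them do. Within a block the
  -- remainders modulo `p` tell vertices apart, and there are only p < n of them.
  no-long-cycle : ∀ n (n≥3 : 3 ≤ n) → p < n → ¬ (Cycle n n≥3 ⊆G blocks)
  no-long-cycle n n≥3 p<n (f , inj , hom) with i , j , i<j , e ← pigeonhole p<n (λ i → fromℕ< (m%n<n (toℕ (f i)) p)) =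
    <-irrefl (cong toℕ (inj {i} {j} (toℕ-injective equal))) i<j
    where
    consecutive : ∀ {i j} → suc (toℕ i) ≡ toℕ j → block (f i) ≡ block (f j)
    consecutive {i} {j} e = proj₁ (does⁻ (Same? (f i) (f j))
        (hom i j (Equivalence.from T-∨ (inj₁ (Equivalence.from T-∨ (inj₁ (≡⇒≡ᵇ _ _ e)))))))
    first : ∀ a (i : Fin n) → toℕ i ≡ a → ∀ (z : Fin n) → toℕ z ≡ 0 → block (f i) ≡ block (f z)
    first zero i e z e₀ = cong (λ x → block (f x)) (toℕ-injective (trans e (sym e₀)))
    first (suc a) i e z e₀ = trans (sym (consecutive (trans (cong suc (toℕ-fromℕ< a<n)) (sym e))))
        (first a (fromℕ< a<n) (toℕ-fromℕ< a<n) z e₀)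
      where
      a<n : a < n
      a<n = ≤-trans (≤-reflexive (sym e)) (<⇒≤ (toℕ<n i))
    z : Fin n
    z = fromℕ< (≤-trans (s≤s z≤n) n≥3)
    z≡ : toℕ z ≡ 0
    z≡ = toℕ-fromℕ< (≤-trans (s≤s z≤n) n≥3)
    quotients : toℕ (f i) / p ≡ toℕ (f j) / p
    quotients = trans (sym (toℕ-block (f i)))
        (trans (cong toℕ (trans (first (toℕ i) i refl z z≡) (sym (first (toℕ j) j refl z z≡)))) (toℕ-block (f j)))
    remainders : toℕ (f i) % p ≡ toℕ (f j) % p
    remainders = trans (sym (toℕ-fromℕ< _)) (trans (cong toℕ e) (toℕ-fromℕ< _))
    equal : toℕ (f i) ≡ toℕ (f j)
    equal = trans (m≡m%n+[m/n]*n (toℕ (f i)) p)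
        (trans (cong₂ (λ r d → r + d * p) remainders quotients) (sym (m≡m%n+[m/n]*n (toℕ (f j)) p)))

  colouring : ∀ {k} {H : Graph k} → ((f , _) : H ⊆G compl blocks) → ∀ i j → T (adj H i j) → block (f i) ≢ block (f j)
  colouring (f , inj , hom) i j t e with n , a ← compl⁻ blocks (hom i j t) = a (does⁺ (Same? (f i) (f j)) (e , n))

  last-class : ∀ {k} (f : Fin k → Fin N) → (∀ {i j} → f i ≡ f j → i ≡ j) → classSize (block ∘ f) (fromℕ q) ≤ N ∸ q * p
  last-class {k} f inj = ≤-trans (≤-reflexive (sym (#-class (fromℕ q))))
      (≤-trans (#-injective f k {A = sep (λ i → q * p ≤? toℕ i)} (#≤n _)
      (λ {v} i → sep⁺ (λ i → q * p ≤? toℕ i) (≤-trans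
          (*-monoˡ-≤ p (≤-reflexive (trans (sym (toℕ-fromℕ q))
          (trans (cong toℕ (sym (class⁻ i))) (toℕ-block (f v)))))) (m/n*n≤m (toℕ (f v)) p))) (λ _ _ → inj))
          (#-tail (q * p)))
    where open Colouring (block ∘ f)

-- An embedding of `H` in the complement colours `H` properly by blocks. The last block has fewer
-- than `s` vertices, and is empty if N < q p, so its colour class is smaller than every colour
-- class may be.
lower-bound : ∀ {k} (H : Graph k) q s n (n≥3 : 3 ≤ n) →
    (∀ (pc : ProperColouring H (suc q)) → ∀ x → s ≤ classSize (proj₁ pc) x) → 1 ≤ s → s < n →
  ∀ N → N < q * (n ∸ 1) + s → ¬ RamseyProperty (Cycle n n≥3) H N
lower-bound H q s 1 (s≤s ())
lower-bound {k} H q s (suc (suc p′)) n≥3 least 1≤s (s≤s s≤p) N N< ramsey = decide (ramsey blocks)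
  where
  p : ℕ
  p = suc p′
  open Blocks N q p (≤-trans N< (≤-trans (+-monoʳ-≤ (q * p) s≤p) (≤-reflexive (+-comm (q * p) p))))
  decide : (Cycle (suc p) n≥3 ⊆G blocks) ⊎ (H ⊆G compl blocks) → ⊥
  decide (inj₁ C) = no-long-cycle (suc p) n≥3 ≤-refl C
  decide (inj₂ E@(f , inj , _)) with q * p ≤? N
  ... | yes le = (lin162 {s} {_} {N ∸ q * p} {q * p}) (least (block ∘ f , colouring {H = H} E) (fromℕ q))
      (last-class f inj) (m+[n∸m]≡n le) N<
  ... | no gt = 1+n≰n (≤-trans 1≤s (≤-trans (least (block ∘ f , colouring {H = H} E) (fromℕ q))
      (≤-trans (last-class f inj) (≤-reflexive (m≤n⇒m∸n≡0 (<⇒≤ (≰⇒> gt)))))))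

-- From the two bounds to the theorem.

chromatic≤order : ∀ {k} (H : Graph k) q → ChromaticNumberIs H q → q ≤ k
chromatic≤order {k} H q (_ , least) = ≮⇒≥ λ k<q → least k k<q (id , λ { i j t refl → subst T (irrefl H i) t })

-- A colour that does not occur could be removed by `punchOut`, leaving a colouring with fewer
-- colours.
class-nonempty : ∀ {k} (H : Graph k) q → ChromaticNumberIs H (suc q) → ((c , _) : ProperColouring H (suc q)) → ∀ x → 1
    ≤ classSize c x
class-nonempty {k} H q (_ , least) (c , proper) x = ≰⇒> λ empty → least q ≤-refl
    ((λ v → punchOut (avoid empty v)) , λ i j t e → proper i j t
        (punchOut-injective (avoid empty i) (avoid empty j) e))
  where
  open Colouring c
  avoid : classSize c x ≤ 0 → ∀ v → x ≢ c v
  avoid empty v e = 1+n≰n (≤-trans (∈⇒1≤# {A = class x} (class⁺ (sym e))) (≤-trans (≤-reflexive (#-class x)) empty))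

-- A graph with chromatic number 1 has no edges, so only the number of vertices matters.
edgeless : ∀ {k} (H : Graph k) s n (n≥3 : 3 ≤ n) → ((c , _) : ProperColouring H 1) → classSize c zero ≡ s →
    RamseyNumberIs (Cycle n n≥3) H s
edgeless {k} H s n n≥3 (c , proper) size = upper , lower
  where
  open Colouring c
  only : ∀ (y : Fin 1) → y ≡ zero
  only zero = refl
  k≡s : k ≡ s
  k≡s = trans (sym (#-full {k})) (trans (≤-antisym (#-mono (λ {v} _ → class⁺ (only (c v))))
      (≤-trans (#≤n _) (≤-reflexive (sym #-full)))) (trans (#-class zero) size))
  upper : RamseyProperty (Cycle n n≥3) H s
  upper G = inj₂ (cast k≡s , (λ {i} {j} e → toℕ-injective
      (trans (sym (toℕ-cast k≡s i)) (trans (cong toℕ e) (toℕ-cast k≡s j)))) ,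
    λ i j t → ⊥-elim (proper i j t (trans (only (c i)) (sym (only (c j))))))
  lower : ∀ N → N < s → ¬ RamseyProperty (Cycle n n≥3) H N
  lower N N<s ramsey with ramsey record { adj = λ _ _ → false ; sym = λ _ _ → refl ; irrefl = λ _ → refl }
  ... | inj₁ (f , _ , hom) = hom (fromℕ< 0<n) (fromℕ< 1<n)
      (Equivalence.from T-∨ (inj₁ (Equivalence.from T-∨
      (inj₁ (≡⇒≡ᵇ (suc (toℕ (fromℕ< 0<n))) (toℕ (fromℕ< 1<n))
      (trans (cong suc (toℕ-fromℕ< 0<n)) (sym (toℕ-fromℕ< 1<n))))))))
    where
    1<n : 1 < n
    1<n = ≤-trans (s≤s (s≤s z≤n)) n≥3
    0<n : 0 < n
    0<n = <⇒≤ 1<n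
  ... | inj₂ (f , inj , _) with i , j , i<j , e ← pigeonhole (subst (N <_) (sym k≡s) N<s) f = <-irrefl
      (cong toℕ (inj e)) i<j

enough : ∀ k L n → 1 ≤ L → 5000 * k * (L ^ 4) ≤ n → 50 * (100 * (k * (L * L))) ≤ n
enough k L n 1≤L large = ≤-trans (≤-reflexive regroup) (≤-trans (*-monoʳ-≤ (5000 * k) L*L≤L^4) large)
  where
  regroup : 50 * (100 * (k * (L * L))) ≡ 5000 * k * (L * L)
  regroup = trans (sym (*-assoc 50 100 (k * (L * L))))
      (trans (cong (_* (k * (L * L))) (*-comm 50 100)) (sym (*-assoc 5000 k (L * L))))
  L*L≤L^4 : L * L ≤ L ^ 4
  L*L≤L^4 = *-monoʳ-≤ L (≤-trans (≤-reflexive (sym (*-identityʳ L)))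
      (*-monoʳ-≤ L (*-mono-≤ 1≤L (*-mono-≤ 1≤L (≤-refl {1})))))

order<n : ∀ k L n → 1 ≤ k → 1 ≤ L → 50 * (100 * (k * (L * L))) ≤ n → k < n
order<n k L n 1≤k 1≤L big = (lin163 {_} {k * (L * L)} {100 * (k * (L * L))}) 1≤k
  (≤-trans (≤-reflexive (sym (*-identityʳ k))) (*-monoʳ-≤ k (*-mono-≤ 1≤L 1≤L))) big (m≤m+n _ (99 * (k * (L * L))))

theorem1p2 : Σ ℕ λ C → 0 < C ×
    (∀ {k} (H : Graph k) (q s : ℕ) → ChromaticNumberIs H q → SigmaIs H q s →
    ∀ (n : ℕ) (n≥3 : 3 ≤ n) → C * k * (⌈log₂ q ⌉ ^ 4) ≤ n →
    RamseyNumberIs (Cycle n n≥3) H ((q ∸ 1) * (n ∸ 1) + s))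
theorem1p2 = 5000 , s≤s z≤n , λ H q s χ σ n n≥3 large → good H q s ⌈log₂ q ⌉ refl χ σ n n≥3 large
  where
  good : ∀ {k} (H : Graph k) (q s L : ℕ) → ⌈log₂ q ⌉ ≡ L → ChromaticNumberIs H q → SigmaIs H q s →
    ∀ (n : ℕ) (n≥3 : 3 ≤ n) → 5000 * k * (L ^ 4) ≤ n → RamseyNumberIs (Cycle n n≥3) H ((q ∸ 1) * (n ∸ 1) + s)
  good H zero s L _ χ ((_ , () , _) , _) n n≥3 large
  -- The logarithm is 0 here, so the size condition gives no information and n is only known to be
  -- at least 3.
  good H 1 s L _ χ ((pc , zero , size) , _) n n≥3 large = edgeless H s n n≥3 pc size
  good {k} H (suc (suc q)) s L eq χ ((pc , x , size) , least) n n≥3 large =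
      upper-bound H q s n L n≥3 pc x size 1≤k 1≤L
          (≤-trans (≤-reflexive (cong (2 ^_) (sym eq)))
          (≤-trans (2^⌈log₂n⌉≤2n (suc (suc q)) (s≤s z≤n)) (+-mono-≤ q≤k q≤k)))
        (≤-trans (n≤2^⌈log₂n⌉ (suc (suc q))) (≤-reflexive (cong (2 ^_) eq))) (enough k L n 1≤L large) ,
      lower-bound H (suc q) s n n≥3 least (subst (1 ≤_) size (class-nonempty H (suc q) χ pc x)) s<n
    where
    q≤k : suc (suc q) ≤ k
    q≤k = chromatic≤order H (suc (suc q)) χ
    1≤k : 1 ≤ k
    1≤k = ≤-trans (s≤s z≤n) q≤k
    1≤L : 1 ≤ L
    1≤L = ≤-trans (⌈log₂⌉-mono-≤ {2} {suc (suc q)} (s≤s (s≤s z≤n))) (≤-reflexive eq)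
    s<n : s < n
    s<n = ≤-trans (s≤s (≤-trans (≤-reflexive (trans (sym size) (sym (Colouring.#-class (proj₁ pc) x)))) (#≤n _)))
        (order<n k L n 1≤k 1≤L (enough k L n 1≤L large))
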